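{- Let $\mathcal{G},\mathcal{H}$ be graph classes, where $\mathcal{G}$ contains $K_2$. Then $\mathcal{H}$ is $(c^{\mathcal{G}}_{\mathrm u},c^{\mathcal{G}}_{\mathrm l})$-bounded provided one of the following holds: (1) $\mathcal{G}$ is hereditary and has bounded maximum average degree; (2) $\mathcal{G}$ is hereditary and $\mathcal{H}$ has bounded chromatic number; (3) $\mathcal{G}$ is component-closed and $\mathcal{H}$ has bounded treewidth. Moreover, in each of the following cases there exist graph classes $\mathcal{G}$ (containing $K_2$) and $\mathcal{H}$ satisfying the stated conditions such that $\mathcal{H}$ is not $(c^{\mathcal{G}}_{\mathrm u},c^{\mathcal{G}}_{\mathrm l})$-bounded: (a) $\mathcal{G}$ is monotone and has bounded chromatic number; (b) $\mathcal{G}$ is component-closed and $\mathcal{H}$ is $M$-minor-free for some graph $M$; (c) $\mathcal{H}$ has bounded treewidth.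
   Context: All graphs are finite and simple. For graphs $G,H$, a homomorphism $\varphi\colon G\to H$ is a map $V(G)\to V(H)$ with $\varphi(u)\varphi(v)\in E(H)$ whenever $uv\in E(G)$. $\dot\cup$ denotes vertex-disjoint union. For a graph class $\mathcal{G}$ and a graph $H$, a $\mathcal{G}$-cover of $H$ is an edge-surjective homomorphism $\varphi\colon G_1\dot\cup\cdots\dot\cup G_t\to H$ with all $G_i\in\mathcal{G}$; it is called $t$-global, injective if each $\varphi|_{G_i}$ is injective, and $s$-local if $|\varphi^{ -1}(v)|\le s$ for all $v\in V(H)$. $\overline{\mathcal{G}}$ is the class of all vertex-disjoint unions of graphs in $\mathcal{G}$. $c^{\mathcal{G}}_{\mathrm u}(H)$ is the least $t$ such that $H$ has a $t$-global injective $\overline{\mathcal{G}}$-cover; $c^{\mathcal{G}}_{\mathrm l}(H)$ is the least $s$ such that $H$ has an $s$-local injective $\mathcal{G}$-cover. $\mathcal{H}$ is $(c^{\mathcal{G}}_{\mathrm u},c^{\mathcal{G}}_{\mathrm l})$-bounded if there is $f\colon\mathbb{N}\to\mathbb{R}_{\ge0}$ with $c^{\mathcal{G}}_{\mathrm l}(H)\le c^{\mathcal{G}}_{\mathrm u}(H)\le f(c^{\mathcal{G}}_{\mathrm l}(H))$ for all $H\in\mathcal{H}$. A class is monotone if closed under subgraphs, hereditary if closed under induced subgraphs, component-closed if every connected component of every member is a member, $M$-minor-free if no member contains $M$ as a minor. For a graph parameter $p$, a class has bounded $p$ if $\sup$ of $p$ over the class is finite. The maximum average degree is $\mathrm{mad}(G)=\max\{2|E(G')|/|V(G')|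 : G'\subseteq G,\ |V(G')|>0\}$. -}

module Defs where

open import Data.Nat using (ℕ; zero; suc; _+_; _*_; _≤_; _<_)
open import Data.Bool using (Bool; true; false; if_then_else_; not)
open import Data.Fin using (Fin; zero; suc; inject₁; fromℕ; _≟_)
open import Data.Maybe using (Maybe; just; nothing)
open import Data.Product using (Σ; ∃; ∃-syntax; _×_; _,_)
open import Data.Unit using (⊤)
open import Relation.Nullary using (¬_; yes; no)
open import Relation.Nullary.Decidable using (⌊_⌋)
open import Relation.Binary.PropositionalEquality using (_≡_; _≢_; refl)
open import Function.Definitions using (Injective)

countFin : ∀ {n} → (Fin n → Bool) → ℕ
countFin {zero} p = 0
countFin {suc n} p = (if p zero then 1 else 0) + countFin {n} (λ i → p (suc i))

sumFin : ∀ {n} → (Fin n → ℕ) → ℕ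
sumFin {zero} f = 0
sumFin {suc n} f = f zero + sumFin {n} (λ i → f (suc i))

record Graph : Set where
  field
    n      : ℕ
    adj    : Fin n → Fin n → Bool
    adj-sym    : ∀ u v → adj u v ≡ adj v u
    adj-irrefl : ∀ v → adj v v ≡ false
open Graph public

V : Graph → Set
V G = Fin (n G)

E : (G : Graph) → V G → V G → Set
E G u v = adj G u v ≡ true

twiceEdges : Graph → ℕ
twiceEdges G = sumFin (λ u → countFin (adj G u))

K₂ : Graph
K₂ = record { n = 2 ; adj = λ u v → not ⌊ u ≟ v ⌋ ; adj-sym = s ; adj-irrefl = i }
  where
  s : ∀ (u v : Fin 2) → not ⌊ u ≟ v ⌋ ≡ not ⌊ v ≟ u ⌋
  s zero zero = refl
  s zero (suc zero) = refl
  s (suc zero) zero = refl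
  s (suc zero) (suc zero) = refl
  i : ∀ (v : Fin 2) → not ⌊ v ≟ v ⌋ ≡ false
  i zero = refl
  i (suc zero) = refl

IsHom : (G H : Graph) → (V G → V H) → Set
IsHom G H f = ∀ u v → E G u v → E H (f u) (f v)

Iso : Graph → Graph → Set
Iso G H = Σ (V G → V H) λ f → Σ (V H → V G) λ g →
  (∀ x → g (f x) ≡ x) × (∀ y → f (g y) ≡ y) × (∀ u v → adj G u v ≡ adj H (f u) (f v))

SubgraphEmb : (Y X : Graph) → (V Y → V X) → Set
SubgraphEmb Y X e = Injective _≡_ _≡_ e × IsHom Y X e

InducedEmb : (Y X : Graph) → (V Y → V X) → Set
InducedEmb Y X e = Injective _≡_ _≡_ e × (∀ a b → adj Y a b ≡ adj X (e a) (e b))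

data ReachIn (G : Graph) (P : V G → Set) : V G → V G → Set where
  here : ∀ {u} → P u → ReachIn G P u u
  step : ∀ {u w v} → P u → E G u w → ReachIn G P w v → ReachIn G P u v

Connected : Graph → Set
Connected G = ∀ u v → ReachIn G (λ _ → ⊤) u v

IsComponent : (Y X : Graph) → Set
IsComponent Y X = Σ (V Y → V X) λ e → InducedEmb Y X e × (0 < n Y) × Connected Y ×
  (∀ a x → E X (e a) x → ∃ λ b → e b ≡ x)

record GraphClass : Set₁ where
  field
    mem : Graph → Set
    iso-closed : ∀ {X Y} → Iso X Y → mem X → mem Y
open GraphClass public

Monotone : GraphClass → Set
Monotone 𝒞 = ∀ X Y (e : V Y → V X) → mem 𝒞 X → SubgraphEmb Y X e → mem 𝒞 Y

Hereditary : GraphClass → Set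
Hereditary 𝒞 = ∀ X Y (e : V Y → V X) → mem 𝒞 X → InducedEmb Y X e → mem 𝒞 Y

ComponentClosed : GraphClass → Set
ComponentClosed 𝒞 = ∀ X Y → mem 𝒞 X → IsComponent Y X → mem 𝒞 Y

MadAtMost : Graph → ℕ → Set
MadAtMost X d = ∀ Y (e : V Y → V X) → SubgraphEmb Y X e → 0 < n Y → twiceEdges Y ≤ d * n Y

BoundedMad : GraphClass → Set
BoundedMad 𝒞 = ∃ λ d → ∀ X → mem 𝒞 X → MadAtMost X d

Colourable : Graph → ℕ → Set
Colourable X k = Σ (V X → Fin k) λ c → ∀ u v → E X u v → c u ≢ c v

BoundedChromatic : GraphClass → Set
BoundedChromatic 𝒞 = ∃ λ k → ∀ X → mem 𝒞 X → Colourable X k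

HasCycle : Graph → Set
HasCycle T = Σ ℕ λ k → Σ (Fin (suc (suc (suc k))) → V T) λ c → Injective _≡_ _≡_ c ×
  (∀ i → E T (c (inject₁ i)) (c (suc i))) × E T (c (fromℕ (suc (suc k)))) (c zero)

IsTree : Graph → Set
IsTree T = (0 < n T) × Connected T × ¬ HasCycle T

record TreeDecomp (X : Graph) (w : ℕ) : Set where
  field
    T      : Graph
    isTree : IsTree T
    bag    : V T → V X → Bool
    vcover : ∀ x → ∃ λ t → bag t x ≡ true
    ecover : ∀ x y → E X x y → ∃ λ t → bag t x ≡ true × bag t y ≡ true
    subtree : ∀ x t₁ t₂ → bag t₁ x ≡ true → bag t₂ x ≡ true →
              ReachIn T (λ t → bag t x ≡ true) t₁ t₂
    width  : ∀ t → countFin (bag t) ≤ suc w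

BoundedTreewidth : GraphClass → Set
BoundedTreewidth 𝒞 = ∃ λ w → ∀ X → mem 𝒞 X → TreeDecomp X w

-- M is a minor of X (via branch sets β⁻¹(m))
IsMinor : (M X : Graph) → Set
IsMinor M X = Σ (V X → Maybe (V M)) λ β →
  (∀ m → ∃ λ x → β x ≡ just m) ×
  (∀ m x y → β x ≡ just m → β y ≡ just m → ReachIn X (λ z → β z ≡ just m) x y) ×
  (∀ a b → E M a b → ∃ λ x → ∃ λ y → E X x y × β x ≡ just a × β y ≡ just b)

MinorFree : Graph → GraphClass → Set
MinorFree M 𝒞 = ∀ X → mem 𝒞 X → ¬ IsMinor M X

UnionV : ∀ {k} → (Fin k → Graph) → Set
UnionV {k} Ys = Σ (Fin k) λ i → V (Ys i)

unionAdj : ∀ {k} (Ys : Fin k → Graph) → UnionV Ys → UnionV Ys → Bool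
unionAdj Ys (i , a) (j , b) with i ≟ j
... | yes refl = adj (Ys i) a b
... | no _ = false

InBar : GraphClass → Graph → Set
InBar 𝒢 X = Σ ℕ λ k → Σ (Fin k → Graph) λ Ys → (∀ i → mem 𝒢 (Ys i)) ×
  Σ (UnionV Ys → V X) λ to → Σ (V X → UnionV Ys) λ from →
  (∀ p → from (to p) ≡ p) × (∀ x → to (from x) ≡ x) ×
  (∀ p q → adj X (to p) (to q) ≡ unionAdj Ys p q)

-- Injective covers: φ : G₁ ∪̇ ... ∪̇ Gₜ → H given componentwise

record InjCover (P : Graph → Set) (H : Graph) : Set where
  field
    t    : ℕ
    comp : Fin t → Graph
    inP  : ∀ i → P (comp i)
    φ    : ∀ i → V (comp i) → V H
    hom  : ∀ i → IsHom (comp i) H (φ i)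
    edge-surj : ∀ u v → E H u v →
      ∃ λ i → ∃ λ a → ∃ λ b → E (comp i) a b × φ i a ≡ u × φ i b ≡ v
    inj  : ∀ i → Injective _≡_ _≡_ (φ i)
open InjCover public

preimageSize : ∀ {P H} → InjCover P H → V H → ℕ
preimageSize C v = sumFin (λ i → countFin (λ a → ⌊ φ C i a ≟ v ⌋))

HasGlobalCover : GraphClass → Graph → ℕ → Set
HasGlobalCover 𝒢 H s = Σ (InjCover (InBar 𝒢) H) λ C → t C ≡ s

HasLocalCover : GraphClass → Graph → ℕ → Set
HasLocalCover 𝒢 H s = Σ (InjCover (mem 𝒢) H) λ C → ∀ v → preimageSize C v ≤ s

IsCu : GraphClass → Graph → ℕ → Set
IsCu 𝒢 H t = HasGlobalCover 𝒢 H t × (∀ t' → t' < t → ¬ HasGlobalCover 𝒢 H t')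

IsCl : GraphClass → Graph → ℕ → Set
IsCl 𝒢 H s = HasLocalCover 𝒢 H s × (∀ s' → s' < s → ¬ HasLocalCover 𝒢 H s')

Bounded : GraphClass → GraphClass → Set
Bounded 𝒢 ℋ = ∃ λ (f : ℕ → ℕ) → ∀ H → mem ℋ H → ∀ s t → IsCl 𝒢 H s → IsCu 𝒢 H t →
  s ≤ t × t ≤ f s

{-# OPTIONS --safe #-}
-- Positive part. Number the preimages of every vertex of H in an s-local cover by labels below s. If H is k-coloured,
-- a function g from colours to labels selects at most one preimage of each vertex, and the s ^ k choices of g give the
-- global cover. Bounded maximum average degree of the members makes H degenerate, hence of bounded chromatic number.
-- For bounded treewidth split the members into components; these trace subtrees of the decomposition tree, few of
-- them through each node, so their intersection graph is degenerate and its colour classes form the global cover.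
--
-- Negative part. (a) Shift graphs have a 2-local cover by bipartite graphs but large chromatic number. (b), (c) Put a
-- tree-like gadget at each position of an m × m array such that any copy of a gadget in the resulting graph sits at its
-- own position. The i-th member consists of row i and column i. Every vertex lies in at most two members, any two
-- members meet, and members are needed to cover the many edges at the gadgets' centres, so m of them appear in any
-- global cover, each in a different graph. Joining the gadgets along the grid makes members connected; not joining
-- them gives forests. The grid has no K₅ minor by a winding number argument modulo 2.
module Submission where

open import Defs
open import Data.Nat using (ℕ; zero; suc; _+_; _*_; _∸_; _^_; _≤_; _<_; z≤n; s≤s; z<s; _≤?_; _<?_; _≡ᵇ_; _<ᵇ_)
import Data.Nat.Properties as ℕₚ
open import Data.Bool using (Bool; true; false; if_then_else_; not; _∧_; _∨_; _xor_)
import Data.Bool.Properties as Boolₚ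
open import Data.Fin as Fin using (Fin; zero; suc; toℕ; inject≤; inject₁; fromℕ; fromℕ<; _↑ˡ_; _↑ʳ_; splitAt; combine; remQuot; finToFun; funToFin; _≟_)
import Data.Fin.Properties as Finₚ
open import Data.Fin.Relation.Unary.Top using (view; ‵fromℕ; ‵inject₁)
open import Data.Maybe using (Maybe; just; nothing)
import Data.Maybe.Properties as Maybeₚ
open import Data.Fin.Induction using (<-weakInduction)
open import Data.Product using (Σ; ∃; _×_; _,_; proj₁; proj₂)
open import Data.Product.Properties using (≡-dec)
open import Data.List using (List; []; _∷_; cartesianProduct; allFin)
open import Data.List.Membership.Propositional using (_∈_)
open import Data.List.Membership.Propositional.Properties using (∈-cartesianProduct⁺; ∈-allFin)
open import Data.List.Relation.Unary.Any using (here; there)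
open import Axiom.UniquenessOfIdentityProofs.WithK using (uip)
open import Data.Nat.Induction using (<-rec)
open import Relation.Binary.Definitions using (tri<; tri≈; tri>)
open import Data.Sum using (_⊎_; inj₁; inj₂)
open import Data.Vec using (Vec; []; _∷_)
open import Data.Unit using (⊤; tt)
open import Data.Empty using (⊥; ⊥-elim)
open import Relation.Nullary using (¬_; Dec; yes; no; contradiction)
open import Relation.Nullary.Decidable using (⌊_⌋; _×-dec_; _⊎-dec_; ¬?; decidable-stable; map′)
open import Relation.Binary.PropositionalEquality using (_≡_; _≢_; refl; sym; trans; cong; cong₂; subst; subst₂)
open import Function using (_∘_)
open import Function.Definitions using (Injective)

-- Selecting single preimages needs a hereditary class. A class that is only component-closed allows
-- nothing finer than whole components, so for bounded treewidth the argument has to colour pieces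
-- instead. The bounds obtained are `s ^ k` for k colours, hence `s ^ suc (d * s)` for members of
-- maximum average degree at most d, and `suc (suc w * s)` for treewidth w. In (b) and (c) one class
-- must serve every m, so it holds the members of all sizes, and a global cover may draw on any of
-- them. Degrees exclude the wrong sizes: a larger member does not embed, and `K₂` and smaller
-- members carry too few edges at a star centre. Members i and i′ of the right size both occupy the
-- star centre at position (i , i′), so one graph of the cover cannot contain both as disjoint
-- summands. For the grid, a parity attached to the unit squares replaces the Jordan curve theorem:
-- it changes exactly when an edge used by the closed walk is crossed.

true≢false : true ≢ false
true≢false ()

¬true⇒false : ∀ {b} → b ≢ true → b ≡ false
¬true⇒false {true} ne = contradiction refl ne
¬true⇒false {false} ne = refl

⌊⌋-sound : ∀ {a} {A : Set a} (d : Dec A) → ⌊ d ⌋ ≡ true → A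
⌊⌋-sound (yes a) _ = a

⌊⌋-complete : ∀ {a} {A : Set a} (d : Dec A) → A → ⌊ d ⌋ ≡ true
⌊⌋-complete (yes _) _ = refl
⌊⌋-complete (no ¬a) a = contradiction a ¬a

∧-true : ∀ {a b} → a ∧ b ≡ true → a ≡ true × b ≡ true
∧-true {true} {true} _ = refl , refl

∨-true : ∀ {a b} → a ∨ b ≡ true → a ≡ true ⊎ b ≡ true
∨-true {true} _ = inj₁ refl
∨-true {false} e = inj₂ e

∨-trueʳ : ∀ a {b} → b ≡ true → a ∨ b ≡ true
∨-trueʳ true _ = refl
∨-trueʳ false e = e

true? : (b : Bool) → Dec (b ≡ true)
true? b = b Boolₚ.≟ true

bool-ext : ∀ {a b} → (a ≡ true → b ≡ true) → (b ≡ true → a ≡ true) → a ≡ b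
bool-ext {true} f g = sym (f refl)
bool-ext {false} {true} f g = g refl
bool-ext {false} {false} f g = refl

-- Enumerating finite subsets and finite sums

enum : ∀ {n} (p : Fin n → Bool) → Fin (countFin p) → Fin n
enum {suc n} p j with p zero
enum {suc n} p zero | true = zero
enum {suc n} p (suc j) | true = suc (enum (p ∘ suc) j)
enum {suc n} p j | false = suc (enum (p ∘ suc) j)

enum-true : ∀ {n} (p : Fin n → Bool) j → p (enum p j) ≡ true
enum-true {suc n} p j with p zero in eq
enum-true {suc n} p zero | true = eq
enum-true {suc n} p (suc j) | true = enum-true (p ∘ suc) j
enum-true {suc n} p j | false = enum-true (p ∘ suc) j

enum-injective : ∀ {n} (p : Fin n → Bool) → Injective _≡_ _≡_ (enum p)
enum-injective {suc n} p {i} {j} eq with p zero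
enum-injective {suc n} p {zero} {zero} eq | true = refl
enum-injective {suc n} p {suc i} {suc j} eq | true = cong suc (enum-injective (p ∘ suc) (Finₚ.suc-injective eq))
enum-injective {suc n} p {i} {j} eq | false = enum-injective (p ∘ suc) (Finₚ.suc-injective eq)

rank : ∀ {n} (p : Fin n → Bool) x → p x ≡ true → Fin (countFin p)
rank {suc n} p zero px with p zero
rank {suc n} p zero px | true = zero
rank {suc n} p (suc x) px with p zero
... | true = suc (rank (p ∘ suc) x px)
... | false = rank (p ∘ suc) x px

enum-rank : ∀ {n} (p : Fin n → Bool) x (px : p x ≡ true) → enum p (rank p x px) ≡ x
enum-rank {suc n} p zero px with p zero
enum-rank {suc n} p zero px | true = refl
enum-rank {suc n} p (suc x) px with p zero
... | true = cong suc (enum-rank (p ∘ suc) x px)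
... | false = cong suc (enum-rank (p ∘ suc) x px)

rank-injective : ∀ {n} (p : Fin n → Bool) {x y} px py → rank p x px ≡ rank p y py → x ≡ y
rank-injective p {x} {y} px py e =
  trans (sym (enum-rank p x px)) (trans (cong (enum p) e) (enum-rank p y py))

count-injection : ∀ {m n} (p : Fin m → Bool) (q : Fin n → Bool) (f : Fin m → Fin n) →
  (∀ x → p x ≡ true → q (f x) ≡ true) →
  (∀ x y → p x ≡ true → p y ≡ true → f x ≡ f y → x ≡ y) →
  countFin p ≤ countFin q
count-injection p q f pq inj = Finₚ.injective⇒≤ {f = g} g-inj
  where
  g : Fin (countFin p) → Fin (countFin q)
  g i = rank q (f (enum p i)) (pq _ (enum-true p i))
  g-inj : Injective _≡_ _≡_ g
  g-inj {i} {j} e = enum-injective p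
    (inj _ _ (enum-true p i) (enum-true p j) (rank-injective q _ _ e))

count-strict : ∀ {n} (p q : Fin n → Bool) x → (∀ y → p y ≡ true → q y ≡ true) →
  p x ≡ false → q x ≡ true → countFin p < countFin q
count-strict p q x p⊆q px qx = Finₚ.injective⇒≤ {f = g} g-inj
  where
  g : Fin (suc (countFin p)) → Fin (countFin q)
  g zero = rank q x qx
  g (suc i) = rank q (enum p i) (p⊆q _ (enum-true p i))
  g-inj : Injective _≡_ _≡_ g
  g-inj {zero} {zero} _ = refl
  g-inj {zero} {suc j} e = contradiction
    (trans (sym (enum-true p j)) (trans (cong p (sym (rank-injective q _ _ e))) px)) true≢false
  g-inj {suc i} {zero} e = contradiction
    (trans (sym (enum-true p i)) (trans (cong p (rank-injective q _ _ e)) px)) true≢false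
  g-inj {suc i} {suc j} e = cong suc (enum-injective p (rank-injective q _ _ e))

-- `Fin (sumFin f)` serves as the disjoint union of the `Fin (f i)`; `pair` and `unpair` are the two
-- directions of this bijection, through which injections into and out of sums are built.
pair : ∀ {k} (f : Fin k → ℕ) i → Fin (f i) → Fin (sumFin f)
pair f zero x = x ↑ˡ _
pair f (suc i) x = f zero ↑ʳ pair (f ∘ suc) i x

unpair : ∀ {k} (f : Fin k → ℕ) → Fin (sumFin f) → Σ (Fin k) (Fin ∘ f)
unpair {suc k} f j with splitAt (f zero) j
... | inj₁ x = zero , x
... | inj₂ y = suc (proj₁ (unpair (f ∘ suc) y)) , proj₂ (unpair (f ∘ suc) y)

unpair-pair : ∀ {k} (f : Fin k → ℕ) i x → unpair f (pair f i x) ≡ (i , x)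
unpair-pair {suc k} f zero x rewrite Finₚ.splitAt-↑ˡ (f zero) x (sumFin (f ∘ suc)) = refl
unpair-pair {suc k} f (suc i) x
  rewrite Finₚ.splitAt-↑ʳ (f zero) (sumFin (f ∘ suc)) (pair (f ∘ suc) i x)
        | unpair-pair (f ∘ suc) i x = refl

pair-unpair : ∀ {k} (f : Fin k → ℕ) j → pair f (proj₁ (unpair f j)) (proj₂ (unpair f j)) ≡ j
pair-unpair {suc k} f j with splitAt (f zero) j in eq
... | inj₁ x = Finₚ.splitAt⁻¹-↑ˡ {i = j} eq
... | inj₂ y = trans (cong (f zero ↑ʳ_) (pair-unpair (f ∘ suc) y)) (Finₚ.splitAt⁻¹-↑ʳ {i = j} eq)

pair-injective : ∀ {k} (f : Fin k → ℕ) {i j x y} → pair f i x ≡ pair f j y →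
  _≡_ {A = Σ (Fin k) (Fin ∘ f)} (i , x) (j , y)
pair-injective f {i} {j} {x} {y} e =
  trans (sym (unpair-pair f i x)) (trans (cong (unpair f) e) (unpair-pair f j y))

unpair-injective : ∀ {k} (f : Fin k → ℕ) → Injective _≡_ _≡_ (unpair f)
unpair-injective f {x} {y} e = trans (sym (pair-unpair f x))
  (trans (cong (λ p → pair f (proj₁ p) (proj₂ p)) e) (pair-unpair f y))

sum-mono : ∀ {k} (f g : Fin k → ℕ) → (∀ i → f i ≤ g i) → sumFin f ≤ sumFin g
sum-mono {zero} f g le = z≤n
sum-mono {suc k} f g le = ℕₚ.+-mono-≤ (le zero) (sum-mono _ _ (le ∘ suc))

sum-*ˡ : ∀ {k} d (f : Fin k → ℕ) → sumFin (λ i → d * f i) ≡ d * sumFin f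
sum-*ˡ {zero} d f = sym (ℕₚ.*-zeroʳ d)
sum-*ˡ {suc k} d f = trans (cong (d * f zero +_) (sum-*ˡ d (f ∘ suc))) (sym (ℕₚ.*-distribˡ-+ d (f zero) _))

sum-const : ∀ k c → sumFin {k} (λ _ → c) ≡ k * c
sum-const zero c = refl
sum-const (suc k) c = cong (c +_) (sum-const k c)

inject≤-injective′ : ∀ {m n} (le le′ : m ≤ n) {i j : Fin m} → inject≤ i le ≡ inject≤ j le′ → i ≡ j
inject≤-injective′ le le′ {i} {j} e = Finₚ.toℕ-injective
  (trans (sym (Finₚ.toℕ-inject≤ i le)) (trans (cong toℕ e) (Finₚ.toℕ-inject≤ j le′)))

Fin-positive : ∀ {k} → Fin k → 0 < k
Fin-positive zero = z<s
Fin-positive (suc _) = z<s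

∃⊎∀ : ∀ {k} {P Q : Fin k → Set} → (∀ i → P i ⊎ Q i) → (∃ P) ⊎ (∀ i → Q i)
∃⊎∀ {zero} h = inj₂ λ ()
∃⊎∀ {suc k} h with h zero | ∃⊎∀ (h ∘ suc)
... | inj₁ p | _ = inj₁ (zero , p)
... | inj₂ q | inj₁ (i , p) = inj₁ (suc i , p)
... | inj₂ q | inj₂ qs = inj₂ λ { zero → q ; (suc i) → qs i }

-- Graphs

deg : (X : Graph) → V X → ℕ
deg X v = countFin (adj X v)

induced : (X : Graph) → (V X → Bool) → Graph
induced X p = record
  { n = countFin p
  ; adj = λ a b → adj X (enum p a) (enum p b)
  ; adj-sym = λ a b → adj-sym X _ _
  ; adj-irrefl = λ a → adj-irrefl X _ }

induced-emb : ∀ X p → InducedEmb (induced X p) X (enum p)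
induced-emb X p = enum-injective p , λ _ _ → refl

Iso-sym : ∀ {X Y} → Iso X Y → Iso Y X
Iso-sym {X} {Y} (f , g , gf , fg , ad) = g , f , fg , gf ,
  λ u v → sym (trans (ad (g u) (g v)) (cong₂ (adj Y) (fg u) (fg v)))

Iso-refl : ∀ {X} → Iso X X
Iso-refl = (λ x → x) , (λ x → x) , (λ _ → refl) , (λ _ → refl) , λ _ _ → refl

Iso-trans : ∀ {X Y Z} → Iso X Y → Iso Y Z → Iso X Z
Iso-trans (f , g , gf , fg , ad) (f′ , g′ , gf′ , fg′ , ad′) =
  f′ ∘ f , g ∘ g′ , (λ x → trans (cong g (gf′ (f x))) (gf x)) ,
  (λ y → trans (cong f′ (fg (g′ y))) (fg′ y)) , λ u v → trans (ad u v) (ad′ (f u) (f v))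

Iso-injective : ∀ {X Y} (i : Iso X Y) → Injective _≡_ _≡_ (proj₁ i)
Iso-injective (f , g , gf , _) {x} {y} e = trans (sym (gf x)) (trans (cong g e) (gf y))

E-sym : ∀ X {u v} → E X u v → E X v u
E-sym X {u} {v} e = trans (adj-sym X v u) e

E-irrefl : ∀ X {v} → ¬ E X v v
E-irrefl X {v} e = true≢false (trans (sym e) (adj-irrefl X v))

deg-injective-≤ : ∀ X Y (f : V X → V Y) → Injective _≡_ _≡_ f → IsHom X Y f → ∀ v → deg X v ≤ deg Y (f v)
deg-injective-≤ X Y f inj hm v = count-injection _ _ f (λ u e → hm v u e) (λ _ _ _ _ → inj)

reach-trans : ∀ {X P u v w} → ReachIn X P u v → ReachIn X P v w → ReachIn X P u w
reach-trans (here _) q = q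
reach-trans (step p e r) q = step p e (reach-trans r q)

reach-end : ∀ {X P u v} → ReachIn X P u v → P v
reach-end (here p) = p
reach-end (step _ _ r) = reach-end r

reach-start : ∀ {X P u v} → ReachIn X P u v → P u
reach-start (here p) = p
reach-start (step p _ r) = p

reach-sym : ∀ {X P u v} → ReachIn X P u v → ReachIn X P v u
reach-sym (here p) = here p
reach-sym {X} (step p e r) = reach-trans (reach-sym r) (step (reach-start r) (E-sym X e) (here p))

reach-map : ∀ {X P Q u v} → (∀ {x} → P x → Q x) → ReachIn X P u v → ReachIn X Q u v
reach-map f (here p) = here (f p)
reach-map f (step p e r) = step (f p) e (reach-map f r)

unionAdj-same : ∀ {k} (Ys : Fin k → Graph) i a b → unionAdj Ys (i , a) (i , b) ≡ adj (Ys i) a b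
unionAdj-same Ys i a b with i ≟ i
... | yes refl = refl
... | no ne = contradiction refl ne

-- A view of adjacency in a union: matching on it identifies the two indices, which the Boolean
-- `unionAdj` hides behind a decision.
data SameComp {k} (Ys : Fin k → Graph) : UnionV Ys → UnionV Ys → Set where
  same : ∀ i a b → E (Ys i) a b → SameComp Ys (i , a) (i , b)

unionAdj-true : ∀ {k} (Ys : Fin k → Graph) p q → unionAdj Ys p q ≡ true → SameComp Ys p q
unionAdj-true Ys (i , a) (j , b) e with i ≟ j
... | yes refl = same i a b e

unionAdj-sym : ∀ {k} (Ys : Fin k → Graph) p q → unionAdj Ys p q ≡ true → unionAdj Ys q p ≡ true
unionAdj-sym Ys p q e with unionAdj-true Ys p q e
... | same i a b e′ = trans (unionAdj-same Ys i b a) (E-sym (Ys i) e′)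

unionGraph : ∀ {k} → (Fin k → Graph) → Graph
unionGraph Ys = record
  { n = sumFin (n ∘ Ys)
  ; adj = λ x y → unionAdj Ys (unpair _ x) (unpair _ y)
  ; adj-sym = λ x y → bool-ext (unionAdj-sym Ys (unpair _ x) (unpair _ y)) (unionAdj-sym Ys (unpair _ y) (unpair _ x))
  ; adj-irrefl = λ x → trans (unionAdj-same Ys (proj₁ (unpair _ x)) _ _) (adj-irrefl (Ys _) _) }

unionGraph-InBar : ∀ (𝒢 : GraphClass) {k} (Ys : Fin k → Graph) → (∀ i → mem 𝒢 (Ys i)) → InBar 𝒢 (unionGraph Ys)
unionGraph-InBar 𝒢 {k} Ys Ys∈ = k , Ys , Ys∈ , (λ p → pair (n ∘ Ys) (proj₁ p) (proj₂ p)) , unpair (n ∘ Ys) ,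
  (λ p → unpair-pair (n ∘ Ys) (proj₁ p) (proj₂ p)) , pair-unpair (n ∘ Ys) ,
  λ p q → cong₂ (unionAdj Ys) (unpair-pair (n ∘ Ys) (proj₁ p) (proj₂ p)) (unpair-pair (n ∘ Ys) (proj₁ q) (proj₂ q))

-- Local covers and labellings

-- The working form of s-locality: labels below `s` telling apart the preimages of a common vertex.
-- Labels restrict directly to induced pieces and components, where fibres would have to be
-- recounted.
record Labelling {P H} (C : InjCover P H) (s : ℕ) : Set where
  field
    lab : ∀ i → V (comp C i) → Fin s
    lab-inj : ∀ i j a b → φ C i a ≡ φ C j b → lab i a ≡ lab j b →
      _≡_ {A = Σ (Fin (t C)) (V ∘ comp C)} (i , a) (j , b)
open Labelling

module _ {P H} (C : InjCover P H) where

  fibre : V H → ∀ i → V (comp C i) → Bool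
  fibre v i a = ⌊ φ C i a ≟ v ⌋

  fibreIndex : ∀ v i a → φ C i a ≡ v → Fin (preimageSize C v)
  fibreIndex v i a e = pair (λ i → countFin (fibre v i)) i (rank (fibre v i) a (⌊⌋-complete (φ C i a ≟ v) e))

  fibreIndex-injective : ∀ v i a e j b e′ → fibreIndex v i a e ≡ fibreIndex v j b e′ →
    _≡_ {A = Σ (Fin (t C)) (V ∘ comp C)} (i , a) (j , b)
  fibreIndex-injective v i a e j b e′ eq = trans (cong (i ,_) (sym (enum-rank (fibre v i) a _)))
    (trans (cong (λ p → proj₁ p , enum (fibre v (proj₁ p)) (proj₂ p)) (pair-injective _ eq))
      (cong (j ,_) (enum-rank (fibre v j) b _)))

  local⇒labelling : ∀ s → (∀ v → preimageSize C v ≤ s) → Labelling C s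
  local⇒labelling s le = record { lab = lb ; lab-inj = λ i j a b e → inj′ _ _ i j a b refl refl e }
    where
    lb : ∀ i → V (comp C i) → Fin s
    lb i a = inject≤ (fibreIndex (φ C i a) i a refl) (le _)
    -- The indices live over `φ C i a` and `φ C j b`, which are only propositionally equal; naming
    -- them `v` and `w` allows matching on the equation.
    inj′ : ∀ v w i j a b (p : φ C i a ≡ v) (q : φ C j b ≡ w) → v ≡ w →
      inject≤ (fibreIndex v i a p) (le v) ≡ inject≤ (fibreIndex w j b q) (le w) → (i , a) ≡ (j , b)
    inj′ v .v i j a b p q refl e = fibreIndex-injective v i a p j b q (inject≤-injective′ (le v) (le v) e)

  labelling⇒local : ∀ s → Labelling C s → ∀ v → preimageSize C v ≤ s
  labelling⇒local s L v = Finₚ.injective⇒≤ {f = g} g-inj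
    where
    cnt : Fin (t C) → ℕ
    cnt i = countFin (fibre v i)
    vert : Σ (Fin (t C)) (Fin ∘ cnt) → Σ (Fin (t C)) (V ∘ comp C)
    vert (i , x) = i , enum (fibre v i) x
    vert-inj : ∀ {p q} → vert p ≡ vert q → p ≡ q
    vert-inj {i , x} {j , y} e = lem i j x y _ _ refl refl (cong proj₁ e) e
      where
      lem : ∀ i j x y a b → enum (fibre v i) x ≡ a → enum (fibre v j) y ≡ b → i ≡ j →
        _≡_ {A = Σ (Fin (t C)) (V ∘ comp C)} (i , a) (j , b) →
        _≡_ {A = Σ (Fin (t C)) (Fin ∘ cnt)} (i , x) (j , y)
      lem i .i x y a .a p q refl refl = cong (i ,_) (enum-injective (fibre v i) (trans p (sym q)))
    over : ∀ p → φ C (proj₁ (vert p)) (proj₂ (vert p)) ≡ v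
    over (i , x) = ⌊⌋-sound (φ C i _ ≟ v) (enum-true (fibre v i) x)
    g : Fin (preimageSize C v) → Fin s
    g x = lab L _ (proj₂ (vert (unpair cnt x)))
    g-inj : Injective _≡_ _≡_ g
    g-inj {x} {y} e = unpair-injective cnt (vert-inj (lab-inj L _ _ _ _
      (trans (over (unpair cnt x)) (sym (over (unpair cnt y)))) e))

-- Lets the components be indexed by a convenient type `I`; since `dec` hits every index, each lift
-- of an edge survives the renumbering.
coverFrom : ∀ {P H} {I : Set} {N} (dec : Fin N → I) (enc : I → Fin N) → (∀ i → dec (enc i) ≡ i) →
  (G : I → Graph) → (∀ i → P (G i)) → (ψ : ∀ i → V (G i) → V H) → (∀ i → IsHom (G i) H (ψ i)) →
  (∀ u v → E H u v → Σ I λ i → ∃ λ a → ∃ λ b → E (G i) a b × ψ i a ≡ u × ψ i b ≡ v) →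
  (∀ i → Injective _≡_ _≡_ (ψ i)) → InjCover P H
coverFrom {P} {H} {I} {N} dec enc dec-enc G G∈ ψ ψ-hom surj ψ-inj = record
  { t = N ; comp = G ∘ dec ; inP = G∈ ∘ dec ; φ = λ x → ψ (dec x) ; hom = ψ-hom ∘ dec
  ; edge-surj = λ u v e → let (i , w) = surj u v e in enc i , subst (Lift u v) (sym (dec-enc i)) w
  ; inj = λ x → ψ-inj (dec x) }
  where
  Lift : V H → V H → I → Set
  Lift u v i = ∃ λ a → ∃ λ b → E (G i) a b × ψ i a ≡ u × ψ i b ≡ v

module InBarData {𝒢 : GraphClass} {X : Graph} (X∈ : InBar 𝒢 X) where
  Ys : Fin (proj₁ X∈) → Graph
  Ys = proj₁ (proj₂ X∈)
  Ys∈ : ∀ j → mem 𝒢 (Ys j)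
  Ys∈ = proj₁ (proj₂ (proj₂ X∈))
  to : UnionV Ys → V X
  to = proj₁ (proj₂ (proj₂ (proj₂ X∈)))
  from : V X → UnionV Ys
  from = proj₁ (proj₂ (proj₂ (proj₂ (proj₂ X∈))))
  from-to : ∀ p → from (to p) ≡ p
  from-to = proj₁ (proj₂ (proj₂ (proj₂ (proj₂ (proj₂ X∈)))))
  to-from : ∀ x → to (from x) ≡ x
  to-from = proj₁ (proj₂ (proj₂ (proj₂ (proj₂ (proj₂ (proj₂ X∈))))))
  adj-to : ∀ p q → adj X (to p) (to q) ≡ unionAdj Ys p q
  adj-to = proj₂ (proj₂ (proj₂ (proj₂ (proj₂ (proj₂ (proj₂ X∈))))))

  to-injective : ∀ {p q} → to p ≡ to q → p ≡ q
  to-injective {p} {q} e = trans (sym (from-to p)) (trans (cong from e) (from-to q))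

  to-hom : ∀ j → IsHom (Ys j) X (λ y → to (j , y))
  to-hom j a b e = trans (adj-to _ _) (trans (unionAdj-same Ys j a b) e)

  edge-same : ∀ {a b} → E X a b → SameComp Ys (from a) (from b)
  edge-same {a} {b} e = unionAdj-true Ys (from a) (from b)
    (trans (sym (adj-to _ _)) (trans (cong₂ (adj X) (to-from a) (to-from b)) e))

  -- A union has no edges between different summands, so every neighbour comes from a neighbour in
  -- the summand `j`.
  deg-to : ∀ j y → deg X (to (j , y)) ≤ deg (Ys j) y
  deg-to j y = count-injection (adj X (to (j , y))) (adj (Ys j) y) pick pick-adj pick-inj
    where
    choose : UnionV Ys → V (Ys j)
    choose (j′ , y′) with j ≟ j′
    ... | yes refl = y′
    -- A default value; no neighbour of `to (j , y)` lies in another summand.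
    ... | no _ = y
    choose-same : ∀ y′ → choose (j , y′) ≡ y′
    choose-same y′ with j ≟ j
    ... | yes refl = refl
    ... | no ne = contradiction refl ne
    pick : V X → V (Ys j)
    pick b = choose (from b)
    inside : ∀ b → E X (to (j , y)) b → ∃ λ y′ → from b ≡ (j , y′) × E (Ys j) y y′
    inside b e = go (from b) (subst (λ q → SameComp Ys q (from b)) (from-to (j , y)) (edge-same e))
      where
      go : ∀ q → SameComp Ys (j , y) q → ∃ λ y′ → q ≡ (j , y′) × E (Ys j) y y′
      go _ (same .j .y y′ e) = y′ , refl , e
    pick-adj : ∀ b → E X (to (j , y)) b → E (Ys j) y (pick b)
    pick-adj b e = let (y′ , q , e′) = inside b e in
      subst (E (Ys j) y) (sym (trans (cong choose q) (choose-same y′))) e′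
    pick-inj : ∀ b c → E X (to (j , y)) b → E X (to (j , y)) c → pick b ≡ pick c → b ≡ c
    pick-inj b c eb ec e = let (y₁ , q₁ , _) = inside b eb ; (y₂ , q₂ , _) = inside c ec in
      trans (sym (to-from b)) (trans (cong to (trans q₁ (trans (cong (j ,_)
        (trans (sym (choose-same y₁)) (trans (cong choose (sym q₁)) (trans e (trans (cong choose q₂) (choose-same y₂))))))
        (sym q₂)))) (to-from c))

-- Pieces of the same colour have disjoint images, so they form one graph of the closure under disjoint unions.
colouring⇒global : ∀ {𝒢 H} (C : InjCover (mem 𝒢) H) N (col : Fin (t C) → Fin N) →
  (∀ i j a b → col i ≡ col j → φ C i a ≡ φ C j b → i ≡ j) → HasGlobalCover 𝒢 H N
colouring⇒global {𝒢} {H} C N col disj = record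
  { t = N
  ; comp = λ k → unionGraph (Ys k)
  ; inP = λ k → unionGraph-InBar 𝒢 (Ys k) (λ i → inP C _)
  ; φ = λ k x → ψ k (unpair _ x)
  ; hom = λ k x y e → ψ-hom k _ _ (unionAdj-true (Ys k) _ _ e)
  ; edge-surj = surj
  ; inj = λ k e → unpair-injective _ (ψ-inj k _ _ _ _ e) } , refl
  where
  p : Fin N → Fin (t C) → Bool
  p k i = ⌊ col i ≟ k ⌋
  Ys : ∀ k → Fin (countFin (p k)) → Graph
  Ys k j = comp C (enum (p k) j)
  ψ : ∀ k → UnionV (Ys k) → V H
  ψ k (j , a) = φ C _ a
  ψ-hom : ∀ k x y → SameComp (Ys k) x y → E H (ψ k x) (ψ k y)
  ψ-hom k _ _ (same j a b e) = hom C _ a b e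
  colour-enum : ∀ k j → col (enum (p k) j) ≡ k
  colour-enum k j = ⌊⌋-sound (col _ ≟ k) (enum-true (p k) j)
  ψ-inj : ∀ k j a j′ b → ψ k (j , a) ≡ ψ k (j′ , b) → _≡_ {A = UnionV (Ys k)} (j , a) (j′ , b)
  ψ-inj k j a j′ b e with enum-injective (p k) (disj _ _ a b (trans (colour-enum k j) (sym (colour-enum k j′))) e)
  ... | refl = cong (j ,_) (inj C _ e)
  lift : ∀ i i′ (a b : V (comp C i)) → i′ ≡ i → E (comp C i) a b →
    Σ (V (comp C i′)) λ a′ → Σ (V (comp C i′)) λ b′ → E (comp C i′) a′ b′ × φ C i′ a′ ≡ φ C i a × φ C i′ b′ ≡ φ C i b
  lift i .i a b refl e = a , b , e , refl , refl
  surj : ∀ u v → E H u v → ∃ λ k → ∃ λ x → ∃ λ y →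
    E (unionGraph (Ys k)) x y × ψ k (unpair _ x) ≡ u × ψ k (unpair _ y) ≡ v
  surj u v e with edge-surj C u v e
  ... | i , a , b , eab , refl , refl with rank (p (col i)) i (⌊⌋-complete (col i ≟ col i) refl)
                                        | enum-rank (p (col i)) i (⌊⌋-complete (col i ≟ col i) refl)
  ... | j | ej with lift i (enum (p (col i)) j) a b ej eab
  ... | a′ , b′ , e′ , ea , eb = col i , pair _ j a′ , pair _ j b′ ,
    trans (cong₂ (unionAdj (Ys (col i))) (unpair-pair _ j a′) (unpair-pair _ j b′)) (trans (unionAdj-same (Ys (col i)) j a′ b′) e′) ,
    trans (cong (ψ (col i)) (unpair-pair _ j a′)) ea , trans (cong (ψ (col i)) (unpair-pair _ j b′)) eb

-- The summands of one graph of the cover have disjoint images, so the number of that graph can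
-- serve as the label.
global⇒local : ∀ {𝒢 H s} → HasGlobalCover 𝒢 H s → HasLocalCover 𝒢 H s
global⇒local {𝒢} {H} (C , refl) = C′ , labelling⇒local C′ (t C) (record { lab = λ x _ → proj₁ (ix x) ; lab-inj = lab-inj′ })
  where
  module B k = InBarData {𝒢} {comp C k} (inP C k)
  num : Fin (t C) → ℕ
  num k = proj₁ (inP C k)
  I = Σ (Fin (t C)) (Fin ∘ num)
  ix : Fin (sumFin num) → I
  ix = unpair num
  ψ : ((k , j) : I) → V (B.Ys k j) → V H
  ψ (k , j) a = φ C k (B.to k (j , a))
  ψ-injective : ∀ p → Injective _≡_ _≡_ (ψ p)
  ψ-injective (k , j) e with B.to-injective k (inj C k e)
  ... | refl = refl
  surj : ∀ u v → E H u v → Σ I λ (k , j) → ∃ λ a → ∃ λ b → E (B.Ys k j) a b × ψ (k , j) a ≡ u × ψ (k , j) b ≡ v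
  surj u v e with edge-surj C u v e
  ... | k , a , b , eab , refl , refl with B.from k a | B.from k b | B.to-from k a | B.to-from k b | B.edge-same k eab
  ... | _ | _ | refl | refl | same j a′ b′ e′ = (k , j) , a′ , b′ , e′ , refl , refl
  C′ : InjCover (mem 𝒢) H
  C′ = coverFrom ix (λ (k , j) → pair num k j) (λ (k , j) → unpair-pair num k j) (λ (k , j) → B.Ys k j)
    (λ (k , j) → B.Ys∈ k j) ψ (λ (k , j) a b e → hom C k _ _ (B.to-hom k j a b e)) surj ψ-injective
  lab-inj′ : ∀ x y a b → φ C′ x a ≡ φ C′ y b → proj₁ (ix x) ≡ proj₁ (ix y) →
    _≡_ {A = Σ (Fin (sumFin num)) (V ∘ comp C′)} (x , a) (y , b)
  lab-inj′ x y a b e ek with unpair-injective num {x} {y} (same-index (ix x) (ix y) ek a b e)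
    where
    same-index : ∀ p q → proj₁ p ≡ proj₁ q → ∀ a b → ψ p a ≡ ψ q b → p ≡ q
    same-index (k , j) (.k , j′) refl a b e = cong (λ p → k , proj₁ p) (B.to-injective k (inj C k e))
  ... | refl = cong (x ,_) (inj C′ x e)

-- Minimality does the rest: a global cover by `f s` graphs bounds t, and a global cover read as a
-- local one bounds s.
bounded-intro : ∀ 𝒢 ℋ (f : ℕ → ℕ) →
  (∀ H → mem ℋ H → ∀ s → HasLocalCover 𝒢 H s → HasGlobalCover 𝒢 H (f s)) → Bounded 𝒢 ℋ
bounded-intro 𝒢 ℋ f build = f , λ H H∈ s t (ls , mins) (gt , mint) →
  ℕₚ.≮⇒≥ (λ t<s → mins t t<s (global⇒local {𝒢} gt)) ,
  ℕₚ.≮⇒≥ (λ fs<t → mint (f s) fs<t (build H H∈ s ls))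

-- Degenerate graphs

Degenerate : Graph → ℕ → Set
Degenerate X D = ∀ (U : V X → Bool) → (∃ λ u → U u ≡ true) →
  ∃ λ v → U v ≡ true × countFin (λ u → U u ∧ adj X v u) ≤ D

-- Pigeonhole: if all D + 1 colours occurred, choosing an element for each would inject them into a
-- set of at most D elements.
free-colour : ∀ {m D} (p : Fin m → Bool) (c : Fin m → Fin (suc D)) → countFin p ≤ D →
  ∃ λ k → ∀ u → p u ≡ true → c u ≢ k
free-colour {m} {D} p c le with Finₚ.any? (λ k → Finₚ.all? (λ u → ¬? (true? (p u) ×-dec (c u ≟ k))))
... | yes (k , free) = k , λ u pu cu → free u (pu , cu)
... | no all-used = contradiction (Finₚ.injective⇒≤ {f = g} g-inj) (ℕₚ.<⇒≱ (s≤s le))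
  where
  used : ∀ k → ∃ λ u → p u ≡ true × c u ≡ k
  used k with Finₚ.any? (λ u → true? (p u) ×-dec (c u ≟ k))
  ... | yes w = w
  ... | no ¬w = contradiction (k , λ u q → ¬w (u , q)) all-used
  g : Fin (suc D) → Fin (countFin p)
  g k = rank p (proj₁ (used k)) (proj₁ (proj₂ (used k)))
  g-inj : Injective _≡_ _≡_ g
  g-inj {k} {l} e = trans (sym (proj₂ (proj₂ (used k))))
    (trans (cong c (rank-injective p _ _ e)) (proj₂ (proj₂ (used l))))

-- Greedy colouring: a vertex with at most D neighbours in the current set is removed, the rest is
-- coloured, and the vertex takes a colour missing among those neighbours.
degenerate⇒colourable : ∀ X D → Degenerate X D → Colourable X (suc D)
degenerate⇒colourable X D degen with go (countFin {n X} (λ _ → true)) (λ _ → true) ℕₚ.≤-refl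
  where
  go : ∀ fuel (U : V X → Bool) → countFin U ≤ fuel →
    Σ (V X → Fin (suc D)) λ c → ∀ u v → U u ≡ true → U v ≡ true → E X u v → c u ≢ c v
  go fuel U le with Finₚ.any? (λ u → true? (U u))
  ... | no none = (λ _ → zero) , λ u v Uu → contradiction (u , Uu) none
  go fuel U le | yes some with degen U some
  go zero U le | yes some | v , Uv , _ = contradiction (rank U v Uv) (λ i → Finₚ.¬Fin0 (subst Fin (ℕₚ.n≤0⇒n≡0 le) i))
  go (suc fuel) U le | yes some | v , Uv , few = c′ , proper
    where
    U′ : V X → Bool
    U′ u = U u ∧ not ⌊ u ≟ v ⌋
    U′v : U′ v ≡ false
    U′v with v ≟ v
    ... | yes _ = Boolₚ.∧-zeroʳ (U v)
    ... | no ne = contradiction refl ne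
    U′-intro : ∀ u → U u ≡ true → u ≢ v → U′ u ≡ true
    U′-intro u Uu ne with u ≟ v
    ... | yes e = contradiction e ne
    ... | no _ = trans (Boolₚ.∧-identityʳ (U u)) Uu
    rec = go fuel U′ (ℕₚ.≤-pred (ℕₚ.≤-trans (count-strict U′ U v (λ u e → proj₁ (∧-true e)) U′v Uv) le))
    c = proj₁ rec
    fresh = free-colour (λ u → U u ∧ adj X v u) c few
    c′ : V X → Fin (suc D)
    c′ u = if ⌊ u ≟ v ⌋ then proj₁ fresh else c u
    proper : ∀ u w → U u ≡ true → U w ≡ true → E X u w → c′ u ≢ c′ w
    proper u w Uu Uw e with u ≟ v | w ≟ v
    ... | yes refl | yes refl = λ _ → E-irrefl X e
    ... | yes refl | no _ = λ q → proj₂ fresh w (cong₂ _∧_ Uw e) (sym q)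
    ... | no _ | yes refl = λ q → proj₂ fresh u (cong₂ _∧_ Uu (E-sym X e)) q
    ... | no u≢v | no w≢v = proj₂ rec u w (U′-intro u Uu u≢v) (U′-intro w Uw w≢v) e
... | c , proper = c , λ u v → proper u v refl refl

-- A function g from colours to labels selects at most one preimage of every vertex; the two ends of an edge
-- have different colours, so some g selects both ends of its lift.
chromatic⇒global : ∀ {𝒢 H k s} → Hereditary 𝒢 → Colourable H k → HasLocalCover 𝒢 H s → HasGlobalCover 𝒢 H (s ^ k)
chromatic⇒global {𝒢} {H} {k} {s} her (κ , κ-proper) (C , le) =
  colouring⇒global {𝒢} C′ (s ^ k) (λ x → proj₁ (dec x)) disjoint
  where
  L = local⇒labelling C s le
  I = Fin (s ^ k) × Fin (t C)
  dec : Fin (s ^ k * t C) → I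
  dec = remQuot (t C)
  sel : ((g , i) : I) → V (comp C i) → Bool
  sel (g , i) a = ⌊ finToFun g (κ (φ C i a)) ≟ lab L i a ⌋
  ψ : ((g , i) : I) → V (induced (comp C i) (sel (g , i))) → V H
  ψ (g , i) a = φ C i (enum (sel (g , i)) a)
  surj : ∀ u v → E H u v → Σ I λ i → ∃ λ a → ∃ λ b → E (induced (comp C (proj₂ i)) (sel i)) a b × ψ i a ≡ u × ψ i b ≡ v
  surj u v e with edge-surj C u v e
  ... | i , a , b , eab , refl , refl = (g , i) , rank p a pa , rank p b pb ,
      trans (cong₂ (adj (comp C i)) (enum-rank p a pa) (enum-rank p b pb)) eab ,
      cong (φ C i) (enum-rank p a pa) , cong (φ C i) (enum-rank p b pb)
    where
    -- The two ends have different colours, so their labels can be prescribed independently; every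
    -- colour but that of `a` is sent to the label of `b`.
    choose : Fin k → Fin s
    choose c = if ⌊ c ≟ κ (φ C i a) ⌋ then lab L i a else lab L i b
    g = funToFin choose
    p = sel (g , i)
    choose-a : choose (κ (φ C i a)) ≡ lab L i a
    choose-a with κ (φ C i a) ≟ κ (φ C i a)
    ... | yes _ = refl
    ... | no ne = contradiction refl ne
    choose-b : choose (κ (φ C i b)) ≡ lab L i b
    choose-b with κ (φ C i b) ≟ κ (φ C i a)
    ... | yes q = contradiction (sym q) (κ-proper _ _ e)
    ... | no _ = refl
    pa : p a ≡ true
    pa = ⌊⌋-complete (finToFun g (κ (φ C i a)) ≟ lab L i a) (trans (Finₚ.finToFun-funToFin choose _) choose-a)
    pb : p b ≡ true
    pb = ⌊⌋-complete (finToFun g (κ (φ C i b)) ≟ lab L i b) (trans (Finₚ.finToFun-funToFin choose _) choose-b)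
  C′ : InjCover (mem 𝒢) H
  C′ = coverFrom dec (λ p → combine (proj₁ p) (proj₂ p)) (λ p → Finₚ.remQuot-combine (proj₁ p) (proj₂ p))
    (λ i → induced (comp C (proj₂ i)) (sel i))
    (λ i → her _ _ _ (inP C (proj₂ i)) (induced-emb (comp C (proj₂ i)) (sel i)))
    ψ (λ i a b e → hom C _ _ _ e) surj (λ i e → enum-injective (sel i) (inj C _ e))
  -- Two preimages of one vertex selected by the same g both carry the label that g assigns to the
  -- colour of that vertex, so they coincide.
  disjoint : ∀ x y a b → proj₁ (dec x) ≡ proj₁ (dec y) → φ C′ x a ≡ φ C′ y b → x ≡ y
  disjoint x y a b eg e = trans (sym (Finₚ.combine-remQuot {s ^ k} (t C) x))
    (trans (cong₂ combine eg (lem (dec x) (dec y) eg a b e)) (Finₚ.combine-remQuot {s ^ k} (t C) y))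
    where
    lem : ∀ (p q : I) → proj₁ p ≡ proj₁ q → ∀ a b → ψ p a ≡ ψ q b → proj₂ p ≡ proj₂ q
    lem (g , i) (.g , j) refl a b e = cong proj₁ (lab-inj L i j (enum (sel (g , i)) a) (enum (sel (g , j)) b) e
      (trans (sym (⌊⌋-sound (_ ≟ _) (enum-true (sel (g , i)) a)))
        (trans (cong (finToFun g ∘ κ) e) (⌊⌋-sound (_ ≟ _) (enum-true (sel (g , j)) b)))))

-- Bounded maximum average degree

-- Each directed edge is charged to a chosen lift; `decode` recovers the edge from its lift, so no
-- lift is charged twice.
twiceEdges-cover : ∀ {P H} (C : InjCover P H) → twiceEdges H ≤ sumFin (λ i → twiceEdges (comp C i))
twiceEdges-cover {P} {H} C = Finₚ.injective⇒≤ {f = code} code-inj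
  where
  ends : Fin (twiceEdges H) → V H × V H
  ends x = let (u , y) = unpair (deg H) x in u , enum (adj H u) y
  edge : ∀ x → E H (proj₁ (ends x)) (proj₂ (ends x))
  edge x = enum-true (adj H _) (proj₂ (unpair (deg H) x))
  ends-inj : ∀ {x y} → ends x ≡ ends y → x ≡ y
  ends-inj {x} {y} e = unpair-injective (deg H) (lem (unpair (deg H) x) (unpair (deg H) y) e)
    where
    lem : ∀ (p q : Σ (V H) (λ u → Fin (deg H u))) →
      (proj₁ p , enum (adj H (proj₁ p)) (proj₂ p)) ≡ (proj₁ q , enum (adj H (proj₁ q)) (proj₂ q)) → p ≡ q
    lem (u , y) (u′ , y′) e with cong proj₁ e
    ... | refl = cong (u ,_) (enum-injective (adj H u) (cong proj₂ e))
  tw = λ i → twiceEdges (comp C i)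
  encode : ∀ i a b → E (comp C i) a b → Fin (sumFin tw)
  encode i a b e = pair tw i (pair (deg (comp C i)) a (rank (adj (comp C i) a) b e))
  decode : Fin (sumFin tw) → V H × V H
  decode z = let (i , z′) = unpair tw z in
    φ C i (proj₁ (unpair (deg (comp C i)) z′)) , φ C i (enum (adj (comp C i) _) (proj₂ (unpair (deg (comp C i)) z′)))
  decode-encode : ∀ i a b e → decode (encode i a b e) ≡ (φ C i a , φ C i b)
  decode-encode i a b e
    rewrite unpair-pair tw i (pair (deg (comp C i)) a (rank (adj (comp C i) a) b e))
          | unpair-pair (deg (comp C i)) a (rank (adj (comp C i) a) b e)
          | enum-rank (adj (comp C i) a) b e = refl
  code : Fin (twiceEdges H) → Fin (sumFin tw)
  code x = let (i , a , b , e , _) = edge-surj C _ _ (edge x) in encode i a b e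
  decode-code : ∀ x → decode (code x) ≡ ends x
  decode-code x = let (i , a , b , e , ea , eb) = edge-surj C _ _ (edge x) in
    trans (decode-encode i a b e) (cong₂ _,_ ea eb)
  code-inj : Injective _≡_ _≡_ code
  code-inj {x} {y} e = ends-inj (trans (sym (decode-code x)) (trans (cong decode e) (decode-code y)))

-- A vertex of a component is determined by its image together with its label.
total-size-cover : ∀ {P H s} (C : InjCover P H) → Labelling C s → sumFin (n ∘ comp C) ≤ n H * s
total-size-cover {P} {H} {s} C L = Finₚ.injective⇒≤ {f = λ x → code (unpair (n ∘ comp C) x)}
  (λ {x} {y} e → unpair-injective _ (lab-inj L _ _ _ _
    (Finₚ.combine-injectiveˡ (φ C _ (proj₂ (unpair (n ∘ comp C) x))) (lab L _ (proj₂ (unpair (n ∘ comp C) x))) (φ C _ (proj₂ (unpair (n ∘ comp C) y))) (lab L _ (proj₂ (unpair (n ∘ comp C) y))) e)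
    (Finₚ.combine-injectiveʳ (φ C _ (proj₂ (unpair (n ∘ comp C) x))) (lab L _ (proj₂ (unpair (n ∘ comp C) x))) (φ C _ (proj₂ (unpair (n ∘ comp C) y))) (lab L _ (proj₂ (unpair (n ∘ comp C) y))) e)))
  where
  code : Σ (Fin (t C)) (V ∘ comp C) → Fin (n H * s)
  code (i , a) = combine (φ C i a) (lab L i a)

-- Averaging: the components have at most `n H * s` vertices in all, hence degree sum at most
-- `d * (n H * s)`, which the degree sum of H would exceed if all degrees were larger. The vertex
-- `v₀` makes this strict.
low-degree-vertex : ∀ {P H s d} (C : InjCover P H) → Labelling C s →
  (∀ i → twiceEdges (comp C i) ≤ d * n (comp C i)) → V H → ∃ λ v → deg H v ≤ d * s
low-degree-vertex {P} {H} {s} {d} C L sparse v₀ with Finₚ.any? (λ v → deg H v ≤? d * s)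
... | yes w = w
... | no all-large = contradiction edges≤ (ℕₚ.<⇒≱ edges>)
  where
  edges≤ : twiceEdges H ≤ n H * (d * s)
  edges≤ = begin
    twiceEdges H                          ≤⟨ twiceEdges-cover C ⟩
    sumFin (λ i → twiceEdges (comp C i))  ≤⟨ sum-mono _ _ sparse ⟩
    sumFin (λ i → d * n (comp C i))       ≡⟨ sum-*ˡ d (n ∘ comp C) ⟩
    d * sumFin (n ∘ comp C)               ≤⟨ ℕₚ.*-monoʳ-≤ d (total-size-cover C L) ⟩
    d * (n H * s)                         ≡⟨ sym (ℕₚ.*-assoc d (n H) s) ⟩
    d * n H * s                           ≡⟨ cong (_* s) (ℕₚ.*-comm d (n H)) ⟩
    n H * d * s                           ≡⟨ ℕₚ.*-assoc (n H) d s ⟩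
    n H * (d * s)                         ∎
    where open ℕₚ.≤-Reasoning
  edges> : n H * (d * s) < twiceEdges H
  edges> = begin-strict
    n H * (d * s)             <⟨ ℕₚ.m<n+m (n H * (d * s)) (Fin-positive v₀) ⟩
    n H + n H * (d * s)       ≡⟨ sym (ℕₚ.*-suc (n H) (d * s)) ⟩
    n H * suc (d * s)         ≡⟨ sym (sum-const (n H) (suc (d * s))) ⟩
    sumFin {n H} (λ _ → suc (d * s)) ≤⟨ sum-mono _ _ (λ v → ℕₚ.≰⇒> (λ le → all-large (v , le))) ⟩
    twiceEdges H              ∎
    where open ℕₚ.≤-Reasoning

module _ {P H} (C : InjCover P H) (U : V H → Bool) where

  -- An induced part of a component may fail `P`, so the restricted cover records only the trivial
  -- property; sparsity is supplied separately, since maximum average degree passes to subgraphs.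
  restrict : InjCover (λ _ → ⊤) (induced H U)
  restrict = record
    { t = t C
    ; comp = λ i → induced (comp C i) (p i)
    ; inP = λ _ → tt
    ; φ = ψ
    ; hom = λ i a b e → trans (cong₂ (adj H) (enum-rank U _ _) (enum-rank U _ _)) (hom C i _ _ e)
    ; edge-surj = surj
    ; inj = λ i e → enum-injective (p i) (inj C i (rank-injective U _ _ e)) }
    where
    p : ∀ i → V (comp C i) → Bool
    p i a = U (φ C i a)
    ψ : ∀ i → V (induced (comp C i) (p i)) → V (induced H U)
    ψ i a = rank U (φ C i (enum (p i) a)) (enum-true (p i) a)
    surj : ∀ u v → E (induced H U) u v →
      ∃ λ i → ∃ λ a → ∃ λ b → E (induced (comp C i) (p i)) a b × ψ i a ≡ u × ψ i b ≡ v
    surj u v e with edge-surj C (enum U u) (enum U v) e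
    ... | i , a , b , eab , ea , eb = i , rank (p i) a pa , rank (p i) b pb ,
        trans (cong₂ (adj (comp C i)) (enum-rank (p i) a pa) (enum-rank (p i) b pb)) eab ,
        enum-injective U (trans (enum-rank U _ _) (trans (cong (φ C i) (enum-rank (p i) a pa)) ea)) ,
        enum-injective U (trans (enum-rank U _ _) (trans (cong (φ C i) (enum-rank (p i) b pb)) eb))
      where
      pa : p i a ≡ true
      pa = trans (cong U ea) (enum-true U u)
      pb : p i b ≡ true
      pb = trans (cong U eb) (enum-true U v)

  restrict-labelling : ∀ {s} → Labelling C s → Labelling restrict s
  restrict-labelling L = record
    { lab = λ i a → lab L i (enum (λ a → U (φ C i a)) a)
    ; lab-inj = λ i j a b e el → descend i j a b (lab-inj L i j _ _ (rank-injective U _ _ e) el) }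
    where
    descend : ∀ i j a b → _≡_ {A = Σ (Fin (t C)) (V ∘ comp C)} (i , enum (λ a → U (φ C i a)) a) (j , enum (λ a → U (φ C j a)) b) →
      _≡_ {A = Σ (Fin (t C)) (V ∘ comp restrict)} (i , a) (j , b)
    descend i j a b e = lem i j a b _ _ refl refl e
      where
      lem : ∀ i j a b x y → enum (λ a → U (φ C i a)) a ≡ x → enum (λ a → U (φ C j a)) b ≡ y →
        _≡_ {A = Σ (Fin (t C)) (V ∘ comp C)} (i , x) (j , y) →
        _≡_ {A = Σ (Fin (t C)) (V ∘ comp restrict)} (i , a) (j , b)
      lem i .i a b x .x p q refl = cong (i ,_) (enum-injective (λ a → U (φ C i a)) (trans p (sym q)))

-- `MadAtMost` speaks of nonempty subgraphs only, so the empty one is treated apart.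
MadAtMost-sparse : ∀ {X d} → MadAtMost X d → ∀ p → twiceEdges (induced X p) ≤ d * n (induced X p)
MadAtMost-sparse {X} {d} mad p with 0 <? countFin p
... | yes pos = mad (induced X p) (enum p) (enum-injective p , λ _ _ e → e) pos
... | no ¬pos = empty-sum (countFin p) (deg (induced X p)) (ℕₚ.n≤0⇒n≡0 (ℕₚ.≮⇒≥ ¬pos))
  where
  empty-sum : ∀ k (f : Fin k → ℕ) → k ≡ 0 → ∀ {m} → sumFin f ≤ m
  empty-sum zero f refl = z≤n

mad⇒degenerate : ∀ {P H s d} (C : InjCover P H) → Labelling C s → (∀ i → MadAtMost (comp C i) d) → Degenerate H (d * s)
mad⇒degenerate {P} {H} {s} {d} C L mad U (u , Uu)
  with low-degree-vertex {d = d} (restrict C U) (restrict-labelling C U L)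
         (λ i → MadAtMost-sparse {comp C i} {d} (mad i) _) (rank U u Uu)
... | v , le = enum U v , enum-true U v , ℕₚ.≤-trans (ℕₚ.≤-trans
    (count-injection _ (adj (induced H U) v) back
      (λ x e → trans (cong (adj H (enum U v)) (enum-back x (proj₁ (∧-true e)))) (proj₂ (∧-true e)))
      (λ x y px py e → trans (sym (enum-back x (proj₁ (∧-true px)))) (trans (cong (enum U) e) (enum-back y (proj₁ (∧-true py))))))
    ℕₚ.≤-refl) le
  where
  back : V H → V (induced H U)
  back x with true? (U x)
  ... | yes Ux = rank U x Ux
  ... | no _ = v
  enum-back : ∀ x → U x ≡ true → enum U (back x) ≡ x
  enum-back x Ux with true? (U x)
  ... | yes Ux′ = enum-rank U x Ux′
  ... | no ¬Ux = contradiction Ux ¬Ux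

bounded-mad : ∀ 𝒢 ℋ → Hereditary 𝒢 → BoundedMad 𝒢 → Bounded 𝒢 ℋ
bounded-mad 𝒢 ℋ her (d , mad) = bounded-intro 𝒢 ℋ (λ s → s ^ suc (d * s)) λ H H∈ s (C , le) →
  chromatic⇒global {𝒢} her (degenerate⇒colourable H (d * s)
    (mad⇒degenerate {d = d} C (local⇒labelling C s le) (λ i → mad _ (inP C i)))) (C , le)

bounded-chromatic : ∀ 𝒢 ℋ → Hereditary 𝒢 → BoundedChromatic ℋ → Bounded 𝒢 ℋ
bounded-chromatic 𝒢 ℋ her (k , col) = bounded-intro 𝒢 ℋ (_^ k) λ H H∈ s C →
  chromatic⇒global {𝒢} her (col H H∈) C

-- Simple paths

-- Generic in the relation because simple paths are taken both in trees and among lattice points.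
-- The predicate `P` holds at every vertex of a walk.
module Walks {A : Set} (_≟ᵃ_ : (x y : A) → Dec (x ≡ y)) (R : A → A → Set) where

  data Walk (P : A → Set) : A → A → Set where
    nil : ∀ {u} → P u → Walk P u u
    cons : ∀ {u w v} → P u → R u w → Walk P w v → Walk P u v

  len : ∀ {P u v} → Walk P u v → ℕ
  len (nil _) = 0
  len (cons _ _ p) = suc (len p)

  at : ∀ {P u v} (p : Walk P u v) → Fin (suc (len p)) → A
  at {u = u} (nil _) _ = u
  at {u = u} (cons _ _ p) zero = u
  at (cons _ _ p) (suc i) = at p i

  at-start : ∀ {P u v} (p : Walk P u v) → at p zero ≡ u
  at-start (nil _) = refl
  at-start (cons _ _ _) = refl

  at-end : ∀ {P u v} (p : Walk P u v) → at p (fromℕ (len p)) ≡ v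
  at-end (nil _) = refl
  at-end (cons _ _ p) = at-end p

  at-P : ∀ {P u v} (p : Walk P u v) i → P (at p i)
  at-P (nil q) _ = q
  at-P (cons q _ p) zero = q
  at-P (cons _ _ p) (suc i) = at-P p i

  at-step : ∀ {P u v} (p : Walk P u v) (i : Fin (len p)) → R (at p (inject₁ i)) (at p (suc i))
  at-step (cons {u} _ r p) zero = subst (R u) (sym (at-start p)) r
  at-step (cons _ _ p) (suc i) = at-step p i

  Simple : ∀ {P u v} → Walk P u v → Set
  Simple (nil _) = ⊤
  Simple (cons {u} _ _ p) = (∀ i → at p i ≢ u) × Simple p

  at-injective : ∀ {P u v} (p : Walk P u v) → Simple p → Injective _≡_ _≡_ (at p)
  at-injective (nil _) _ {zero} {zero} _ = refl
  at-injective (cons _ _ p) _ {zero} {zero} _ = refl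
  at-injective (cons _ _ p) (new , _) {zero} {suc j} e = contradiction (sym e) (new j)
  at-injective (cons _ _ p) (new , _) {suc i} {zero} e = contradiction e (new i)
  at-injective (cons _ _ p) (_ , s) {suc i} {suc j} e = cong suc (at-injective p s e)

  suffix : ∀ {P u v} (p : Walk P u v) → Simple p → ∀ i → Σ (Walk P (at p i) v) Simple
  suffix (nil q) s zero = nil q , tt
  suffix p@(cons _ _ _) s zero = p , s
  suffix (cons _ _ p) (_ , s) (suc i) = suffix p s i

  simplify : ∀ {P u v} → Walk P u v → Σ (Walk P u v) Simple
  simplify (nil q) = nil q , tt
  simplify (cons {u} q r p) with simplify p
  ... | p′ , s with Finₚ.any? (λ i → at p′ i ≟ᵃ u)
  -- `u` recurs on the already simple rest, so the closed part before that occurrence is cut out.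
  ... | yes (i , e) = subst (λ x → Σ (Walk _ x _) Simple) e (suffix p′ s i)
  ... | no new = cons q r p′ , (λ i e → new (i , e)) , s

-- Rooting a tree

-- The value of `par` at the root is left open; a genuine parent is recognised by the drop in depth,
-- which later arguments therefore carry along.
record Rooted (T : Graph) : Set where
  field
    depth : V T → ℕ
    par : V T → V T
    edge : ∀ x y → E T x y → (par x ≡ y × depth y < depth x) ⊎ (par y ≡ x × depth x < depth y)

module _ (T : Graph) where
  open Walks {V T} _≟_ (E T)

  reach⇒walk : ∀ {P u v} → ReachIn T P u v → Walk P u v
  reach⇒walk (here p) = nil p
  reach⇒walk (step p e r) = cons p e (reach⇒walk r)

  -- A simple path inside `P` between the two distinct neighbours has at least two vertices, and
  -- `y`, lying outside `P`, closes it to a cycle.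
  two-neighbours⇒cycle : ∀ {P : V T → Set} {x x′ y} → ReachIn T P x x′ → x ≢ x′ → ¬ P y →
    E T y x → E T y x′ → HasCycle T
  two-neighbours⇒cycle {P} {x} {x′} {y} r x≢x′ ¬Py eyx eyx′ with simplify (reach⇒walk r)
  ... | nil _ , _ = contradiction refl x≢x′
  ... | p@(cons _ _ q) , s = len q , c , c-inj , c-step , subst (λ z → E T z y) (sym (at-end q)) (E-sym T eyx′)
    where
    c : Fin (suc (suc (suc (len q)))) → V T
    c zero = y
    c (suc i) = at p i
    c-inj : Injective _≡_ _≡_ c
    c-inj {zero} {zero} _ = refl
    c-inj {zero} {suc j} e = contradiction (subst P (sym e) (at-P p j)) ¬Py
    c-inj {suc i} {zero} e = contradiction (subst P e (at-P p i)) ¬Py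
    c-inj {suc i} {suc j} e = cong suc (at-injective p s e)
    c-step : ∀ i → E T (c (inject₁ i)) (c (suc i))
    c-step zero = eyx
    c-step (suc i) = at-step p i

  exit-edge : ∀ (A : V T → Bool) {P a z} → ReachIn T P a z → A a ≡ true → A z ≢ true →
    ∃ λ x → ∃ λ y → A x ≡ true × A y ≢ true × E T x y
  exit-edge A (here _) Aa ¬Az = contradiction Aa ¬Az
  exit-edge A (step {u} {w} _ e r) Aa ¬Az with true? (A w)
  ... | yes Aw = exit-edge A r Aw ¬Az
  ... | no ¬Aw = u , w , Aa , ¬Aw , e

  ParentEdge : (V T → ℕ) → (V T → V T) → V T → V T → Set
  ParentEdge depth par x y = (par x ≡ y × depth y < depth x) ⊎ (par y ≡ x × depth x < depth y)

  -- Grow a rooted subtree A: by acyclicity a vertex outside A has at most one neighbour in A.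
  grow : IsTree T → ∀ fuel (A : V T → Bool) → countFin (not ∘ A) ≤ fuel → (∃ λ x → A x ≡ true) →
    (∀ x y → A x ≡ true → A y ≡ true → ReachIn T (λ z → A z ≡ true) x y) →
    (depth : V T → ℕ) (par : V T → V T) →
    (∀ x y → A x ≡ true → A y ≡ true → E T x y → ParentEdge depth par x y) → Rooted T
  grow tree fuel A le ne conn depth par edge with Finₚ.any? (λ z → ¬? (true? (A z)))
  ... | no all = record { depth = depth ; par = par ; edge = λ x y → edge x y (total x) (total y) }
    where
    total : ∀ x → A x ≡ true
    total x with true? (A x)
    ... | yes Ax = Ax
    ... | no ¬Ax = contradiction (x , ¬Ax) all
  grow tree zero A le ne conn depth par edge | yes (z , ¬Az) =
    contradiction (rank (not ∘ A) z (cong not (¬true⇒false ¬Az))) (λ i → Finₚ.¬Fin0 (subst Fin (ℕₚ.n≤0⇒n≡0 le) i))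
  grow tree@(pos , connT , acyc) (suc fuel) A le ne@(a , Aa) conn depth par edge | yes (z , ¬Az)
    with exit-edge A (connT a z) Aa ¬Az
  ... | x , y , Ax , ¬Ay , exy = grow tree fuel A′
      (ℕₚ.≤-pred (ℕₚ.≤-trans (count-strict (not ∘ A′) (not ∘ A) y shrink (cong not A′y) (cong not (¬true⇒false ¬Ay))) le))
      (a , A⊆A′ a Aa) conn′ depth′ par′ edge′
    where
    A′ : V T → Bool
    A′ v = ⌊ v ≟ y ⌋ ∨ A v
    A′y : A′ y ≡ true
    A′y with y ≟ y
    ... | yes _ = refl
    ... | no ne = contradiction refl ne
    A⊆A′ : ∀ v → A v ≡ true → A′ v ≡ true
    A⊆A′ v = ∨-trueʳ ⌊ v ≟ y ⌋
    A′-cases : ∀ v → A′ v ≡ true → v ≡ y ⊎ A v ≡ true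
    A′-cases v e with v ≟ y
    ... | yes q = inj₁ q
    ... | no _ = inj₂ e
    shrink : ∀ v → not (A′ v) ≡ true → not (A v) ≡ true
    shrink v e with v ≟ y
    ... | no _ = e
    depth′ : V T → ℕ
    depth′ v = if ⌊ v ≟ y ⌋ then suc (depth x) else depth v
    par′ : V T → V T
    par′ v = if ⌊ v ≟ y ⌋ then x else par v
    A⇒≢y : ∀ {v} → A v ≡ true → v ≢ y
    A⇒≢y Av refl = ¬Ay Av
    depth′-y : depth′ y ≡ suc (depth x)
    depth′-y with y ≟ y
    ... | yes _ = refl
    ... | no ne = contradiction refl ne
    par′-y : par′ y ≡ x
    par′-y with y ≟ y
    ... | yes _ = refl
    ... | no ne = contradiction refl ne
    depth′-A : ∀ v → A v ≡ true → depth′ v ≡ depth v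
    depth′-A v Av with v ≟ y
    ... | yes q = contradiction q (A⇒≢y Av)
    ... | no _ = refl
    par′-A : ∀ v → A v ≡ true → par′ v ≡ par v
    par′-A v Av with v ≟ y
    ... | yes q = contradiction q (A⇒≢y Av)
    ... | no _ = refl
    toX : ∀ v → A′ v ≡ true → ReachIn T (λ z → A′ z ≡ true) v x
    toX v A′v with A′-cases v A′v
    ... | inj₁ refl = step A′y (E-sym T exy) (here (A⊆A′ x Ax))
    ... | inj₂ Av = reach-map (λ {z} → A⊆A′ z) (conn v x Av Ax)
    conn′ : ∀ u v → A′ u ≡ true → A′ v ≡ true → ReachIn T (λ z → A′ z ≡ true) u v
    conn′ u v A′u A′v = reach-trans (toX u A′u) (reach-sym (toX v A′v))
    only-x : ∀ v → A v ≡ true → E T y v → v ≡ x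
    only-x v Av eyv with v ≟ x
    ... | yes q = q
    ... | no ne = contradiction (two-neighbours⇒cycle (conn v x Av Ax) ne ¬Ay eyv (E-sym T exy)) acyc
    below : par′ y ≡ x × depth′ x < depth′ y
    below = par′-y , subst₂ _<_ (sym (depth′-A x Ax)) (sym depth′-y) ℕₚ.≤-refl
    edge′ : ∀ u v → A′ u ≡ true → A′ v ≡ true → E T u v → ParentEdge depth′ par′ u v
    edge′ u v A′u A′v e with A′-cases u A′u | A′-cases v A′v
    ... | inj₁ refl | inj₁ refl = contradiction e (E-irrefl T)
    ... | inj₁ refl | inj₂ Av with only-x v Av e
    ... | refl = inj₁ below
    edge′ u v A′u A′v e | inj₂ Au | inj₁ refl with only-x u Au (E-sym T e)
    ... | refl = inj₂ below
    edge′ u v A′u A′v e | inj₂ Au | inj₂ Av with edge u v Au Av e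
    ... | inj₁ (p , d) = inj₁ (trans (par′-A u Au) p , subst₂ _<_ (sym (depth′-A v Av)) (sym (depth′-A u Au)) d)
    ... | inj₂ (p , d) = inj₂ (trans (par′-A v Av) p , subst₂ _<_ (sym (depth′-A u Au)) (sym (depth′-A v Av)) d)

  abstract
    tree⇒rooted : IsTree T → Rooted T
    tree⇒rooted tree@(pos , _) = grow tree _ (λ v → ⌊ v ≟ r ⌋) ℕₚ.≤-refl (r , ⌊⌋-complete (r ≟ r) refl)
      (λ x y p q → lem x y (⌊⌋-sound (x ≟ r) p) (⌊⌋-sound (y ≟ r) q))
      (λ _ → 0) (λ v → v)
      (λ x y p q e → contradiction (subst₂ (E T) (⌊⌋-sound (x ≟ r) p) (⌊⌋-sound (y ≟ r) q) e) (E-irrefl T))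
      where
      r : V T
      r = fromℕ< pos
      lem : ∀ x y → x ≡ r → y ≡ r → ReachIn T (λ z → ⌊ z ≟ r ⌋ ≡ true) x y
      lem x .x refl refl = here (⌊⌋-complete (x ≟ x) refl)

-- Connected vertex sets in a rooted tree

module Subtrees {T : Graph} (root : Rooted T) where
  open Rooted root

  data Descendant (τ : V T) : V T → Set where
    self : Descendant τ τ
    below : ∀ {x} → Descendant τ (par x) → depth (par x) < depth x → Descendant τ x

  depth-descendant : ∀ {τ x} → Descendant τ x → depth τ ≤ depth x
  depth-descendant self = ℕₚ.≤-refl
  depth-descendant (below d lt) = ℕₚ.≤-trans (depth-descendant d) (ℕₚ.<⇒≤ lt)

  HasParent : (V T → Set) → V T → Set
  HasParent S τ = S (par τ) × depth (par τ) < depth τ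

  -- A walk can leave the descendants of τ only along the edge from τ to its parent, and then the
  -- parent belongs to S.
  walk-up : ∀ {S : V T → Set} {τ x ρ} → Descendant τ x → ReachIn T S x ρ → Descendant τ ρ ⊎ HasParent S τ
  walk-up d (here _) = inj₁ d
  walk-up d (step {u} {w} _ e r) with edge u w e
  walk-up self (step _ e r) | inj₁ (refl , lt) = inj₂ (reach-start r , lt)
  walk-up (below d _) (step _ e r) | inj₁ (refl , lt) = walk-up d r
  walk-up d (step _ e r) | inj₂ (refl , lt) = walk-up (below d lt) r

  record Top (S : V T → Set) (ρ : V T) : Set where
    field
      inS : S ρ
      lowest : ∀ τ → S τ → depth ρ ≤ depth τ
      upward : ∀ τ → S τ → τ ≡ ρ ⊎ HasParent S τ

  -- If the walk from τ to ρ stays below τ, then ρ is a descendant of τ, and by its minimal depth it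
  -- is τ; otherwise the walk passes through the parent of τ.
  connected⇒top : ∀ {S : V T → Set} {ρ} → S ρ → (∀ τ → S τ → depth ρ ≤ depth τ) →
    (∀ τ → S τ → ReachIn T S τ ρ) → Top S ρ
  connected⇒top {S} {ρ} Sρ low conn = record { inS = Sρ ; lowest = low ; upward = up }
    where
    up : ∀ τ → S τ → τ ≡ ρ ⊎ HasParent S τ
    up τ Sτ with walk-up self (conn τ Sτ)
    ... | inj₂ h = inj₂ h
    ... | inj₁ self = inj₁ refl
    ... | inj₁ (below d lt) = contradiction (low τ Sτ) (ℕₚ.<⇒≱ (ℕₚ.≤-<-trans (depth-descendant d) lt))

  -- Climbing from a common vertex stays in both sets until S reaches its top; S′ cannot stop
  -- earlier, its top being no deeper. This is the form of the Helly property of subtrees used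
  -- below.
  deeper-top-shared : ∀ {S S′ : V T → Set} {ρ ρ′} → Top S ρ → Top S′ ρ′ → depth ρ′ ≤ depth ρ →
    ∀ τ → S τ → S′ τ → S′ ρ
  deeper-top-shared {S} {S′} {ρ} {ρ′} top top′ le τ = go (depth τ) τ ℕₚ.≤-refl
    where
    go : ∀ fuel τ → depth τ ≤ fuel → S τ → S′ τ → S′ ρ
    go fuel τ d Sτ S′τ with Top.upward top τ Sτ | Top.upward top′ τ S′τ
    ... | inj₁ refl | _ = S′τ
    ... | inj₂ (Sπ , lt) | inj₁ refl = contradiction (ℕₚ.≤-trans le (Top.lowest top _ Sπ)) (ℕₚ.<⇒≱ lt)
    go zero τ d Sτ S′τ | inj₂ (Sπ , lt) | inj₂ (S′π , _) = contradiction (ℕₚ.<-≤-trans lt d) λ ()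
    go (suc fuel) τ d Sτ S′τ | inj₂ (Sπ , lt) | inj₂ (S′π , _) =
      go fuel (par τ) (ℕₚ.≤-pred (ℕₚ.≤-trans lt d)) Sπ S′π

abstract
  -- The order is a parameter so that one proof yields both a maximum and, with the order reversed,
  -- a minimum.
  extremum : (_≼_ : ℕ → ℕ → Set) → (∀ a → a ≼ a) → (∀ {a b c} → a ≼ b → b ≼ c → a ≼ c) → (∀ a b → a ≼ b ⊎ b ≼ a) →
    ∀ {k} (f : Fin k → ℕ) {P : Fin k → Set} → (∀ x → Dec (P x)) → ∃ P →
    ∃ λ x → P x × ∀ y → P y → f y ≼ f x
  extremum _≼_ rfl trn tot {suc k} f {P} P? (x , Px) with Finₚ.any? (P? ∘ suc)
  extremum _≼_ rfl trn tot {suc k} f {P} P? (zero , Px) | no none =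
    zero , Px , λ { zero _ → rfl _ ; (suc y) Py → contradiction (y , Py) none }
  extremum _≼_ rfl trn tot {suc k} f {P} P? (suc x , Px) | no none = contradiction (x , Px) none
  extremum _≼_ rfl trn tot {suc k} f {P} P? _ | yes some
    with extremum _≼_ rfl trn tot (f ∘ suc) {P ∘ suc} (P? ∘ suc) some
  ... | x , Px , max with P? zero
  ... | no ¬P0 = suc x , Px , λ { zero P0 → contradiction P0 ¬P0 ; (suc y) Py → max y Py }
  ... | yes P0 with tot (f zero) (f (suc x))
  ... | inj₁ le = suc x , Px , λ { zero _ → le ; (suc y) Py → max y Py }
  ... | inj₂ ge = zero , P0 , λ { zero _ → rfl _ ; (suc y) Py → trn (max y Py) ge }

-- Connected components

abstract
  -- Edges are processed one at a time; at an edge xy all vertices represented by `rep x` are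
  -- redirected to `rep y`. Components thereby become decidable.
  representatives : ∀ X → Σ (V X → V X) λ rep →
    (∀ u → ReachIn X (λ _ → ⊤) u (rep u)) × (∀ u v → E X u v → rep u ≡ rep v)
  representatives X with go (cartesianProduct (allFin (n X)) (allFin (n X)))
    where
    go : (es : List (V X × V X)) → Σ (V X → V X) λ rep →
      (∀ u → ReachIn X (λ _ → ⊤) u (rep u)) × (∀ u v → (u , v) ∈ es → E X u v → rep u ≡ rep v)
    go [] = (λ u → u) , (λ u → here tt) , λ u v ()
    go ((x , y) ∷ es) with go es | true? (adj X x y)
    ... | rep , reach , same-rep | no ¬e = rep , reach , λ
      { u v (here refl) e → contradiction e ¬e ; u v (there m) e → same-rep u v m e }
    ... | rep , reach , same-rep | yes exy = rep′ , reach′ , same-rep′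
      where
      rep′ : V X → V X
      rep′ u = if ⌊ rep u ≟ rep x ⌋ then rep y else rep u
      reach′ : ∀ u → ReachIn X (λ _ → ⊤) u (rep′ u)
      reach′ u with rep u ≟ rep x
      ... | no _ = reach u
      ... | yes q = reach-trans (subst (ReachIn X _ u) q (reach u))
        (reach-trans (reach-sym (reach x)) (step tt exy (reach y)))
      same-rep′ : ∀ u v → (u , v) ∈ ((x , y) ∷ es) → E X u v → rep′ u ≡ rep′ v
      same-rep′ u v (there m) e = cong (λ r → if ⌊ r ≟ rep x ⌋ then rep y else r) (same-rep u v m e)
      same-rep′ u v (here refl) e with rep x ≟ rep x | rep y ≟ rep x
      ... | yes _ | yes _ = refl
      ... | yes _ | no _ = refl
      ... | no ne | _ = contradiction refl ne
  ... | rep , reach , same-rep = rep , reach , λ u v → same-rep u v (∈-cartesianProduct⁺ (∈-allFin u) (∈-allFin v))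

module Components (X : Graph) where
  rep = proj₁ (representatives X)
  rep-reach = proj₁ (proj₂ (representatives X))
  rep-edge = proj₂ (proj₂ (representatives X))

  rep-walk : ∀ {u v} → ReachIn X (λ _ → ⊤) u v → rep u ≡ rep v
  rep-walk (here _) = refl
  rep-walk (step _ e r) = trans (rep-edge _ _ e) (rep-walk r)

  rep-idem : ∀ u → rep (rep u) ≡ rep u
  rep-idem u = sym (rep-walk (rep-reach u))

  component-set : V X → V X → Bool
  component-set r a = ⌊ rep a ≟ r ⌋

  component : V X → Graph
  component r = induced X (component-set r)

  component-rep : ∀ r a → rep (enum (component-set r) a) ≡ r
  component-rep r a = ⌊⌋-sound (_ ≟ r) (enum-true (component-set r) a)

  component-walk : ∀ r {u v} → ReachIn X (λ _ → ⊤) u v → ∀ a b →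
    enum (component-set r) a ≡ u → enum (component-set r) b ≡ v → ReachIn (component r) (λ _ → ⊤) a b
  component-walk r (here _) a b refl eb with enum-injective (component-set r) eb
  ... | refl = here tt
  component-walk r (step {u} {w} _ e q) a b refl eb = step tt
      (trans (cong (adj X u) (enum-rank (component-set r) w pw)) e)
      (component-walk r q (rank (component-set r) w pw) b (enum-rank (component-set r) w pw) eb)
    where
    pw : component-set r w ≡ true
    pw = ⌊⌋-complete (rep w ≟ r) (trans (sym (rep-edge u w e)) (component-rep r a))

  component-connected : ∀ r → Connected (component r)
  component-connected r a b = component-walk r (reach-trans (rep-reach _)
    (subst (λ z → ReachIn X (λ _ → ⊤) z _) (trans (component-rep r b) (sym (component-rep r a))) (reach-sym (rep-reach _)))) a b refl refl

  component-IsComponent : ∀ r → rep r ≡ r → IsComponent (component r) X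
  component-IsComponent r e = enum (component-set r) , induced-emb X (component-set r) ,
    Fin-positive (rank (component-set r) r (⌊⌋-complete (rep r ≟ r) e)) , component-connected r ,
    λ a x ex → let px = ⌊⌋-complete (rep x ≟ r) (trans (sym (rep-edge _ _ ex)) (component-rep r a)) in
      rank (component-set r) x px , enum-rank (component-set r) x px

-- Global covers from tree decompositions

module TreewidthColouring {𝒢 : GraphClass} (closed : ComponentClosed 𝒢) {H : Graph} {w : ℕ} (D : TreeDecomp H w)
  {s : ℕ} (C : InjCover (mem 𝒢) H) (L : Labelling C s) where
  open TreeDecomp D
  open Rooted (tree⇒rooted T isTree)
  open Subtrees (tree⇒rooted T isTree)
  module K i = Components (comp C i)

  -- A component is named by the vertex representing it; the condition `K.rep i r ≡ r` leaves
  -- exactly one index per component.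
  I : Set
  I = Σ (Fin (t C)) λ i → Σ (V (comp C i)) λ r → K.rep i r ≡ r

  size : Fin (t C) → ℕ
  size = n ∘ comp C

  isRep : Fin (sumFin size) → Bool
  isRep x = let (i , r) = unpair size x in ⌊ K.rep i r ≟ r ⌋

  dec : Fin (countFin isRep) → I
  dec x = let (i , r) = unpair size (enum isRep x) in i , r , ⌊⌋-sound (K.rep i r ≟ r) (enum-true isRep x)

  isRep-pair : ∀ i r → K.rep i r ≡ r → isRep (pair size i r) ≡ true
  isRep-pair i r e rewrite unpair-pair size i r = ⌊⌋-complete (K.rep i r ≟ r) e

  I-≡ : {x y : I} → _≡_ {A = Σ (Fin (t C)) (V ∘ comp C)} (proj₁ x , proj₁ (proj₂ x)) (proj₁ y , proj₁ (proj₂ y)) → x ≡ y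
  I-≡ {i , r , e} {.i , .r , e′} refl = cong (λ q → i , r , q) (uip e e′)

  enc : I → Fin (countFin isRep)
  enc (i , r , e) = rank isRep (pair size i r) (isRep-pair i r e)

  dec-enc : ∀ x → dec (enc x) ≡ x
  dec-enc (i , r , e) = I-≡ (trans (cong (unpair size) (enum-rank isRep (pair size i r) (isRep-pair i r e))) (unpair-pair size i r))

  dec-injective : ∀ {x y} → dec x ≡ dec y → x ≡ y
  dec-injective e = enum-injective isRep (unpair-injective size (cong (λ q → proj₁ q , proj₁ (proj₂ q)) e))

  piece : I → Graph
  piece (i , r , _) = K.component i r

  vert : (x : I) → V (piece x) → V (comp C (proj₁ x))
  vert (i , r , _) = enum (K.component-set i r)

  ψ : (x : I) → V (piece x) → V H
  ψ x a = φ C (proj₁ x) (vert x a)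

  piece-surj : ∀ u v → E H u v → Σ I λ x → ∃ λ a → ∃ λ b → E (piece x) a b × ψ x a ≡ u × ψ x b ≡ v
  piece-surj u v e with edge-surj C u v e
  ... | i , a , b , eab , refl , refl = (i , K.rep i a , K.rep-idem i a) ,
      rank S a pa , rank S b pb , trans (cong₂ (adj (comp C i)) (enum-rank S a pa) (enum-rank S b pb)) eab ,
      cong (φ C i) (enum-rank S a pa) , cong (φ C i) (enum-rank S b pb)
    where
    S = K.component-set i (K.rep i a)
    pa : S a ≡ true
    pa = ⌊⌋-complete (K.rep i a ≟ K.rep i a) refl
    pb : S b ≡ true
    pb = ⌊⌋-complete (K.rep i b ≟ K.rep i a) (sym (K.rep-edge i a b eab))

  C′ : InjCover (mem 𝒢) H
  C′ = coverFrom dec enc dec-enc piece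
    (λ { (i , r , e) → closed _ _ (inP C i) (K.component-IsComponent i r e) })
    ψ (λ x a b e → hom C _ _ _ e) piece-surj (λ { (i , r , _) e → enum-injective (K.component-set i r) (inj C i e) })

  piece-lab : (x : I) → V (piece x) → Fin s
  piece-lab x a = lab L (proj₁ x) (vert x a)

  piece-lab-inj : ∀ x y a b → ψ x a ≡ ψ y b → piece-lab x a ≡ piece-lab y b → x ≡ y
  piece-lab-inj x@(i , r , _) y@(j , r′ , _) a b e el = I-≡
    (trans (cong (i ,_) (sym (K.component-rep i r a)))
      (trans (cong (λ q → proj₁ q , K.rep (proj₁ q) (proj₂ q)) (lab-inj L i j _ _ e el))
        (cong (j ,_) (K.component-rep j r′ b))))

  Hits : I → V T → Set
  Hits x τ = ∃ λ a → bag τ (ψ x a) ≡ true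

  hits? : ∀ x τ → Dec (Hits x τ)
  hits? x τ = Finₚ.any? (λ a → true? (bag τ (ψ x a)))

  -- Adjacent vertices of a piece map to adjacent vertices of H, which share a bag, so their
  -- subtrees overlap and can be chained along a walk in the piece.
  hits-walk : ∀ x {a b} → ReachIn (piece x) (λ _ → ⊤) a b → ∀ τ τ′ →
    bag τ (ψ x a) ≡ true → bag τ′ (ψ x b) ≡ true → ReachIn T (Hits x) τ τ′
  hits-walk x {a} (here _) τ τ′ p q = reach-map (a ,_) (subtree (ψ x a) τ τ′ p q)
  hits-walk x {a} (step {w = b} _ e r) τ τ′ p q with ecover (ψ x a) (ψ x b) (hom C _ _ _ e)
  ... | σ , pa , pb = reach-trans (reach-map (a ,_) (subtree (ψ x a) τ σ p pa)) (hits-walk x r σ τ′ pb q)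

  hits-connected : ∀ x τ τ′ → Hits x τ → Hits x τ′ → ReachIn T (Hits x) τ τ′
  hits-connected x@(i , r , _) τ τ′ (a , p) (b , q) = hits-walk x (K.component-connected i r a b) τ τ′ p q

  hits-nonempty : ∀ x → ∃ (Hits x)
  hits-nonempty x@(i , r , e) = let (τ , p) = vcover (ψ x a) in τ , a , p
    where
    a : V (piece x)
    a = rank (K.component-set i r) r (⌊⌋-complete (K.rep i r ≟ r) e)

  top : ∀ x → ∃ (Top (Hits x))
  top x with extremum (λ a b → b ≤ a) (λ _ → ℕₚ.≤-refl) (λ p q → ℕₚ.≤-trans q p) (λ a b → ℕₚ.≤-total b a)
               depth (hits? x) (hits-nonempty x)
  ... | ρ , hit , low = ρ , connected⇒top hit low (λ τ h → hits-connected x τ ρ h hit)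

  Meets : I → I → Set
  Meets x y = ∃ λ a → ∃ λ b → ψ x a ≡ ψ y b

  meets? : ∀ x y → Dec (Meets x y)
  meets? x y = Finₚ.any? (λ a → Finₚ.any? (λ b → ψ x a ≟ ψ y b))

  Conflict : (x y : Fin (countFin isRep)) → Set
  Conflict x y = x ≢ y × Meets (dec x) (dec y)

  conflict-symmetric : ∀ {x y} → Conflict x y → Conflict y x
  conflict-symmetric (ne , a , b , q) = (λ e → ne (sym e)) , b , a , sym q

  abstract
    conflict : (x y : Fin (countFin isRep)) → Bool
    conflict x y = ⌊ ¬? (x ≟ y) ×-dec meets? (dec x) (dec y) ⌋

    conflict-sound : ∀ {x y} → conflict x y ≡ true → Conflict x y
    conflict-sound {x} {y} = ⌊⌋-sound (¬? (x ≟ y) ×-dec meets? (dec x) (dec y))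

    conflict-complete : ∀ {x y} → Conflict x y → conflict x y ≡ true
    conflict-complete {x} {y} = ⌊⌋-complete (¬? (x ≟ y) ×-dec meets? (dec x) (dec y))

  conflicts : Graph
  conflicts = record
    { n = countFin isRep
    ; adj = conflict
    ; adj-sym = λ x y → bool-ext (conflict-complete ∘ conflict-symmetric ∘ conflict-sound)
        (conflict-complete ∘ conflict-symmetric ∘ conflict-sound)
    ; adj-irrefl = λ x → ¬true⇒false (λ e → proj₁ (conflict-sound e) refl) }

  -- A piece is determined by a vertex at which it meets the bag, one of at most `suc w`, and its
  -- label there.
  few-pieces-at-node : ∀ ρ (p : Fin (countFin isRep) → Bool) → (∀ x → p x ≡ true → Hits (dec x) ρ) →
    countFin p ≤ suc w * s
  few-pieces-at-node ρ p hits = ℕₚ.≤-trans (Finₚ.injective⇒≤ {f = g} g-inj) (ℕₚ.*-monoˡ-≤ s (width ρ))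
    where
    x : Fin (countFin p) → I
    x j = dec (enum p j)
    a : ∀ j → V (piece (x j))
    a j = proj₁ (hits (enum p j) (enum-true p j))
    in-bag : ∀ j → bag ρ (ψ (x j) (a j)) ≡ true
    in-bag j = proj₂ (hits (enum p j) (enum-true p j))
    g : Fin (countFin p) → Fin (countFin (bag ρ) * s)
    g j = combine (rank (bag ρ) (ψ (x j) (a j)) (in-bag j)) (piece-lab (x j) (a j))
    g-inj : Injective _≡_ _≡_ g
    g-inj {i} {j} e = enum-injective p (dec-injective (piece-lab-inj (x i) (x j) (a i) (a j)
      (rank-injective (bag ρ) (in-bag i) (in-bag j) (proj₁ eqs)) (proj₂ eqs)))
      where
      eqs = Finₚ.combine-injective (rank (bag ρ) (ψ (x i) (a i)) (in-bag i)) (piece-lab (x i) (a i))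
              (rank (bag ρ) (ψ (x j) (a j)) (in-bag j)) (piece-lab (x j) (a j)) e

  meets⇒hits-top : ∀ x y → Meets x y → depth (proj₁ (top y)) ≤ depth (proj₁ (top x)) → Hits y (proj₁ (top x))
  meets⇒hits-top x y (a , b , q) le = let (τ , h) = vcover (ψ x a) in
    deeper-top-shared (proj₂ (top x)) (proj₂ (top y)) le τ (a , h) (b , subst (λ v → bag τ v ≡ true) q h)

  -- Pieces in conflict with one whose top is deepest all contain that top, and few pieces contain a given node.
  conflicts-degenerate : Degenerate conflicts (suc w * s)
  conflicts-degenerate U some = x , proj₁ (proj₂ best) , few-pieces-at-node (proj₁ (top (dec x))) _
    λ y e → meets⇒hits-top (dec x) (dec y) (proj₂ (conflict-sound (proj₂ (∧-true {U y} e))))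
      (proj₂ (proj₂ best) y (proj₁ (∧-true {U y} e)))
    where
    best = extremum _≤_ (λ _ → ℕₚ.≤-refl) ℕₚ.≤-trans ℕₚ.≤-total
      (λ x → depth (proj₁ (top (dec x)))) {λ x → U x ≡ true} (λ x → true? (U x)) some
    x = proj₁ best

  proper-disjoint : ∀ {k} ((c , _) : Colourable conflicts k) → ∀ x y a b → c x ≡ c y → φ C′ x a ≡ φ C′ y b → x ≡ y
  proper-disjoint (c , proper) x y a b ec e = decidable-stable (x ≟ y)
    λ ne → proper x y (conflict-complete (ne , a , b , e)) ec

  global : HasGlobalCover 𝒢 H (suc (suc w * s))
  global = colouring⇒global {𝒢} C′ _ (proj₁ colouring) (proper-disjoint colouring)
    where
    colouring : Colourable conflicts (suc (suc w * s))
    colouring = degenerate⇒colourable conflicts (suc w * s) conflicts-degenerate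

bounded-treewidth : ∀ 𝒢 ℋ → ComponentClosed 𝒢 → BoundedTreewidth ℋ → Bounded 𝒢 ℋ
bounded-treewidth 𝒢 ℋ closed (w , decomp) = bounded-intro 𝒢 ℋ (λ s → suc (suc w * s)) λ H H∈ s (C , le) →
  TreewidthColouring.global {𝒢} closed (decomp H H∈) C (local⇒labelling C s le)

-- Unboundedness

-- Existence of a cover of given size is an arbitrary predicate, so the least number is found only
-- classically; the refutations using it have conclusion ⊥.
¬¬-least : ∀ (P : ℕ → Set) N → P N → ¬ ¬ (∃ λ k → k ≤ N × P k × (∀ j → j < k → ¬ P j))
¬¬-least P N PN none = <-rec (λ k → k ≤ N → ¬ P k)
  (λ k ih k≤N Pk → none (k , k≤N , Pk , λ j j<k → ih j<k (ℕₚ.≤-trans (ℕₚ.<⇒≤ j<k) k≤N))) N ℕₚ.≤-refl PN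

local⇒some-global : ∀ {𝒢 H s} → HasLocalCover 𝒢 H s → ∃ λ N → HasGlobalCover 𝒢 H N
local⇒some-global {𝒢} (C , _) = t C , colouring⇒global {𝒢} C (t C) (λ i → i) (λ _ _ _ _ e _ → e)

unbounded : ∀ {𝒢 ℋ} → (∀ m → Σ Graph λ H → mem ℋ H × HasLocalCover 𝒢 H 2 × (∀ k → HasGlobalCover 𝒢 H k → m ≤ k)) →
  ¬ Bounded 𝒢 ℋ
-- The local cover number is known only to be at most 2 and f may fail to be monotone; the sum
-- dominates all three possible values.
unbounded {𝒢} {ℋ} family (f , bound) with family (suc (f 0 + (f 1 + f 2)))
... | H , H∈ , local , lower =
  let (N , glob) = local⇒some-global {𝒢} local in
  ¬¬-least (HasLocalCover 𝒢 H) 2 local λ (s , s≤2 , ls , mins) →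
  ¬¬-least (HasGlobalCover 𝒢 H) N glob λ (k , _ , gk , mink) →
  ℕₚ.<⇒≱ (lower k gk) (ℕₚ.≤-trans (proj₂ (bound H H∈ s k (ls , mins) (gk , mink))) (f≤ s s≤2))
  where
  f≤ : ∀ s → s ≤ 2 → f s ≤ f 0 + (f 1 + f 2)
  f≤ 0 _ = ℕₚ.m≤m+n (f 0) _
  f≤ 1 _ = ℕₚ.≤-trans (ℕₚ.m≤m+n (f 1) (f 2)) (ℕₚ.m≤n+m _ (f 0))
  f≤ 2 _ = ℕₚ.≤-trans (ℕₚ.m≤n+m (f 2) (f 1)) (ℕₚ.m≤n+m _ (f 0))
  f≤ (suc (suc (suc s))) (s≤s (s≤s ()))

-- Shared by both constructions: r and c are the two entries of a pair for shift graphs, and row and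
-- column of a gadget for gadget graphs.
line : ∀ {A : Set} {m} → (A → Fin m) → (A → Fin m) → Fin m → A → Bool
line r c i v = ⌊ r v ≟ i ⌋ ∨ ⌊ c v ≟ i ⌋

line-cases : ∀ {A : Set} {m} (r c : A → Fin m) i v → line r c i v ≡ true → r v ≡ i ⊎ c v ≡ i
line-cases r c i v e with ∨-true e
... | inj₁ p = inj₁ (⌊⌋-sound (r v ≟ i) p)
... | inj₂ p = inj₂ (⌊⌋-sound (c v ≟ i) p)

on-line : ∀ {A : Set} {m} (r c : A → Fin m) i v → r v ≡ i ⊎ c v ≡ i → line r c i v ≡ true
on-line r c i v (inj₁ e) = cong (_∨ ⌊ c v ≟ i ⌋) (⌊⌋-complete (r v ≟ i) e)
on-line r c i v (inj₂ e) = ∨-trueʳ ⌊ r v ≟ i ⌋ (⌊⌋-complete (c v ≟ i) e)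

-- A vertex lies only on the lines `r v` and `c v`; the label `side` tells which of the two is
-- meant.
lines⇒local : ∀ {𝒢 H m} (r c : V H → Fin m) → (∀ i → mem 𝒢 (induced H (line r c i))) →
  (∀ u v → E H u v → ∃ λ i → line r c i u ≡ true × line r c i v ≡ true) → HasLocalCover 𝒢 H 2
lines⇒local {𝒢} {H} {m} r c line∈ covers = C , labelling⇒local C 2 (record { lab = lb ; lab-inj = lb-inj })
  where
  C : InjCover (mem 𝒢) H
  C = record
    { t = m ; comp = λ i → induced H (line r c i) ; inP = line∈ ; φ = λ i → enum (line r c i)
    ; hom = λ i a b e → e
    ; edge-surj = λ u v e → let (i , pu , pv) = covers u v e in
        i , rank (line r c i) u pu , rank (line r c i) v pv ,
        trans (cong₂ (adj H) (enum-rank (line r c i) u pu) (enum-rank (line r c i) v pv)) e ,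
        enum-rank (line r c i) u pu , enum-rank (line r c i) v pv
    ; inj = λ i → enum-injective (line r c i) }
  side : Fin m → V H → Fin 2
  side i v = if ⌊ r v ≟ i ⌋ then zero else suc zero
  lb : ∀ i → V (comp C i) → Fin 2
  lb i a = side i (φ C i a)
  side-inj : ∀ i j v → line r c i v ≡ true → line r c j v ≡ true → side i v ≡ side j v → i ≡ j
  side-inj i j v pi pj e with r v ≟ i | r v ≟ j
  ... | yes p | yes q = trans (sym p) q
  ... | no p | no q = trans (sym (⌊⌋-sound (c v ≟ i) pi)) (⌊⌋-sound (c v ≟ j) pj)
  lb-inj : ∀ i j a b → φ C i a ≡ φ C j b → lb i a ≡ lb j b → _≡_ {A = Σ (Fin m) (V ∘ comp C)} (i , a) (j , b)
  lb-inj i j a b e el with side-inj i j (φ C i a) (enum-true (line r c i) a)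
       (trans (cong (line r c j) e) (enum-true (line r c j) b)) (trans el (cong (side j) (sym e)))
  ... | refl = cong (i ,_) (enum-injective (line r c i) e)

-- Shift graphs

2-colourable : GraphClass
2-colourable = record
  { mem = λ X → Colourable X 2
  ; iso-closed = λ { {X} {Y} (f , g , gf , fg , ad) (c , proper) → c ∘ g , λ u v e →
      proper (g u) (g v) (trans (ad (g u) (g v)) (trans (cong₂ (adj Y) (fg u) (fg v)) e)) } }

2-colourable-monotone : Monotone 2-colourable
2-colourable-monotone X Y e (c , proper) (_ , hm) = c ∘ e , λ u v q → proper _ _ (hm u v q)

2-colourable-K₂ : mem 2-colourable K₂
2-colourable-K₂ = (λ v → v) , λ { zero (suc zero) _ () ; (suc zero) zero _ () ; zero zero () ; (suc zero) (suc zero) () }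

2-colourable-bar : ∀ {X} → InBar 2-colourable X → Colourable X 2
2-colourable-bar {X} (k , Ys , Ys∈ , to , from , _ , to-from , ad) = c ∘ from , λ u v e →
    differ (from u) (from v) (unionAdj-true Ys (from u) (from v)
      (trans (sym (ad (from u) (from v))) (trans (cong₂ (adj X) (to-from u) (to-from v)) e)))
  where
  c : UnionV Ys → Fin 2
  c (i , a) = proj₁ (Ys∈ i) a
  differ : ∀ p q → SameComp Ys p q → c p ≢ c q
  differ _ _ (same i a b e) = proj₂ (Ys∈ i) a b e

-- The product of the 2-colourings of the components, with `zero` outside their images: an edge is
-- separated in the coordinate of a component that lifts it.
cover⇒colourable : ∀ {H} (C : InjCover (λ X → Colourable X 2) H) → Colourable H (2 ^ t C)
cover⇒colourable {H} C = (λ v → funToFin (λ k → colour k v)) , proper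
  where
  colour : Fin (t C) → V H → Fin 2
  colour k v with Finₚ.any? (λ a → φ C k a ≟ v)
  ... | yes (a , _) = proj₁ (inP C k) a
  ... | no _ = zero
  colour-φ : ∀ k a → colour k (φ C k a) ≡ proj₁ (inP C k) a
  colour-φ k a with Finₚ.any? (λ b → φ C k b ≟ φ C k a)
  ... | yes (b , e) = cong (proj₁ (inP C k)) (inj C k e)
  ... | no none = contradiction (a , refl) none
  proper : ∀ u v → E H u v → funToFin (λ k → colour k u) ≢ funToFin (λ k → colour k v)
  proper u v e q with edge-surj C u v e
  ... | k , a , b , eab , refl , refl = proj₂ (inP C k) a b eab
    (trans (sym (colour-φ k a)) (trans (trans (sym (Finₚ.finToFun-funToFin (λ k → colour k u) k))
      (trans (cong (λ g → finToFun g k) q) (Finₚ.finToFun-funToFin (λ k → colour k v) k))) (colour-φ k b)))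

module Shift (N : ℕ) where

  Pair : Set
  Pair = Fin N × Fin N

  -- Pairs that are not increasing stay in the graph as isolated vertices, so the vertex set is a
  -- full square.
  Arc : Pair → Pair → Set
  Arc (i , j) (k , l) = j ≡ k × i Fin.< j × k Fin.< l

  arc? : ∀ p q → Dec (Arc p q)
  arc? (i , j) (k , l) = (j ≟ k) ×-dec ((i Finₚ.<? j) ×-dec (k Finₚ.<? l))

  arc-cases : ∀ p q → ⌊ arc? p q ⌋ ∨ ⌊ arc? q p ⌋ ≡ true → Arc p q ⊎ Arc q p
  arc-cases p q e = Data.Sum.map (⌊⌋-sound (arc? p q)) (⌊⌋-sound (arc? q p)) (∨-true e)

  dec : Fin (N * N) → Pair
  dec = remQuot N

  shift : Graph
  shift = record
    { n = N * N
    ; adj = λ x y → ⌊ arc? (dec x) (dec y) ⌋ ∨ ⌊ arc? (dec y) (dec x) ⌋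
    ; adj-sym = λ x y → Boolₚ.∨-comm ⌊ arc? (dec x) (dec y) ⌋ _
    ; adj-irrefl = λ x → ¬true⇒false (λ e → no-loop (dec x) (Data.Sum.reduce (arc-cases (dec x) (dec x) e))) }
    where
    no-loop : ∀ p → ¬ Arc p p
    no-loop (i , j) (refl , lt , _) = Finₚ.<-irrefl refl lt

  shift-arc : ∀ x y → E shift x y → Arc (dec x) (dec y) ⊎ Arc (dec y) (dec x)
  shift-arc x y = arc-cases (dec x) (dec y)

  row col : V shift → Fin N
  row x = proj₁ (dec x)
  col x = proj₂ (dec x)

  arc-middle : ∀ x y → Arc (dec x) (dec y) → line row col (col x) x ≡ true × line row col (col x) y ≡ true
  arc-middle x y (e , _) = on-line row col _ x (inj₂ refl) , on-line row col _ y (inj₁ (sym e))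

  covered : ∀ x y → E shift x y → ∃ λ i → line row col i x ≡ true × line row col i y ≡ true
  covered x y e with shift-arc x y e
  ... | inj₁ a = col x , arc-middle x y a
  ... | inj₂ a = col y , proj₂ (arc-middle y x a) , proj₁ (arc-middle y x a)

  side : Fin N → Pair → Fin 2
  side i p = if ⌊ proj₁ p ≟ i ⌋ then suc zero else zero

  -- The first entries x < y of the ends of an arc cannot both be i; if neither is, the first pair,
  -- whose entries are x and y, is off the line.
  side-differs : ∀ i p q → Arc p q → proj₁ p ≡ i ⊎ proj₂ p ≡ i → proj₁ q ≡ i ⊎ proj₂ q ≡ i → side i p ≢ side i q
  side-differs i (x , y) (.y , z) (refl , x<y , y<z) pi qi with x ≟ i | y ≟ i
  ... | yes refl | yes refl = λ _ → Finₚ.<-irrefl refl x<y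
  ... | yes _ | no _ = λ ()
  ... | no _ | yes _ = λ ()
  ... | no x≢i | no y≢i = λ _ → Data.Sum.[ x≢i , y≢i ] pi

  line-2-colourable : ∀ i → Colourable (induced shift (line row col i)) 2
  line-2-colourable i = (λ a → side i (dec (enum L a))) , λ a b e → proper a b (shift-arc (enum L a) (enum L b) e)
    where
    L = line row col i
    proper : ∀ a b → Arc (dec (enum L a)) (dec (enum L b)) ⊎ Arc (dec (enum L b)) (dec (enum L a)) →
      side i (dec (enum L a)) ≢ side i (dec (enum L b))
    proper a b (inj₁ arc) = side-differs i _ _ arc (line-cases row col i _ (enum-true L a)) (line-cases row col i _ (enum-true L b))
    proper a b (inj₂ arc) e = side-differs i _ _ arc (line-cases row col i _ (enum-true L b)) (line-cases row col i _ (enum-true L a)) (sym e)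

  -- The sets of colours occurring on pairs ending in j are distinct for distinct j.
  colourable⇒small : ∀ k → Colourable shift k → N ≤ 2 ^ k
  colourable⇒small k (c , proper) = Finₚ.injective⇒≤ {f = λ j → funToFin (code j)} code-inj
    where
    colour : Fin N → Fin N → Fin k
    colour i j = c (combine i j)
    Occurs : Fin N → Fin k → Set
    Occurs j a = ∃ λ i → i Fin.< j × colour i j ≡ a
    occurs? : ∀ j a → Dec (Occurs j a)
    occurs? j a = Finₚ.any? (λ i → (i Finₚ.<? j) ×-dec (colour i j ≟ a))
    code : Fin N → Fin k → Fin 2
    code j a = if ⌊ occurs? j a ⌋ then suc zero else zero
    arc-edge : ∀ i j l → i Fin.< j → j Fin.< l → E shift (combine i j) (combine j l)
    arc-edge i j l i<j j<l = cong (_∨ ⌊ arc? (dec (combine j l)) (dec (combine i j)) ⌋)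
      (⌊⌋-complete (arc? _ _) (subst₂ Arc (sym (Finₚ.remQuot-combine i j)) (sym (Finₚ.remQuot-combine j l)) (refl , i<j , j<l)))
    -- The colour of the pair (j , l) occurs at l, but not at j, as every pair (i , j) with i < j is
    -- adjacent to (j , l).
    code-≢ : ∀ j l → j Fin.< l → code j (colour j l) ≢ code l (colour j l)
    code-≢ j l j<l with occurs? j (colour j l) | occurs? l (colour j l)
    ... | yes (i , i<j , e) | _ = λ _ → proper _ _ (arc-edge i j l i<j j<l) e
    ... | no _ | yes _ = λ ()
    ... | no _ | no none = λ _ → none (j , j<l , refl)
    same-code : ∀ {j l} → funToFin (code j) ≡ funToFin (code l) → ∀ a → code j a ≡ code l a
    same-code {j} {l} e a = trans (sym (Finₚ.finToFun-funToFin (code j) a))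
      (trans (cong (λ g → finToFun g a) e) (Finₚ.finToFun-funToFin (code l) a))
    code-inj : Injective _≡_ _≡_ (λ j → funToFin (code j))
    code-inj {j} {l} e with Finₚ.<-cmp j l
    ... | tri< j<l _ _ = contradiction (same-code e _) (code-≢ j l j<l)
    ... | tri≈ _ q _ = q
    ... | tri> _ _ l<j = contradiction (sym (same-code e _)) (code-≢ l j l<j)

allGraphs : GraphClass
allGraphs = record { mem = λ _ → ⊤ ; iso-closed = λ _ _ → tt }

shift-unbounded : ¬ Bounded 2-colourable allGraphs
-- A cover by k < m bipartite graphs would give a proper colouring with `2 ^ k` colours, hence N ≤
-- `2 ^ (2 ^ k)`; N is chosen just beyond `2 ^ (2 ^ m)`.
shift-unbounded = unbounded {2-colourable} {allGraphs} λ m → let open Shift (suc (2 ^ (2 ^ m))) in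
  shift , tt , lines⇒local {2-colourable} row col line-2-colourable covered , λ { k (C , refl) → ℕₚ.≮⇒≥ λ k<m →
    ℕₚ.<⇒≱ (s≤s (ℕₚ.^-monoʳ-≤ 2 (ℕₚ.^-monoʳ-≤ 2 (ℕₚ.<⇒≤ k<m))))
      (colourable⇒small (2 ^ t C) (cover⇒colourable (bar⇒2-colourable C))) }
  where
  bar⇒2-colourable : ∀ {H} (C : InjCover (InBar 2-colourable) H) → InjCover (λ X → Colourable X 2) H
  bar⇒2-colourable C = record { t = t C ; comp = comp C ; inP = λ i → 2-colourable-bar {comp C i} (inP C i) ; φ = φ C
    ; hom = hom C ; edge-surj = edge-surj C ; inj = inj C }

-- Gadget graphs

-- A gadget has an edge between a hub and a star centre, and L m leaves of which the first α hang on the centre and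
-- the others on the hub. Gadgets p ≠ q are incomparable: if the centre of q has more leaves, its hub has fewer.
-- Leaf numbers differ by multiples of 5 because a hub has up to four neighbours in other gadgets. A star centre of the
-- graph of size suc m has more than suc m * Dₘ m leaves, where Dₘ m bounds the degrees in all smaller graphs, so that
-- smaller members cannot cover its edges.

abstract
  Kₘ Lₘ Dₘ : ℕ → ℕ
  Kₘ zero = 10
  Kₘ (suc m) = 10 + (5 * (suc m * suc m) + suc m * Dₘ m)
  Lₘ m = Kₘ m + 5 * (m * m)
  Dₘ m = suc (Lₘ m)

  -- A hub has degree at most 5m² + 5, so this bound puts every hub degree below every star degree.
  K-large : ∀ m → 10 + 5 * (m * m) ≤ Kₘ m
  K-large zero = ℕₚ.≤-refl
  K-large (suc m) = ℕₚ.+-monoʳ-≤ 10 (ℕₚ.m≤m+n (5 * (suc m * suc m)) (suc m * Dₘ m))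

  -- At most suc m graphs, each supplying at most `Dₘ m` edges at a star centre, cannot cover that
  -- star.
  K-beats : ∀ m → suc m * Dₘ m < Kₘ (suc m)
  K-beats m = s≤s (ℕₚ.≤-trans (ℕₚ.m≤n+m (suc m * Dₘ m) (5 * (suc m * suc m))) (ℕₚ.m≤n+m _ 9))

  D<K : ∀ m → Dₘ m < Kₘ (suc m)
  D<K m = ℕₚ.≤-<-trans (ℕₚ.m≤m+n (Dₘ m) (m * Dₘ m)) (K-beats m)

  K≤D : ∀ m → Kₘ m ≤ Dₘ m
  K≤D m = ℕₚ.≤-trans (ℕₚ.m≤m+n (Kₘ m) (5 * (m * m))) (ℕₚ.n≤1+n _)

  D-mono : ∀ {m m′} → m ≤ m′ → Dₘ m ≤ Dₘ m′
  D-mono {m} {m′} le = go (ℕₚ.≤⇒≤′ le)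
    where
    go : ∀ {m′} → m Data.Nat.≤′ m′ → Dₘ m ≤ Dₘ m′
    go (Data.Nat.≤′-reflexive refl) = ℕₚ.≤-refl
    go (Data.Nat.≤′-step {n = m″} l) = ℕₚ.≤-trans (go l) (ℕₚ.≤-trans (ℕₚ.<⇒≤ (D<K m″)) (K≤D (suc m″)))

  D<K-mono : ∀ {m m′} → m < m′ → Dₘ m < Kₘ m′
  D<K-mono {m} {suc m′} (s≤s le) = ℕₚ.≤-<-trans (D-mono le) (D<K m′)

  1≤D : ∀ m → 1 ≤ Dₘ m
  1≤D m = s≤s z≤n

  L<D : ∀ m → Lₘ m < Dₘ m
  L<D m = ℕₚ.≤-refl

Pos : ℕ → Set
Pos m = Fin m × Fin m

OnLine : ∀ {m} → Fin m → Pos m → Set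
OnLine i p = proj₁ p ≡ i ⊎ proj₂ p ≡ i

-- `direction` limits the hubs joined to a given hub to four; `joined-line` lets the lines cover the
-- edges between hubs.
record Skeleton (m : ℕ) : Set where
  field
    joined : Pos m → Pos m → Bool
    joined-sym : ∀ p q → joined p q ≡ true → joined q p ≡ true
    joined-irrefl : ∀ p → joined p p ≢ true
    direction : Pos m → Pos m → Fin 4
    direction-injective : ∀ p q q′ → joined p q ≡ true → joined p q′ ≡ true → direction p q ≡ direction p q′ → q ≡ q′
    joined-line : ∀ p q → joined p q ≡ true → ∃ λ i → OnLine i p × OnLine i q

module Gadgets {m : ℕ} (Sk : Skeleton m) where
  open Skeleton Sk public

  L : ℕ
  L = Lₘ m

  index : Pos m → ℕ
  index p = toℕ (combine (proj₁ p) (proj₂ p))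

  index-injective : ∀ {p q} → index p ≡ index q → p ≡ q
  index-injective {p} {q} e =
    let (e₁ , e₂) = Finₚ.combine-injective (proj₁ p) (proj₂ p) (proj₁ q) (proj₂ q) (Finₚ.toℕ-injective e) in cong₂ _,_ e₁ e₂

  abstract
    α : Pos m → ℕ
    α p = Kₘ m + 5 * index p

    α<L : ∀ p → α p < L
    α<L p = ℕₚ.+-monoʳ-< (Kₘ m) (ℕₚ.*-monoʳ-< 5 (Finₚ.toℕ<n (combine (proj₁ p) (proj₂ p))))

    α≥K : ∀ p → Kₘ m ≤ α p
    α≥K p = ℕₚ.m≤m+n (Kₘ m) _

    hub-leaves≤ : ∀ p → L ∸ α p + 5 < Kₘ m
    hub-leaves≤ p = ℕₚ.≤-trans (s≤s (ℕₚ.+-monoˡ-≤ 5 le))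
      (ℕₚ.≤-trans (ℕₚ.≤-trans (s≤s (ℕₚ.≤-reflexive (ℕₚ.+-comm (5 * (m * m)) 5))) (ℕₚ.m≤n+m _ 4)) (K-large m))
      where
      le : L ∸ α p ≤ 5 * (m * m)
      le = ℕₚ.≤-trans (ℕₚ.∸-monoʳ-≤ L (α≥K p)) (ℕₚ.≤-reflexive (ℕₚ.m+n∸m≡n (Kₘ m) _))

    α-reflects-≤ : ∀ p q → α p ≤ α q → index p ≤ index q
    α-reflects-≤ p q le = ℕₚ.*-cancelˡ-≤ 5 (ℕₚ.+-cancelˡ-≤ (Kₘ m) _ _ le)

    -- The left side counts the neighbours of hub p inside its gadget, the right side bounds the
    -- degree of hub q. A larger index costs at least five leaves, so the star centre and four
    -- joined hubs cannot make up for them.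
    hub-reflects-≤ : ∀ p q → suc (L ∸ α p) ≤ L ∸ α q + 5 → index q ≤ index p
    hub-reflects-≤ p q le = ℕₚ.≮⇒≥ λ lt → ℕₚ.<⇒≱ (s≤s (gap lt)) le
      where
      open ℕₚ.≤-Reasoning
      gap : index p < index q → L ∸ α q + 5 ≤ L ∸ α p
      gap lt = begin
        L ∸ α q + 5               ≡⟨ sym (ℕₚ.m+n∸n≡m (L ∸ α q + 5) (α p)) ⟩
        L ∸ α q + 5 + α p ∸ α p   ≡⟨ cong (_∸ α p) (ℕₚ.+-assoc (L ∸ α q) 5 (α p)) ⟩
        L ∸ α q + (5 + α p) ∸ α p ≤⟨ ℕₚ.∸-monoˡ-≤ (α p) (ℕₚ.+-monoʳ-≤ (L ∸ α q) shift) ⟩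
        L ∸ α q + α q ∸ α p       ≡⟨ cong (_∸ α p) (ℕₚ.m∸n+n≡m (ℕₚ.<⇒≤ (α<L q))) ⟩
        L ∸ α p                   ∎
        where
        shift : 5 + α p ≤ α q
        shift = begin
          5 + (Kₘ m + 5 * index p)   ≡⟨ sym (ℕₚ.+-assoc 5 (Kₘ m) _) ⟩
          5 + Kₘ m + 5 * index p     ≡⟨ cong (_+ 5 * index p) (ℕₚ.+-comm 5 (Kₘ m)) ⟩
          Kₘ m + 5 + 5 * index p     ≡⟨ ℕₚ.+-assoc (Kₘ m) 5 _ ⟩
          Kₘ m + (5 + 5 * index p)   ≡⟨ cong (Kₘ m +_) (sym (ℕₚ.*-suc 5 (index p))) ⟩
          Kₘ m + 5 * suc (index p)   ≤⟨ ℕₚ.+-monoʳ-≤ (Kₘ m) (ℕₚ.*-monoʳ-≤ 5 lt) ⟩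
          Kₘ m + 5 * index q         ∎

  Slot : Set
  Slot = Fin (2 + L)

  pattern hub = zero
  pattern star = suc zero
  pattern leaf l = suc (suc l)

  Vertex : Set
  Vertex = Pos m × Slot

  data Adj : Vertex → Vertex → Set where
    hub-star : ∀ {p} → Adj (p , hub) (p , star)
    star-hub : ∀ {p} → Adj (p , star) (p , hub)
    hub-leaf : ∀ {p l} → α p ≤ toℕ l → Adj (p , hub) (p , leaf l)
    leaf-hub : ∀ {p l} → α p ≤ toℕ l → Adj (p , leaf l) (p , hub)
    star-leaf : ∀ {p l} → toℕ l < α p → Adj (p , star) (p , leaf l)
    leaf-star : ∀ {p l} → toℕ l < α p → Adj (p , leaf l) (p , star)
    hub-hub : ∀ {p q} → joined p q ≡ true → Adj (p , hub) (q , hub)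

  Adj-sym : ∀ {u v} → Adj u v → Adj v u
  Adj-sym hub-star = star-hub
  Adj-sym star-hub = hub-star
  Adj-sym (hub-leaf le) = leaf-hub le
  Adj-sym (leaf-hub le) = hub-leaf le
  Adj-sym (star-leaf lt) = leaf-star lt
  Adj-sym (leaf-star lt) = star-leaf lt
  Adj-sym (hub-hub j) = hub-hub (joined-sym _ _ j)

  Adj-irrefl : ∀ {v} → ¬ Adj v v
  Adj-irrefl (hub-hub j) = joined-irrefl _ j

  _≟ₚ_ : (p q : Pos m) → Dec (p ≡ q)
  _≟ₚ_ = ≡-dec _≟_ _≟_

  adj? : ∀ u v → Dec (Adj u v)
  adj? (p , hub) (q , hub) = map′ hub-hub (λ { (hub-hub j) → j }) (true? (joined p q))
  adj? (p , hub) (q , star) = map′ (λ { refl → hub-star }) (λ { hub-star → refl }) (p ≟ₚ q)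
  adj? (p , hub) (q , leaf l) = map′ (λ { (refl , le) → hub-leaf le }) (λ { (hub-leaf le) → refl , le })
    ((p ≟ₚ q) ×-dec (α p ≤? toℕ l))
  adj? (p , star) (q , hub) = map′ (λ { refl → star-hub }) (λ { star-hub → refl }) (p ≟ₚ q)
  adj? (p , star) (q , star) = no λ ()
  adj? (p , star) (q , leaf l) = map′ (λ { (refl , lt) → star-leaf lt }) (λ { (star-leaf lt) → refl , lt })
    ((p ≟ₚ q) ×-dec (toℕ l <? α p))
  adj? (p , leaf l) (q , hub) = map′ (λ { (refl , le) → leaf-hub le }) (λ { (leaf-hub le) → refl , le })
    ((p ≟ₚ q) ×-dec (α p ≤? toℕ l))
  adj? (p , leaf l) (q , star) = map′ (λ { (refl , lt) → leaf-star lt }) (λ { (leaf-star lt) → refl , lt })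
    ((p ≟ₚ q) ×-dec (toℕ l <? α p))
  adj? (p , leaf l) (q , leaf l′) = no λ ()

  abstract
    dec : Fin (m * m * (2 + L)) → Vertex
    dec x = let (p , s) = remQuot {m * m} (2 + L) x in remQuot {m} m p , s

    enc : Vertex → Fin (m * m * (2 + L))
    enc (p , s) = combine (combine (proj₁ p) (proj₂ p)) s

    dec-enc : ∀ v → dec (enc v) ≡ v
    dec-enc ((i , j) , s) = trans
      (cong (λ q → remQuot {m} m (proj₁ q) , proj₂ q) (Finₚ.remQuot-combine {m * m} {2 + L} (combine i j) s))
      (cong (_, s) (Finₚ.remQuot-combine i j))

    enc-dec : ∀ x → enc (dec x) ≡ x
    enc-dec x = trans (cong (λ q → combine q (proj₂ (remQuot {m * m} (2 + L) x))) (Finₚ.combine-remQuot {m} m _))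
      (Finₚ.combine-remQuot {m * m} (2 + L) x)

    hasEdge : (x y : Fin (m * m * (2 + L))) → Bool
    hasEdge x y = ⌊ adj? (dec x) (dec y) ⌋

    hasEdge-sound : ∀ {x y} → hasEdge x y ≡ true → Adj (dec x) (dec y)
    hasEdge-sound {x} {y} = ⌊⌋-sound (adj? (dec x) (dec y))

    hasEdge-complete : ∀ {x y} → Adj (dec x) (dec y) → hasEdge x y ≡ true
    hasEdge-complete {x} {y} = ⌊⌋-complete (adj? (dec x) (dec y))

  dec-injective : ∀ {x y} → dec x ≡ dec y → x ≡ y
  dec-injective {x} {y} e = trans (sym (enc-dec x)) (trans (cong enc e) (enc-dec y))

  graph : Graph
  graph = record
    { n = m * m * (2 + L)
    ; adj = hasEdge
    ; adj-sym = λ x y → bool-ext (hasEdge-complete ∘ Adj-sym ∘ hasEdge-sound) (hasEdge-complete ∘ Adj-sym ∘ hasEdge-sound)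
    ; adj-irrefl = λ x → ¬true⇒false (Adj-irrefl ∘ hasEdge-sound) }

  enc-edge : ∀ {u v} → Adj u v → E graph (enc u) (enc v)
  enc-edge {u} {v} a = hasEdge-complete (subst₂ Adj (sym (dec-enc u)) (sym (dec-enc v)) a)

  row col : V graph → Fin m
  row x = proj₁ (proj₁ (dec x))
  col x = proj₂ (proj₁ (dec x))

  member : Fin m → Graph
  member i = induced graph (line row col i)

  -- A lower bound d on the degree, stated for decoded vertices and transported by injective
  -- homomorphisms.
  Family : Vertex → ℕ → Set
  Family v d = Σ (Fin d → Vertex) λ ν → (∀ j → Adj v (ν j)) × Injective _≡_ _≡_ ν

  family-bound : ∀ {v k d} (code : ∀ {y} → Adj v y → Fin k) →
    (∀ {y y′} (a : Adj v y) (a′ : Adj v y′) → code a ≡ code a′ → y ≡ y′) → Family v d → d ≤ k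
  family-bound code code-inj (ν , a , ν-inj) =
    Finₚ.injective⇒≤ {f = λ j → code (a j)} (λ {i} {j} e → ν-inj (code-inj (a i) (a j) e))

  leaf-degree : ∀ {p l d} → Family (p , leaf l) d → d ≤ 1
  leaf-degree = family-bound (λ _ → zero) only
    where
    only : ∀ {p l y y′} → Adj (p , leaf l) y → Adj (p , leaf l) y′ → _ → y ≡ y′
    only (leaf-hub _) (leaf-hub _) _ = refl
    only (leaf-hub le) (leaf-star lt) _ = contradiction le (ℕₚ.<⇒≱ lt)
    only (leaf-star lt) (leaf-hub le) _ = contradiction le (ℕₚ.<⇒≱ lt)
    only (leaf-star _) (leaf-star _) _ = refl

  star-degree : ∀ {p d} → Family (p , star) d → d ≤ suc (α p)
  star-degree {p} = family-bound code code-inj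
    where
    code : ∀ {y} → Adj (p , star) y → Fin (suc (α p))
    code star-hub = zero
    code (star-leaf lt) = suc (fromℕ< lt)
    code-inj : ∀ {y y′} (a : Adj (p , star) y) (a′ : Adj (p , star) y′) → code a ≡ code a′ → y ≡ y′
    code-inj star-hub star-hub _ = refl
    code-inj (star-leaf lt) (star-leaf lt′) e =
      cong (λ l → p , leaf l) (Finₚ.toℕ-injective (Finₚ.fromℕ<-injective _ _ lt lt′ (Finₚ.suc-injective e)))

  -- The leaves take the first `L ∸ α p` codes; the last five belong to the star centre and the four
  -- directions.
  hub-degree : ∀ {p d} → Family (p , hub) d → d ≤ L ∸ α p + 5
  hub-degree {p} = family-bound code code-inj
    where
    below : ∀ {l : Fin L} → α p ≤ toℕ l → toℕ l ∸ α p < L ∸ α p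
    below {l} le = ℕₚ.∸-monoˡ-< (Finₚ.toℕ<n l) le
    code : ∀ {y} → Adj (p , hub) y → Fin (L ∸ α p + 5)
    code hub-star = (L ∸ α p) ↑ʳ zero
    code (hub-leaf {l = l} le) = fromℕ< (below {l} le) ↑ˡ 5
    code (hub-hub {q = q} _) = (L ∸ α p) ↑ʳ suc (direction p q)
    apart : ∀ {k} (x : Fin k) y → x ↑ˡ 5 ≢ k ↑ʳ y
    apart {k} x y e with trans (sym (Finₚ.splitAt-↑ˡ k x 5)) (trans (cong (splitAt k) e) (Finₚ.splitAt-↑ʳ k 5 y))
    ... | ()
    code-inj : ∀ {y y′} (a : Adj (p , hub) y) (a′ : Adj (p , hub) y′) → code a ≡ code a′ → y ≡ y′
    code-inj hub-star hub-star _ = refl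
    code-inj hub-star (hub-leaf le) e = contradiction (sym e) (apart (fromℕ< (below le)) zero)
    code-inj hub-star (hub-hub _) e = contradiction (Finₚ.↑ʳ-injective (L ∸ α p) _ _ e) λ ()
    code-inj (hub-leaf le) hub-star e = contradiction e (apart (fromℕ< (below le)) zero)
    code-inj (hub-leaf le) (hub-leaf le′) e = cong (λ l → p , leaf l) (Finₚ.toℕ-injective (ℕₚ.∸-cancelʳ-≡ le le′
      (Finₚ.fromℕ<-injective _ _ (below le) (below le′) (Finₚ.↑ˡ-injective 5 _ _ e))))
    code-inj (hub-leaf le) (hub-hub {q = q} _) e = contradiction e (apart (fromℕ< (below le)) (suc (direction p q)))
    code-inj (hub-hub _) hub-star e = contradiction (Finₚ.↑ʳ-injective (L ∸ α p) _ _ e) λ ()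
    code-inj (hub-hub {q = q} _) (hub-leaf le) e = contradiction (sym e) (apart (fromℕ< (below le)) (suc (direction p q)))
    code-inj (hub-hub j) (hub-hub j′) e = cong (_, hub)
      (direction-injective _ _ _ j j′ (Finₚ.suc-injective (Finₚ.↑ʳ-injective (L ∸ α p) _ _ e)))

  family-degree : ∀ v {d} → Family v d → d ≤ Dₘ m
  family-degree (p , hub) F = ℕₚ.≤-trans (hub-degree F) (ℕₚ.≤-trans (ℕₚ.<⇒≤ (hub-leaves≤ p)) (K≤D m))
  family-degree (p , star) F = ℕₚ.≤-trans (star-degree F) (ℕₚ.≤-trans (α<L p) (ℕₚ.<⇒≤ (L<D m)))
  family-degree (p , leaf l) F = ℕₚ.≤-trans (leaf-degree F) (1≤D m)

  neighbours : ∀ x → Family (dec x) (deg graph x)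
  neighbours x = (λ j → dec (enum (adj graph x) j)) , (λ j → hasEdge-sound (enum-true (adj graph x) j)) ,
    λ e → enum-injective (adj graph x) (dec-injective e)

  -- Only neighbours inside the gadget are listed, so the family is carried along by any map defined
  -- on this gadget alone.
  star-family : ∀ p → Σ (Fin (suc (α p)) → Slot) λ ν → (∀ j → Adj (p , star) (p , ν j)) × Injective _≡_ _≡_ ν
  star-family p = ν , ν-adj , ν-inj
    where
    ν : Fin (suc (α p)) → Slot
    ν zero = hub
    ν (suc j) = leaf (inject≤ j (ℕₚ.<⇒≤ (α<L p)))
    ν-adj : ∀ j → Adj (p , star) (p , ν j)
    ν-adj zero = star-hub
    ν-adj (suc j) = star-leaf (subst (_< α p) (sym (Finₚ.toℕ-inject≤ j _)) (Finₚ.toℕ<n j))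
    ν-inj : Injective _≡_ _≡_ ν
    ν-inj {zero} {zero} _ = refl
    ν-inj {suc i} {suc j} e = cong suc (inject≤-injective′ (ℕₚ.<⇒≤ (α<L p)) (ℕₚ.<⇒≤ (α<L p)) (Finₚ.suc-injective (Finₚ.suc-injective e)))

  hub-family : ∀ p → Σ (Fin (suc (L ∸ α p)) → Slot) λ ν → (∀ j → Adj (p , hub) (p , ν j)) × Injective _≡_ _≡_ ν
  hub-family p = ν , ν-adj , ν-inj
    where
    lt : ∀ (j : Fin (L ∸ α p)) → α p + toℕ j < L
    lt j = ℕₚ.<-≤-trans (ℕₚ.+-monoʳ-< (α p) (Finₚ.toℕ<n j)) (ℕₚ.≤-reflexive (ℕₚ.m+[n∸m]≡n (ℕₚ.<⇒≤ (α<L p))))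
    ν : Fin (suc (L ∸ α p)) → Slot
    ν zero = star
    ν (suc j) = leaf (fromℕ< (lt j))
    ν-adj : ∀ j → Adj (p , hub) (p , ν j)
    ν-adj zero = hub-star
    ν-adj (suc j) = hub-leaf (subst (α p ≤_) (sym (Finₚ.toℕ-fromℕ< (lt j))) (ℕₚ.m≤m+n (α p) _))
    ν-inj : Injective _≡_ _≡_ ν
    ν-inj {zero} {zero} _ = refl
    ν-inj {suc i} {suc j} e = cong suc (Finₚ.toℕ-injective (ℕₚ.+-cancelˡ-≡ (α p) _ _
      (Finₚ.fromℕ<-injective _ _ (lt i) (lt j) (Finₚ.suc-injective (Finₚ.suc-injective e)))))

  push-family : ∀ {p x d} (h : Slot → Vertex) → Injective _≡_ _≡_ h → (∀ s s′ → Adj (p , s) (p , s′) → Adj (h s) (h s′)) →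
    (Σ (Fin d → Slot) λ ν → (∀ j → Adj (p , x) (p , ν j)) × Injective _≡_ _≡_ ν) → Family (h x) d
  push-family h h-inj h-adj (ν , a , ν-inj) = h ∘ ν , (λ j → h-adj _ _ (a j)) , λ e → ν-inj (h-inj e)

  -- The star has too many neighbours for a leaf or a hub, so it goes to a star centre; the hub has
  -- at least two, so it goes to the hub there. Star degrees now compare the indices in one
  -- direction and hub degrees in the other.
  rigid : ∀ p (h : Slot → Vertex) → Injective _≡_ _≡_ h → (∀ s s′ → Adj (p , s) (p , s′) → Adj (h s) (h s′)) →
    h star ≡ (p , star) × h hub ≡ (p , hub)
  rigid p h h-inj h-adj = go (h star) (h hub) refl refl (push-family h h-inj h-adj (star-family p))
      (push-family h h-inj h-adj (hub-family p)) (h-adj _ _ star-hub)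
    where
    tiny : ∀ {k} → 10 + k ≤ suc (α p) → suc (α p) ≤ 1 → ⊥
    tiny le (s≤s le′) = contradiction (ℕₚ.≤-trans le (s≤s le′)) λ { (s≤s ()) }
    go : ∀ u v → h star ≡ u → h hub ≡ v → Family u (suc (α p)) → Family v (suc (L ∸ α p)) → Adj u v →
      h star ≡ (p , star) × h hub ≡ (p , hub)
    go (q , leaf l) v eu ev Fu Fv a = ⊥-elim (tiny (ℕₚ.≤-trans (K-large m) (ℕₚ.≤-trans (α≥K p) (ℕₚ.n≤1+n _))) (leaf-degree Fu))
    go (q , hub) v eu ev Fu Fv a = contradiction (ℕₚ.≤-trans (α≥K p) (ℕₚ.n≤1+n _))
      (ℕₚ.<⇒≱ (ℕₚ.≤-<-trans (hub-degree Fu) (hub-leaves≤ q)))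
    go (q , star) (.q , leaf l) eu ev Fu Fv (star-leaf lt) =
      contradiction (leaf-degree Fv) (ℕₚ.<⇒≱ (s≤s (ℕₚ.m<n⇒0<n∸m (α<L p))))
    go (q , star) (.q , hub) eu ev Fu Fv star-hub
      with index-injective {p} {q} (ℕₚ.≤-antisym (α-reflects-≤ p q (ℕₚ.≤-pred (star-degree Fu))) (hub-reflects-≤ p q (hub-degree Fv)))
    ... | refl = eu , ev

deg-K₂ : ∀ v → deg K₂ v ≤ 1
deg-K₂ zero = ℕₚ.≤-refl
deg-K₂ (suc zero) = ℕₚ.≤-refl

deg-iso : ∀ {X Y} ((f , _) : Iso X Y) → ∀ v → deg X v ≤ deg Y (f v)
deg-iso {X} {Y} (f , g , gf , fg , ad) v = deg-injective-≤ X Y f (Iso-injective {X} {Y} (f , g , gf , fg , ad))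
  (λ a b e → trans (sym (ad a b)) e) v

deg-induced : ∀ X p v → deg (induced X p) v ≤ deg X (enum p v)
deg-induced X p = deg-injective-≤ (induced X p) X (enum p) (enum-injective p) (λ _ _ e → e)

-- The class of members and its global covers

module GadgetClass (Sk : ∀ m → Skeleton m) where
  module G m = Gadgets (Sk m)

  𝒢 : GraphClass
  𝒢 = record
    { mem = λ X → Iso K₂ X ⊎ Σ ℕ λ m → Σ (Fin m) λ i → Iso (G.member m i) X
    ; iso-closed = λ { {X} {Y} f (inj₁ g) → inj₁ (Iso-trans {K₂} {X} {Y} g f)
                     ; {X} {Y} f (inj₂ (m , i , g)) → inj₂ (m , i , Iso-trans {G.member m i} {X} {Y} g f) } }

  module _ {m : ℕ} {i : Fin m} where
    open Gadgets (Sk m)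

    place-on : ∀ p → OnLine i p → ∀ s → line row col i (enc (p , s)) ≡ true
    place-on p on s = on-line row col i _ (subst (λ v → OnLine i (proj₁ v)) (sym (dec-enc (p , s))) on)

    place : ∀ p → OnLine i p → Slot → V (member i)
    place p on s = rank (line row col i) (enc (p , s)) (place-on p on s)

    place-enum : ∀ p on s → enum (line row col i) (place p on s) ≡ enc (p , s)
    place-enum p on s = enum-rank (line row col i) (enc (p , s)) (place-on p on s)

    place-injective : ∀ p on {s s′} → place p on s ≡ place p on s′ → s ≡ s′
    place-injective p on {s} {s′} e = cong proj₂ (trans (sym (dec-enc (p , s)))
      (trans (cong dec (rank-injective (line row col i) (place-on p on s) (place-on p on s′) e)) (dec-enc (p , s′))))

    place-edge : ∀ {p q s s′} on on′ → Adj (p , s) (q , s′) → E (member i) (place p on s) (place q on′ s′)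
    place-edge {p} {q} {s} {s′} on on′ a = trans (cong₂ (adj graph) (place-enum p on s) (place-enum q on′ s′)) (enc-edge a)

    position : V (member i) → Vertex
    position y = dec (enum (line row col i) y)

    position-on : ∀ y → OnLine i (proj₁ (position y))
    position-on y = line-cases row col i _ (enum-true (line row col i) y)

    place-position : ∀ y v → position y ≡ v → (on : OnLine i (proj₁ v)) → place (proj₁ v) on (proj₂ v) ≡ y
    place-position y v e on = enum-injective (line row col i)
      (trans (place-enum (proj₁ v) on (proj₂ v)) (trans (cong enc (sym e)) (enc-dec _)))

  module _ {m m′ : ℕ} {i : Fin m′} (f : V (G.member m′ i) → V (G.graph m))
    (f-inj : Injective _≡_ _≡_ f) (f-hom : IsHom (G.member m′ i) (G.graph m) f) where

    slot-map : ∀ p → OnLine i p → G.Slot m′ → G.Vertex m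
    slot-map p on s = G.dec m (f (place p on s))

    slot-injective : ∀ p on → Injective _≡_ _≡_ (slot-map p on)
    slot-injective p on e = place-injective p on (f-inj (G.dec-injective m e))

    slot-adj : ∀ p on s s′ → G.Adj m′ (p , s) (p , s′) → G.Adj m (slot-map p on s) (slot-map p on s′)
    slot-adj p on s s′ a = G.hasEdge-sound m (f-hom _ _ (place-edge on on a))

    -- Already the star centre at (i , i) has more neighbours than any vertex of the smaller graph.
    not-larger : ¬ (m < m′)
    not-larger lt = ℕₚ.<⇒≱ (ℕₚ.<-≤-trans (D<K-mono lt) (ℕₚ.≤-trans (G.α≥K m′ (i , i)) (ℕₚ.n≤1+n _)))
      (G.family-degree m _ (star-image (G.star-family m′ (i , i))))
      where
      on : OnLine i (i , i)
      on = inj₁ refl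
      star-image : ∀ {d} → (Σ (Fin d → G.Slot m′) λ ν → (∀ j → G.Adj m′ ((i , i) , suc zero) ((i , i) , ν j)) × Injective _≡_ _≡_ ν) →
        G.Family m (slot-map (i , i) on (suc zero)) d
      star-image (ν , a , ν-inj) = (λ j → slot-map (i , i) on (ν j)) , (λ j → slot-adj (i , i) on _ _ (a j)) ,
        λ e → ν-inj (slot-injective (i , i) on e)

  module _ {m : ℕ} {i : Fin m} (f : V (G.member m i) → V (G.graph m))
    (f-inj : Injective _≡_ _≡_ f) (f-hom : IsHom (G.member m i) (G.graph m) f) where
    open Gadgets (Sk m)

    fixes : ∀ p (on : OnLine i p) → dec (f (place p on star)) ≡ (p , star) × dec (f (place p on hub)) ≡ (p , hub)
    fixes p on = rigid p (slot-map f f-inj f-hom p on) (slot-injective f f-inj f-hom p on) (slot-adj f f-inj f-hom p on)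

    -- By rigidity a hub goes to a hub and a star centre to the star centre of its own position;
    -- what remains is a leaf.
    star-preimage : ∀ p y → dec (f y) ≡ (p , star) → OnLine i p ⊎ deg (member i) y ≤ 1
    star-preimage p y e = go (position y) refl
      where
      go : ∀ v → position y ≡ v → OnLine i p ⊎ deg (member i) y ≤ 1
      go (q , s) ev with subst (λ v → OnLine i (proj₁ v)) ev (position-on y)
      go (q , hub) ev | on = contradiction
        (trans (sym (proj₂ (fixes q on))) (trans (cong (dec ∘ f) (place-position y (q , hub) ev on)) e)) λ ()
      go (q , star) ev | on = inj₁ (subst (OnLine i) (cong proj₁
        (trans (sym (proj₁ (fixes q on))) (trans (cong (dec ∘ f) (place-position y (q , star) ev on)) e))) on)
      go (q , leaf l) ev | on = inj₂ (ℕₚ.≤-trans (deg-induced graph (line row col i) y)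
        (leaf-degree (subst (λ v → Family v (deg graph (enum (line row col i) y))) ev (neighbours _))))

  module LowerBound (m₀ : ℕ) (C : InjCover (InBar 𝒢) (G.graph (suc m₀))) where
    m = suc m₀
    open Gadgets (Sk m)
    module B k = InBarData {𝒢} {comp C k} (inP C k)

    ψ : ∀ k j → V (B.Ys k j) → V graph
    ψ k j y = φ C k (B.to k (j , y))

    ψ-injective : ∀ k j → Injective _≡_ _≡_ (ψ k j)
    ψ-injective k j e with B.to-injective k (inj C k e)
    ... | refl = refl

    ψ-hom : ∀ k j → IsHom (B.Ys k j) graph (ψ k j)
    ψ-hom k j a b e = hom C k _ _ (B.to-hom k j a b e)

    module _ {m′} {i : Fin m′} k j (iso : Iso (G.member m′ i) (B.Ys k j)) where
      ψiso : V (G.member m′ i) → V graph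
      ψiso y = ψ k j (proj₁ iso y)

      ψiso-injective : Injective _≡_ _≡_ ψiso
      ψiso-injective e = Iso-injective {G.member m′ i} {B.Ys k j} iso (ψ-injective k j e)

      ψiso-hom : IsHom (G.member m′ i) graph ψiso
      ψiso-hom a b e = ψ-hom k j _ _ (trans (sym (proj₂ (proj₂ (proj₂ (proj₂ iso))) a b)) e)

    -- Besides an isomorphism the chosen membership witness of the summand is recorded, which makes
    -- i a function of j: bare isomorphisms would not tell the members apart.
    Contains : Fin (t C) → Fin m → Set
    Contains k i = Σ (Fin (proj₁ (inP C k))) λ j → Σ (Iso (member i) (B.Ys k j)) λ iso → B.Ys∈ k j ≡ inj₂ (m , i , iso)

    -- Two copies of members of size m share the star centre at their crossing.
    contains-unique : ∀ k i i′ → Contains k i → Contains k i′ → i ≡ i′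
    contains-unique k i i′ (j , iso , e) (j′ , iso′ , e′) = same-member j j′ iso iso′ e e′
        (cong proj₁ (B.to-injective k (inj C k (dec-injective (trans
          (proj₁ (fixes (ψiso k j iso) (ψiso-injective k j iso) (ψiso-hom k j iso) (i , i′) (inj₁ refl)))
          (sym (proj₁ (fixes (ψiso k j′ iso′) (ψiso-injective k j′ iso′) (ψiso-hom k j′ iso′) (i , i′) (inj₂ refl)))))))))
      where
      same-member : ∀ j j′ iso iso′ → B.Ys∈ k j ≡ inj₂ (m , i , iso) → B.Ys∈ k j′ ≡ inj₂ (m , i′ , iso′) → j ≡ j′ → i ≡ i′
      same-member j .j iso iso′ e e′ refl with trans (sym e) e′
      ... | refl = refl

    on-diagonal : ∀ {i i′ : Fin m} → OnLine i′ (i , i) → i ≡ i′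
    on-diagonal (inj₁ e) = e
    on-diagonal (inj₂ e) = e

    -- The position (i , i) lies on line i only, so of the members of size m only the i-th can place
    -- a star centre there. In all other cases y is a leaf or lies in `K₂` or a smaller member.
    classify : ∀ i k j y → dec (ψ k j y) ≡ ((i , i) , star) → (Y∈ : mem 𝒢 (B.Ys k j)) → B.Ys∈ k j ≡ Y∈ →
      Contains k i ⊎ deg (B.Ys k j) y ≤ Dₘ m₀
    classify i k j y e (inj₁ iso) _ = inj₂ (ℕₚ.≤-trans (deg-iso {B.Ys k j} {K₂} (Iso-sym {K₂} {B.Ys k j} iso) y)
      (ℕₚ.≤-trans (deg-K₂ (proj₁ (proj₂ iso) y)) (1≤D m₀)))
    classify i k j y e (inj₂ (m′ , i′ , iso)) eY with ℕₚ.<-cmp m′ m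
    ... | tri> _ _ m<m′ = contradiction m<m′ (not-larger (ψiso k j iso) (ψiso-injective k j iso) (ψiso-hom k j iso))
    ... | tri< m′<m _ _ = inj₂ (begin
        deg (B.Ys k j) y                       ≤⟨ deg-iso {B.Ys k j} {G.member m′ i′} (Iso-sym {G.member m′ i′} {B.Ys k j} iso) y ⟩
        deg (G.member m′ i′) y′                ≤⟨ deg-induced (G.graph m′) (line (G.row m′) (G.col m′) i′) y′ ⟩
        deg (G.graph m′) (enum (line (G.row m′) (G.col m′) i′) y′) ≤⟨ G.family-degree m′ _ (G.neighbours m′ _) ⟩
        Dₘ m′                                  ≤⟨ D-mono (ℕₚ.≤-pred m′<m) ⟩
        Dₘ m₀                                  ∎)
      where
      open ℕₚ.≤-Reasoning
      y′ = proj₁ (proj₂ iso) y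
    ... | tri≈ _ refl _ with star-preimage (ψiso k j iso) (ψiso-injective k j iso) (ψiso-hom k j iso) (i , i) (proj₁ (proj₂ iso) y)
                               (trans (cong (dec ∘ ψ k j) (proj₁ (proj₂ (proj₂ (proj₂ iso))) y)) e)
    ... | inj₂ le = inj₂ (ℕₚ.≤-trans (deg-iso {B.Ys k j} {member i′} (Iso-sym {member i′} {B.Ys k j} iso) y) (ℕₚ.≤-trans le (1≤D m₀)))
    ... | inj₁ on with on-diagonal on
    ... | refl = inj₁ (j , iso , eY)

    classify-vertex : ∀ i k a → dec (φ C k a) ≡ ((i , i) , star) → Contains k i ⊎ deg (comp C k) a ≤ Dₘ m₀
    classify-vertex i k a e = Data.Sum.map₂
      (λ le → ℕₚ.≤-trans (subst (λ b → deg (comp C k) b ≤ deg (B.Ys k j) y) (B.to-from k a) (B.deg-to k j y)) le)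
      (classify i k j y (trans (cong (dec ∘ φ C k) (B.to-from k a)) e) (B.Ys∈ k j) refl)
      where
      j = proj₁ (B.from k a)
      y = proj₂ (B.from k a)

    module _ (small : t C ≤ m) (i : Fin m) where
      ν = proj₁ (star-family (i , i))

      abstract
        lifted : ∀ x → ∃ λ k → ∃ λ a → ∃ λ b → E (comp C k) a b × φ C k a ≡ enc ((i , i) , star) × φ C k b ≡ enc ((i , i) , ν x)
        lifted x = edge-surj C _ _ (enc-edge (proj₁ (proj₂ (star-family (i , i))) x))

      piece : Fin (suc (α (i , i))) → Fin (t C)
      piece x = proj₁ (lifted x)

      centre : ∀ x → V (comp C (piece x))
      centre x = proj₁ (proj₂ (lifted x))

      centre-φ : ∀ x → dec (φ C (piece x) (centre x)) ≡ ((i , i) , star)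
      centre-φ x = trans (cong dec (proj₁ (proj₂ (proj₂ (proj₂ (proj₂ (lifted x))))))) (dec-enc ((i , i) , star))

      Bad : Fin (suc (α (i , i))) → Set
      Bad x = deg (comp C (piece x)) (centre x) ≤ Dₘ m₀

      -- By injectivity each graph of the cover has one vertex over the star centre. If all degrees
      -- there were at most `Dₘ m₀`, an edge would be determined by its graph and a rank below that
      -- bound, which are too few choices.
      not-all-bad : ¬ (∀ x → Bad x)
      not-all-bad bad = ℕₚ.<⇒≱ (ℕₚ.<-≤-trans (ℕₚ.≤-<-trans (ℕₚ.*-monoˡ-≤ (Dₘ m₀) small) (K-beats m₀))
          (ℕₚ.≤-trans (α≥K (i , i)) (ℕₚ.n≤1+n _))) (Finₚ.injective⇒≤ {f = code} code-inj)
        where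
        slot : ∀ k a b → E (comp C k) a b → deg (comp C k) a ≤ Dₘ m₀ → Fin (Dₘ m₀)
        slot k a b e le = inject≤ (rank (adj (comp C k) a) b e) le
        code : Fin (suc (α (i , i))) → Fin (t C * Dₘ m₀)
        code x = let (k , a , b , e , _) = lifted x in combine k (slot k a b e (bad x))
        slot-inj : ∀ k a b e le k′ a′ b′ e′ le′ → k ≡ k′ → φ C k a ≡ φ C k′ a′ → slot k a b e le ≡ slot k′ a′ b′ e′ le′ →
          φ C k b ≡ φ C k′ b′
        slot-inj k a b e le .k a′ b′ e′ le′ refl ea es with inj C k ea
        ... | refl = cong (φ C k) (rank-injective (adj (comp C k) a) e e′ (inject≤-injective′ le le′ es))
        code-inj : Injective _≡_ _≡_ code
        code-inj {x} {x′} e =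
          let (k , a , b , eab , ea , eb) = lifted x
              (k′ , a′ , b′ , eab′ , ea′ , eb′) = lifted x′
              (ek , es) = Finₚ.combine-injective k (slot k a b eab (bad x)) k′ (slot k′ a′ b′ eab′ (bad x′)) e
              same-end = slot-inj k a b eab (bad x) k′ a′ b′ eab′ (bad x′) ek (trans ea (sym ea′)) es
              same-vertex = trans (sym (dec-enc _)) (trans (cong dec (trans (sym eb) (trans same-end eb′))) (dec-enc _))
          in proj₂ (proj₂ (star-family (i , i))) (cong proj₂ same-vertex)

      contained : ∃ λ k → Contains k i
      contained = Data.Sum.[ proj₂ , (λ bad → contradiction bad not-all-bad) ] (∃⊎∀ {P = λ _ → ∃ λ k → Contains k i} {Q = Bad} cases)
        where
        cases : ∀ x → (∃ λ k → Contains k i) ⊎ Bad x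
        cases x = Data.Sum.map₁ (piece x ,_) (classify-vertex i (piece x) (centre x) (centre-φ x))

    size-bound : m ≤ t C
    size-bound with ℕₚ.≤-total m (t C)
    ... | inj₁ le = le
    ... | inj₂ small = Finₚ.injective⇒≤ {f = λ i → proj₁ (contained small i)}
      (λ {i} {i′} e → contains-unique _ i i′ (proj₂ (contained small i)) (subst (λ k → Contains k i′) (sym e) (proj₂ (contained small i′))))

  global-lower-bound : ∀ m k → HasGlobalCover 𝒢 (G.graph m) k → m ≤ k
  global-lower-bound zero k _ = z≤n
  global-lower-bound (suc m₀) _ (C , refl) = LowerBound.size-bound m₀ C

  local-cover : ∀ m → HasLocalCover 𝒢 (G.graph m) 2
  local-cover m = lines⇒local {𝒢} row col (λ i → inj₂ (m , i , Iso-refl {member i})) covered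
    where
    open Gadgets (Sk m)
    covers : ∀ {u v} → Adj u v → ∃ λ i → OnLine i (proj₁ u) × OnLine i (proj₁ v)
    covers hub-star = _ , inj₁ refl , inj₁ refl
    covers star-hub = _ , inj₁ refl , inj₁ refl
    covers (hub-leaf _) = _ , inj₁ refl , inj₁ refl
    covers (leaf-hub _) = _ , inj₁ refl , inj₁ refl
    covers (star-leaf _) = _ , inj₁ refl , inj₁ refl
    covers (leaf-star _) = _ , inj₁ refl , inj₁ refl
    covers (hub-hub j) = joined-line _ _ j
    covered : ∀ x y → E graph x y → ∃ λ i → line row col i x ≡ true × line row col i y ≡ true
    covered x y e = let (i , ou , ov) = covers (hasEdge-sound e) in i , on-line row col i x ou , on-line row col i y ov

  gadgets-unbounded : ∀ {ℋ} → (∀ m → mem ℋ (G.graph (suc m))) → ¬ Bounded 𝒢 ℋ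
  gadgets-unbounded {ℋ} in-ℋ = unbounded {𝒢} {ℋ} λ m → G.graph (suc m) , in-ℋ m , local-cover (suc m) ,
    λ k C → ℕₚ.<⇒≤ (global-lower-bound (suc m) k C)

-- Forests have treewidth one

TreeDecomp-iso : ∀ {X Y w} → Iso X Y → TreeDecomp X w → TreeDecomp Y w
TreeDecomp-iso {X} {Y} (f , g , gf , fg , ad) D = record
  { T = T ; isTree = isTree
  ; bag = λ τ y → bag τ (g y)
  ; vcover = λ y → vcover (g y)
  ; ecover = λ x y e → ecover (g x) (g y) (trans (ad (g x) (g y)) (trans (cong₂ (adj Y) (fg x) (fg y)) e))
  ; subtree = λ y → subtree (g y)
  ; width = λ τ → ℕₚ.≤-trans (count-injection (λ y → bag τ (g y)) (bag τ) g (λ _ e → e)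
      (λ x y _ _ e → trans (sym (fg x)) (trans (cong f e) (fg y)))) (width τ) }
  where open TreeDecomp D

cycle-neighbours : ∀ T ((k , c , _) : HasCycle T) → ∀ i → ∃ λ a → ∃ λ b → a ≢ b × E T (c i) (c a) × E T (c i) (c b)
cycle-neighbours T (k , c , _ , nxt , last) i with view i
... | ‵fromℕ = zero , inject₁ (fromℕ (suc k)) , (λ ()) , last , E-sym T (nxt (fromℕ (suc k)))
... | ‵inject₁ zero = suc zero , fromℕ (suc (suc k)) , (λ ()) , nxt zero , E-sym T last
... | ‵inject₁ (suc j) = suc (suc j) , inject₁ (inject₁ j) , apart , nxt (suc j) , E-sym T (nxt (inject₁ j))
  where
  apart : suc (suc j) ≢ inject₁ (inject₁ j)
  apart e = ℕₚ.1+n≰n (ℕₚ.≤-trans (ℕₚ.n≤1+n _) (ℕₚ.≤-reflexive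
    (trans (cong toℕ e) (trans (Finₚ.toℕ-inject₁ (inject₁ j)) (Finₚ.toℕ-inject₁ j)))))

-- `tree` has all parent links, also those that are not edges of H, and is thus connected even when
-- H is not. Each bag is a vertex with its parent.
module Forest (H : Graph) (root : V H) (par : V H → V H) (depth : V H → ℕ) (par-root : par root ≡ root)
  (rises : ∀ v → v ≡ root ⊎ depth (par v) < depth v) (edges : ∀ x y → E H x y → par x ≡ y ⊎ par y ≡ x) where

  Link : V H → V H → Set
  Link x y = x ≢ y × (par x ≡ y ⊎ par y ≡ x)

  Link-sym : ∀ {x y} → Link x y → Link y x
  Link-sym (ne , l) = (λ e → ne (sym e)) , Data.Sum.swap l

  link? : ∀ x y → Dec (Link x y)
  link? x y = ¬? (x ≟ y) ×-dec ((par x ≟ y) ⊎-dec (par y ≟ x))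

  tree : Graph
  tree = record
    { n = n H
    ; adj = λ x y → ⌊ link? x y ⌋
    ; adj-sym = λ x y → bool-ext (⌊⌋-complete (link? y x) ∘ Link-sym ∘ ⌊⌋-sound (link? x y))
        (⌊⌋-complete (link? x y) ∘ Link-sym ∘ ⌊⌋-sound (link? y x))
    ; adj-irrefl = λ x → ¬true⇒false (λ e → proj₁ (⌊⌋-sound (link? x x) e) refl) }

  to-parent : ∀ {P : V H → Set} x y → P x → P y → par x ≡ y → ReachIn tree P x y
  to-parent x y Px Py e with x ≟ y
  ... | yes refl = here Px
  ... | no ne = step Px (⌊⌋-complete (link? x y) (ne , inj₁ e)) (here Py)

  to-root : ∀ fuel x → depth x ≤ fuel → ReachIn tree (λ _ → ⊤) x root
  to-root fuel x le with rises x
  ... | inj₁ refl = here tt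
  to-root zero x le | inj₂ lt = contradiction (ℕₚ.<-≤-trans lt le) λ ()
  to-root (suc fuel) x le | inj₂ lt =
    reach-trans (to-parent x (par x) tt tt refl) (to-root fuel (par x) (ℕₚ.≤-pred (ℕₚ.≤-trans lt le)))

  connected : Connected tree
  connected x y = reach-trans (to-root _ x ℕₚ.≤-refl) (reach-sym (to-root _ y ℕₚ.≤-refl))

  -- Both cycle neighbours of a deepest vertex of a cycle would be its parent.
  acyclic : ¬ HasCycle tree
  acyclic cyc@(k , c , c-inj , _)
    with extremum _≤_ (λ _ → ℕₚ.≤-refl) ℕₚ.≤-trans ℕₚ.≤-total (depth ∘ c) {λ _ → ⊤} (λ _ → yes tt) (zero , tt)
  ... | i , _ , deepest with cycle-neighbours tree cyc i
  ... | a , b , a≢b , ea , eb = a≢b (c-inj (trans (sym (parent a ea)) (parent b eb)))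
    where
    parent : ∀ a → E tree (c i) (c a) → par (c i) ≡ c a
    parent a e with ⌊⌋-sound (link? (c i) (c a)) e
    ... | _ , inj₁ q = q
    ... | ne , inj₂ q with rises (c a)
    ... | inj₂ lt = contradiction (deepest a tt) (ℕₚ.<⇒≱ (subst (λ z → depth z < depth (c a)) q lt))
    ... | inj₁ r = contradiction (trans (sym q) (trans (cong par r) (trans par-root (sym r)))) ne

  bag : V H → V H → Bool
  bag τ x = ⌊ x ≟ τ ⌋ ∨ ⌊ x ≟ par τ ⌋

  bag-cases : ∀ τ x → bag τ x ≡ true → x ≡ τ ⊎ x ≡ par τ
  bag-cases τ x e = Data.Sum.map (⌊⌋-sound (x ≟ τ)) (⌊⌋-sound (x ≟ par τ)) (∨-true e)

  bag-self : ∀ x → bag x x ≡ true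
  bag-self x = cong (_∨ ⌊ x ≟ par x ⌋) (⌊⌋-complete (x ≟ x) refl)

  bag-parent : ∀ τ x → par τ ≡ x → bag τ x ≡ true
  bag-parent τ x e = ∨-trueʳ ⌊ x ≟ τ ⌋ (⌊⌋-complete (x ≟ par τ) (sym e))

  bag-size : ∀ τ → countFin (bag τ) ≤ 2
  bag-size τ = count-injection (bag τ) (λ (_ : Fin 2) → true) side (λ _ _ → refl) side-inj
    where
    side : V H → Fin 2
    side x = if ⌊ x ≟ τ ⌋ then zero else suc zero
    side-inj : ∀ x y → bag τ x ≡ true → bag τ y ≡ true → side x ≡ side y → x ≡ y
    side-inj x y bx by e with x ≟ τ | y ≟ τ
    ... | yes p | yes q = trans p (sym q)
    ... | no _ | no _ = trans (⌊⌋-sound (x ≟ par τ) bx) (sym (⌊⌋-sound (y ≟ par τ) by))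

  bag-reach : ∀ x τ → bag τ x ≡ true → ReachIn tree (λ σ → bag σ x ≡ true) τ x
  bag-reach x τ b with bag-cases τ x b
  ... | inj₁ refl = here b
  ... | inj₂ e = to-parent τ x b (bag-self x) (sym e)

  decomposition : TreeDecomp H 1
  decomposition = record
    { T = tree
    ; isTree = Fin-positive root , connected , acyclic
    ; bag = bag
    ; vcover = λ x → x , bag-self x
    ; ecover = λ x y e → Data.Sum.[_,_]′ (λ q → x , bag-self x , bag-parent x y q) (λ q → y , bag-parent y x q , bag-self y) (edges x y e)
    ; subtree = λ x τ₁ τ₂ b₁ b₂ → reach-trans (bag-reach x τ₁ b₁) (reach-sym (bag-reach x τ₂ b₂))
    ; width = bag-size }

disconnected : ∀ m → Skeleton m
disconnected m = record
  { joined = λ _ _ → false ; joined-sym = λ _ _ () ; joined-irrefl = λ _ () ; direction = λ _ _ → zero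
  ; direction-injective = λ _ _ _ () ; joined-line = λ _ _ () }

module GadgetForest (m : ℕ) where
  open Gadgets (disconnected (suc m))

  p₀ : Pos (suc m)
  p₀ = zero , zero

  -- All hubs hang on the hub at `p₀`, although no two hubs are adjacent here; this ties the gadgets
  -- into one tree.
  parent : Vertex → Vertex
  parent (p , hub) = p₀ , hub
  parent (p , star) = p , hub
  parent (p , leaf l) = p , (if ⌊ toℕ l <? α p ⌋ then star else hub)

  hub-depth : Pos (suc m) → ℕ
  hub-depth p = if ⌊ p ≟ₚ p₀ ⌋ then 0 else 1

  depth : Vertex → ℕ
  depth (p , hub) = hub-depth p
  depth (p , star) = 2
  depth (p , leaf l) = 3

  hub-depth≤1 : ∀ p → hub-depth p ≤ 1
  hub-depth≤1 p with p ≟ₚ p₀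
  ... | yes _ = z≤n
  ... | no _ = s≤s z≤n

  rises : ∀ v → v ≡ (p₀ , hub) ⊎ depth (parent v) < depth v
  rises (p , hub) with p ≟ₚ p₀
  ... | yes refl = inj₁ refl
  ... | no _ = inj₂ (s≤s z≤n)
  rises (p , star) = inj₂ (s≤s (hub-depth≤1 p))
  rises (p , leaf l) with toℕ l <? α p
  ... | yes _ = inj₂ ℕₚ.≤-refl
  ... | no _ = inj₂ (s≤s (ℕₚ.≤-trans (hub-depth≤1 p) (s≤s z≤n)))

  leaf-parent-star : ∀ p l → toℕ l < α p → parent (p , leaf l) ≡ (p , star)
  leaf-parent-star p l lt with toℕ l <? α p
  ... | yes _ = refl
  ... | no ¬lt = contradiction lt ¬lt

  leaf-parent-hub : ∀ p l → α p ≤ toℕ l → parent (p , leaf l) ≡ (p , hub)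
  leaf-parent-hub p l le with toℕ l <? α p
  ... | yes lt = contradiction le (ℕₚ.<⇒≱ lt)
  ... | no _ = refl

  parents : ∀ {u v} → Adj u v → parent u ≡ v ⊎ parent v ≡ u
  parents hub-star = inj₂ refl
  parents star-hub = inj₁ refl
  parents (hub-leaf le) = inj₂ (leaf-parent-hub _ _ le)
  parents (leaf-hub le) = inj₁ (leaf-parent-hub _ _ le)
  parents (star-leaf lt) = inj₂ (leaf-parent-star _ _ lt)
  parents (leaf-star lt) = inj₁ (leaf-parent-star _ _ lt)

  enc-parent : ∀ {x y} → parent (dec x) ≡ dec y → enc (parent (dec x)) ≡ y
  enc-parent {x} {y} e = trans (cong enc e) (enc-dec y)

  decomposition : TreeDecomp graph 1
  decomposition = Forest.decomposition graph (enc (p₀ , hub)) (enc ∘ parent ∘ dec) (depth ∘ dec)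
    (cong (enc ∘ parent) (dec-enc (p₀ , hub)))
    (λ x → Data.Sum.map (λ e → trans (sym (enc-dec x)) (cong enc e))
      (subst (_< depth (dec x)) (sym (cong depth (dec-enc (parent (dec x)))))) (rises (dec x)))
    (λ x y e → Data.Sum.map enc-parent enc-parent (parents (hasEdge-sound e)))

treewidth-one : GraphClass
treewidth-one = record { mem = λ X → TreeDecomp X 1 ; iso-closed = λ {X} {Y} → TreeDecomp-iso {X} {Y} }

forests-unbounded : ¬ Bounded (GadgetClass.𝒢 disconnected) treewidth-one
forests-unbounded = GadgetClass.gadgets-unbounded disconnected {treewidth-one} GadgetForest.decomposition

-- The square grid has no K₅ minor

all-Bool : ∀ k → (Vec Bool k → Bool) → Bool
all-Bool zero f = f []
all-Bool (suc k) f = all-Bool k (λ v → f (true ∷ v)) ∧ all-Bool k (λ v → f (false ∷ v))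

-- The parity identities below are verified on all valuations by evaluation, then instantiated.
tautology : ∀ k f → all-Bool k f ≡ true → ∀ v → f v ≡ true
tautology zero f e [] = e
tautology (suc k) f e (true ∷ v) = tautology k _ (proj₁ (∧-true e)) v
tautology (suc k) f e (false ∷ v) = tautology k _ (proj₂ (∧-true {all-Bool k (λ v → f (true ∷ v))} e)) v

_==_ : Bool → Bool → Bool
a == b = not (a xor b)

==-sound : ∀ {a b} → (a == b) ≡ true → a ≡ b
==-sound {true} {true} _ = refl
==-sound {false} {false} _ = refl

Pt : Set
Pt = ℕ × ℕ

data Step : Pt → Pt → Set where
  east : ∀ {x y} → Step (x , y) (suc x , y)
  west : ∀ {x y} → Step (suc x , y) (x , y)
  north : ∀ {x y} → Step (x , y) (x , suc y)
  south : ∀ {x y} → Step (x , suc y) (x , y)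

Step-sym : ∀ {a b} → Step a b → Step b a
Step-sym east = west
Step-sym west = east
Step-sym north = south
Step-sym south = north

open Walks {Pt} (≡-dec ℕₚ._≟_ ℕₚ._≟_) Step

walk-map : ∀ {P Q : Pt → Set} {u v} → (∀ {z} → P z → Q z) → Walk P u v → Walk Q u v
walk-map f (nil p) = nil (f p)
walk-map f (cons p s w) = cons (f p) s (walk-map f w)

walk-++ : ∀ {P u v w} → Walk P u v → Walk P v w → Walk P u w
walk-++ (nil _) q = q
walk-++ (cons p s r) q = cons p s (walk-++ r q)

walk-end : ∀ {P u v} → Walk P u v → P v
walk-end (nil p) = p
walk-end (cons _ _ w) = walk-end w

walk-start : ∀ {P u v} → Walk P u v → P u
walk-start (nil p) = p
walk-start (cons p _ _) = p

-- (x , y) also names the unit square whose upper right corner is the point (x , y). The winding parity of a walk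
-- around a square counts the vertical steps met by the ray going left from the square.

isPoint : Pt → Pt → Bool
isPoint (x , y) (X , Y) = (y ≡ᵇ Y) ∧ (x ≡ᵇ X)

ray : Pt → Pt → Bool
ray (x , y) (X , Y) = (y ≡ᵇ Y) ∧ (x <ᵇ X)

-- The edges going south and west from the point q separate the square q from its right and its
-- upper neighbour; `southUse` and `westUse` ask whether the step runs along them.
winding southUse westUse : ∀ {a b} → Step a b → Pt → Bool
winding east q = false
winding west q = false
winding (north {x} {y}) q = ray (x , suc y) q
winding (south {x} {y}) q = ray (x , suc y) q
southUse east q = false
southUse west q = false
southUse (north {x} {y}) q = isPoint (x , suc y) q
southUse (south {x} {y}) q = isPoint (x , suc y) q
westUse (east {x} {y}) q = isPoint (suc x , y) q
westUse (west {x} {y}) q = isPoint (suc x , y) q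
westUse north q = false
westUse south q = false

<ᵇ-suc : ∀ x X → (x <ᵇ suc X) ≡ (x <ᵇ X) xor (x ≡ᵇ X)
<ᵇ-suc zero zero = refl
<ᵇ-suc zero (suc X) = refl
<ᵇ-suc (suc x) zero = refl
<ᵇ-suc (suc x) (suc X) = <ᵇ-suc x X

suc-<ᵇ : ∀ x X → (x <ᵇ X) ≡ (suc x <ᵇ X) xor (suc x ≡ᵇ X)
suc-<ᵇ x zero = refl
suc-<ᵇ zero (suc zero) = refl
suc-<ᵇ zero (suc (suc X)) = refl
suc-<ᵇ (suc x) (suc X) = suc-<ᵇ x X

ray-right : ∀ p X Y → ray p (suc X , Y) ≡ ray p (X , Y) xor isPoint p (X , Y)
ray-right (x , y) X Y = trans (cong ((y ≡ᵇ Y) ∧_) (<ᵇ-suc x X)) (Boolₚ.∧-distribˡ-xor (y ≡ᵇ Y) _ _)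

ray-left : ∀ x y q → ray (x , y) q ≡ ray (suc x , y) q xor isPoint (suc x , y) q
ray-left x y (X , Y) = trans (cong ((y ≡ᵇ Y) ∧_) (suc-<ᵇ x X)) (Boolₚ.∧-distribˡ-xor (y ≡ᵇ Y) _ _)

winding-right : ∀ {a b} (s : Step a b) X Y → winding s (suc X , Y) ≡ winding s (X , Y) xor southUse s (X , Y)
winding-right east X Y = refl
winding-right west X Y = refl
winding-right (north {x} {y}) X Y = ray-right (x , suc y) X Y
winding-right (south {x} {y}) X Y = ray-right (x , suc y) X Y

-- Raising the square also shifts the ray to the next row. The resulting terms at the two ends
-- telescope along a walk and cancel around a closed one.
winding-up : ∀ {a b} (s : Step a b) X Y →
  winding s (X , suc Y) ≡ winding s (X , Y) xor (westUse s (X , Y) xor (ray a (X , Y) xor ray b (X , Y)))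
winding-up (east {x} {y}) X Y = ==-sound (trans
  (cong (λ r → false == (isPoint (suc x , y) (X , Y) xor (r xor ray (suc x , y) (X , Y)))) (ray-left x y (X , Y)))
  (tautology 2 (λ { (r ∷ i ∷ []) → false == (i xor ((r xor i) xor r)) }) refl (ray (suc x , y) (X , Y) ∷ isPoint (suc x , y) (X , Y) ∷ [])))
winding-up (west {x} {y}) X Y = ==-sound (trans
  (cong (λ r → false == (isPoint (suc x , y) (X , Y) xor (ray (suc x , y) (X , Y) xor r))) (ray-left x y (X , Y)))
  (tautology 2 (λ { (r ∷ i ∷ []) → false == (i xor (r xor (r xor i))) }) refl (ray (suc x , y) (X , Y) ∷ isPoint (suc x , y) (X , Y) ∷ [])))
winding-up (north {x} {y}) X Y = ==-sound
  (tautology 2 (λ { (r ∷ r′ ∷ []) → r == (r′ xor (r xor r′)) }) refl (ray (x , y) (X , Y) ∷ ray (x , suc y) (X , Y) ∷ []))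
winding-up (south {x} {y}) X Y = ==-sound
  (tautology 2 (λ { (r ∷ r′ ∷ []) → r == (r′ xor (r′ xor r)) }) refl (ray (x , y) (X , Y) ∷ ray (x , suc y) (X , Y) ∷ []))

windingʷ southUseʷ westUseʷ : ∀ {P a b} → Walk P a b → Pt → Bool
windingʷ (nil _) q = false
windingʷ (cons _ s w) q = winding s q xor windingʷ w q
southUseʷ (nil _) q = false
southUseʷ (cons _ s w) q = southUse s q xor southUseʷ w q
westUseʷ (nil _) q = false
westUseʷ (cons _ s w) q = westUse s q xor westUseʷ w q

windingʷ-right : ∀ {P a b} (w : Walk P a b) X Y → windingʷ w (suc X , Y) ≡ windingʷ w (X , Y) xor southUseʷ w (X , Y)
windingʷ-right (nil _) X Y = refl
windingʷ-right (cons _ s w) X Y = trans (cong₂ _xor_ (winding-right s X Y) (windingʷ-right w X Y)) (==-sound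
  (tautology 4 (λ { (a ∷ b ∷ c ∷ d ∷ []) → ((a xor b) xor (c xor d)) == ((a xor c) xor (b xor d)) }) refl
    (winding s (X , Y) ∷ southUse s (X , Y) ∷ windingʷ w (X , Y) ∷ southUseʷ w (X , Y) ∷ [])))

windingʷ-up : ∀ {P a b} (w : Walk P a b) X Y →
  windingʷ w (X , suc Y) ≡ windingʷ w (X , Y) xor (westUseʷ w (X , Y) xor (ray a (X , Y) xor ray b (X , Y)))
windingʷ-up {a = a} (nil _) X Y = ==-sound
  (tautology 1 (λ { (r ∷ []) → false == (false xor (false xor (r xor r))) }) refl (ray a (X , Y) ∷ []))
windingʷ-up (cons {a} {c} {b} _ s w) X Y = trans (cong₂ _xor_ (winding-up s X Y) (windingʷ-up w X Y)) (==-sound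
  (tautology 7 (λ { (p ∷ q ∷ r ∷ t ∷ A ∷ B ∷ C ∷ []) →
      ((p xor (q xor (A xor C))) xor (r xor (t xor (C xor B)))) == ((p xor r) xor ((q xor t) xor (A xor B))) }) refl
    (winding s (X , Y) ∷ westUse s (X , Y) ∷ windingʷ w (X , Y) ∷ westUseʷ w (X , Y) ∷ ray a (X , Y) ∷ ray b (X , Y) ∷ ray c (X , Y) ∷ [])))

isPoint-false : ∀ p q → p ≢ q → isPoint p q ≡ false
isPoint-false (x , y) (X , Y) ne = ¬true⇒false λ e → let (ey , ex) = ∧-true {y ≡ᵇ Y} e in
  ne (cong₂ _,_ (ℕₚ.≡ᵇ⇒≡ x X (subst Data.Bool.T (sym ex) tt)) (ℕₚ.≡ᵇ⇒≡ y Y (subst Data.Bool.T (sym ey) tt)))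

isPoint-true : ∀ p → isPoint p p ≡ true
isPoint-true (x , y) = cong₂ _∧_ (≡ᵇ-refl y) (≡ᵇ-refl x)
  where
  ≡ᵇ-refl : ∀ k → (k ≡ᵇ k) ≡ true
  ≡ᵇ-refl zero = refl
  ≡ᵇ-refl (suc k) = ≡ᵇ-refl k

unused : ∀ {a b} (s : Step a b) q → a ≢ q → b ≢ q → southUse s q ≡ false × westUse s q ≡ false
unused east q na nb = refl , isPoint-false _ q nb
unused west q na nb = refl , isPoint-false _ q na
unused north q na nb = isPoint-false _ q nb , refl
unused south q na nb = isPoint-false _ q na , refl

unusedʷ : ∀ {P a b} (w : Walk P a b) q → ¬ P q → southUseʷ w q ≡ false × westUseʷ w q ≡ false
unusedʷ (nil _) q ¬Pq = refl , refl
unusedʷ (cons Pa s w) q ¬Pq =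
  let (e₁ , e₂) = unused s q (λ { refl → ¬Pq Pa }) (λ { refl → ¬Pq (walk-start w) })
      (f₁ , f₂) = unusedʷ w q ¬Pq
  in cong₂ _xor_ e₁ f₁ , cong₂ _xor_ e₂ f₂

-- All that is kept of a closed walk: a parity on squares that changes precisely across the used
-- edges, and a set of points containing every used edge's ends.
record Loop : Set₁ where
  field
    On : Pt → Set
    W S-use W-use : Pt → Bool
    right : ∀ X Y → W (suc X , Y) ≡ W (X , Y) xor S-use (X , Y)
    up : ∀ X Y → W (X , suc Y) ≡ W (X , Y) xor W-use (X , Y)
    off : ∀ q → ¬ On q → S-use q ≡ false × W-use q ≡ false
open Loop

triangle : ∀ {P Q R a b c} → Walk P a b → Walk Q b c → Walk R a c → Loop
triangle {P} {Q} {R} {a} {b} {c} p q r = record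
  { On = λ z → P z ⊎ (Q z ⊎ R z)
  ; W = λ z → windingʷ p z xor (windingʷ q z xor windingʷ r z)
  ; S-use = λ z → southUseʷ p z xor (southUseʷ q z xor southUseʷ r z)
  ; W-use = λ z → westUseʷ p z xor (westUseʷ q z xor westUseʷ r z)
  ; right = λ X Y → trans (cong₂ _xor_ (windingʷ-right p X Y) (cong₂ _xor_ (windingʷ-right q X Y) (windingʷ-right r X Y))) (==-sound
      (tautology 6 (λ { (p ∷ q ∷ r ∷ i ∷ j ∷ k ∷ []) →
          ((p xor i) xor ((q xor j) xor (r xor k))) == ((p xor (q xor r)) xor (i xor (j xor k))) }) refl
        (windingʷ p (X , Y) ∷ windingʷ q (X , Y) ∷ windingʷ r (X , Y) ∷
         southUseʷ p (X , Y) ∷ southUseʷ q (X , Y) ∷ southUseʷ r (X , Y) ∷ [])))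
  ; up = λ X Y → trans (cong₂ _xor_ (windingʷ-up p X Y) (cong₂ _xor_ (windingʷ-up q X Y) (windingʷ-up r X Y))) (==-sound
      (tautology 9 (λ { (p ∷ q ∷ r ∷ i ∷ j ∷ k ∷ A ∷ B ∷ C ∷ []) →
          ((p xor (i xor (A xor B))) xor ((q xor (j xor (B xor C))) xor (r xor (k xor (A xor C)))))
            == ((p xor (q xor r)) xor (i xor (j xor k))) }) refl
        (windingʷ p (X , Y) ∷ windingʷ q (X , Y) ∷ windingʷ r (X , Y) ∷
         westUseʷ p (X , Y) ∷ westUseʷ q (X , Y) ∷ westUseʷ r (X , Y) ∷ ray a (X , Y) ∷ ray b (X , Y) ∷ ray c (X , Y) ∷ [])))
  ; off = λ z ¬on → let (p₁ , p₂) = unusedʷ p z (¬on ∘ inj₁)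
                        (q₁ , q₂) = unusedʷ q z (¬on ∘ inj₂ ∘ inj₁)
                        (r₁ , r₂) = unusedʷ r z (¬on ∘ inj₂ ∘ inj₂)
      in cong₂ _xor_ p₁ (cong₂ _xor_ q₁ r₁) , cong₂ _xor_ p₂ (cong₂ _xor_ q₂ r₂) }

isEast isNorth isWest isSouth : ∀ {a b} → Step a b → Bool
isEast east = true
isEast _ = false
isNorth north = true
isNorth _ = false
isWest west = true
isWest _ = false
isSouth south = true
isSouth _ = false

-- East and north steps cross the south or west edge of their start. West and south steps cross an
-- edge at their end, which is off the loop.
step-winding : ∀ (ℓ : Loop) {a b} (s : Step a b) → ¬ On ℓ b →
  W ℓ b ≡ W ℓ a xor ((isEast s ∧ S-use ℓ a) xor (isNorth s ∧ W-use ℓ a))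
step-winding ℓ (east {x} {y}) _ = trans (right ℓ x y) (cong (W ℓ (x , y) xor_) (sym (Boolₚ.xor-identityʳ _)))
step-winding ℓ (north {x} {y}) _ = up ℓ x y
step-winding ℓ (west {x} {y}) ¬on = ==-sound (trans
  (cong (λ r → W ℓ (x , y) == (r xor false)) (trans (right ℓ x y) (cong (W ℓ (x , y) xor_) (proj₁ (off ℓ _ ¬on)))))
  (tautology 1 (λ { (a ∷ []) → a == ((a xor false) xor false) }) refl (W ℓ (x , y) ∷ [])))
step-winding ℓ (south {x} {y}) ¬on = ==-sound (trans
  (cong (λ r → W ℓ (x , y) == (r xor false)) (trans (up ℓ x y) (cong (W ℓ (x , y) xor_) (proj₂ (off ℓ _ ¬on)))))
  (tautology 1 (λ { (a ∷ []) → a == ((a xor false) xor false) }) refl (W ℓ (x , y) ∷ [])))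

winding-constant : ∀ (ℓ : Loop) {P a b} → (∀ {z} → P z → ¬ On ℓ z) → Walk P a b → W ℓ a ≡ W ℓ b
winding-constant ℓ avoid (nil _) = refl
winding-constant ℓ avoid (cons {a} {c} Pa s w) = trans (sym (trans (step-winding ℓ s (avoid (walk-start w)))
    (trans (cong₂ (λ i j → W ℓ a xor ((isEast s ∧ i) xor (isNorth s ∧ j))) (proj₁ (off ℓ a (avoid Pa))) (proj₂ (off ℓ a (avoid Pa))))
      (==-sound (tautology 3 (λ { (x ∷ y ∷ z ∷ []) → (x xor ((y ∧ false) xor (z ∧ false))) == x }) refl
        (W ℓ a ∷ isEast s ∷ isNorth s ∷ []))))))
  (winding-constant ℓ avoid w)

use-map : ∀ {P Q : Pt → Set} {a b} (f : ∀ {z} → P z → Q z) (w : Walk P a b) q →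
  southUseʷ (walk-map f w) q ≡ southUseʷ w q × westUseʷ (walk-map f w) q ≡ westUseʷ w q
use-map f (nil _) q = refl , refl
use-map f (cons _ s w) q = cong (southUse s q xor_) (proj₁ (use-map f w q)) , cong (westUse s q xor_) (proj₂ (use-map f w q))

-- The rest of the walk avoids `a`, so only the first step can run along an edge at `a`.
first-use : ∀ {P Q : Pt → Set} {a b c} (f : ∀ {z} → Q z → P z) (Pa : P a) (s : Step a c) (w : Walk Q c b) → ¬ Q a →
  southUseʷ (cons Pa s (walk-map f w)) a ≡ isSouth s × westUseʷ (cons Pa s (walk-map f w)) a ≡ isWest s
first-use {a = a} f Pa s w ¬Qa =
  trans (cong₂ _xor_ (proj₁ (own s)) (trans (proj₁ (use-map f w a)) (proj₁ (unusedʷ w a ¬Qa)))) (Boolₚ.xor-identityʳ _) ,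
  trans (cong₂ _xor_ (proj₂ (own s)) (trans (proj₂ (use-map f w a)) (proj₂ (unusedʷ w a ¬Qa)))) (Boolₚ.xor-identityʳ _)
  where
  own : ∀ {a b} (s : Step a b) → southUse s a ≡ isSouth s × westUse s a ≡ isWest s
  own (east {x} {y}) = refl , isPoint-false (suc x , y) (x , y) (λ ())
  own (west {x} {y}) = refl , isPoint-true (suc x , y)
  own (north {x} {y}) = isPoint-false (x , suc y) (x , y) (λ ()) , refl
  own (south {x} {y}) = isPoint-true (x , suc y) , refl

-- Exactly one of the pairs (east, south) and (north, west) is used by three distinct directions.
directions-odd : ∀ {u v₁ v₂ v₃} (s₁ : Step u v₁) (s₂ : Step u v₂) (s₃ : Step u v₃) → v₁ ≢ v₂ → v₁ ≢ v₃ → v₂ ≢ v₃ →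
  ((isEast s₃ ∧ (isSouth s₁ xor isSouth s₂)) xor (isNorth s₃ ∧ (isWest s₁ xor isWest s₂))) xor
  (((isEast s₂ ∧ (isSouth s₁ xor isSouth s₃)) xor (isNorth s₂ ∧ (isWest s₁ xor isWest s₃))) xor
   ((isEast s₁ ∧ (isSouth s₂ xor isSouth s₃)) xor (isNorth s₁ ∧ (isWest s₂ xor isWest s₃)))) ≡ true
directions-odd east east _ n _ _ = contradiction refl n
directions-odd west west _ n _ _ = contradiction refl n
directions-odd north north _ n _ _ = contradiction refl n
directions-odd south south _ n _ _ = contradiction refl n
directions-odd east _ east _ n _ = contradiction refl n
directions-odd west _ west _ n _ = contradiction refl n
directions-odd north _ north _ n _ = contradiction refl n
directions-odd south _ south _ n _ = contradiction refl n
directions-odd _ east east _ _ n = contradiction refl n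
directions-odd _ west west _ _ n = contradiction refl n
directions-odd _ north north _ _ n = contradiction refl n
directions-odd _ south south _ _ n = contradiction refl n
directions-odd east west north _ _ _ = refl
directions-odd east west south _ _ _ = refl
directions-odd east north west _ _ _ = refl
directions-odd east north south _ _ _ = refl
directions-odd east south west _ _ _ = refl
directions-odd east south north _ _ _ = refl
directions-odd west east north _ _ _ = refl
directions-odd west east south _ _ _ = refl
directions-odd west north east _ _ _ = refl
directions-odd west north south _ _ _ = refl
directions-odd west south east _ _ _ = refl
directions-odd west south north _ _ _ = refl
directions-odd north east west _ _ _ = refl
directions-odd north east south _ _ _ = refl
directions-odd north west east _ _ _ = refl
directions-odd north west south _ _ _ = refl
directions-odd north south east _ _ _ = refl
directions-odd north south west _ _ _ = refl
directions-odd south east west _ _ _ = refl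
directions-odd south east north _ _ _ = refl
directions-odd south west east _ _ _ = refl
directions-odd south west north _ _ _ = refl
directions-odd south north east _ _ _ = refl
directions-odd south north west _ _ _ = refl

-- Three walks in a connected set from a common point

-- `A` describes the arm without its start, so arms from one centre can be disjoint; the first step
-- stays visible because its direction matters later.
Arm : Pt → Pt → (Pt → Set) → Set
Arm u x A = u ≡ x ⊎ Σ Pt λ v → Step u v × Walk A v x

Arm-map : ∀ {u x} {A A′ : Pt → Set} → (∀ {z} → A z → A′ z) → Arm u x A → Arm u x A′
Arm-map f (inj₁ e) = inj₁ e
Arm-map f (inj₂ (v , s , w)) = inj₂ (v , s , walk-map f w)

extend : ∀ {u w x A} → Arm u w A → Step w x → Arm u x (λ z → A z ⊎ z ≡ x)
extend (inj₁ refl) s = inj₂ (_ , s , nil (inj₂ refl))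
extend (inj₂ (v , s′ , w)) s = inj₂ (v , s′ , walk-++ (walk-map inj₁ w) (cons (inj₁ (walk-end w)) s (nil (inj₂ refl))))

Visits : ∀ {P u v} → Walk P u v → Pt → Set
Visits p z = ∃ λ i → at p i ≡ z

self-walk : ∀ {P u v} (p : Walk P u v) → Walk (Visits p) u v
self-walk (nil _) = nil (zero , refl)
self-walk (cons _ s p) = cons (zero , refl) s (walk-map (λ (i , e) → suc i , e) (self-walk p))

record Split {P x y} (p : Walk P x y) (u : Pt) : Set₁ where
  field
    Left Right : Pt → Set
    to-start : Arm u x Left
    to-end : Arm u y Right
    Left-visits : ∀ {z} → Left z → Visits p z
    Right-visits : ∀ {z} → Right z → Visits p z
    Left-≢ : ∀ {z} → Left z → z ≢ u
    Right-≢ : ∀ {z} → Right z → z ≢ u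
    disjoint : ∀ {z} → Left z → ¬ Right z

split : ∀ {P x y} (p : Walk P x y) → Simple p → ∀ i → Split p (at p i)
split (nil _) _ zero = record
  { Left = λ _ → ⊥ ; Right = λ _ → ⊥ ; to-start = inj₁ refl ; to-end = inj₁ refl ; Left-visits = λ () ; Right-visits = λ ()
  ; Left-≢ = λ () ; Right-≢ = λ () ; disjoint = λ () }
split (cons {x} _ s p) (new , _) zero = record
  { Left = λ _ → ⊥ ; Right = Visits p ; to-start = inj₁ refl ; to-end = inj₂ (_ , s , self-walk p) ; Left-visits = λ ()
  ; Right-visits = λ (i , e) → suc i , e ; Left-≢ = λ () ; Right-≢ = λ { (i , refl) → new i } ; disjoint = λ () }
split (cons {x} _ s p) (new , simple) (suc i) = record
  { Left = λ z → Left z ⊎ z ≡ x ; Right = Right ; to-start = extend to-start (Step-sym s) ; to-end = to-end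
  ; Left-visits = λ { (inj₁ l) → let (j , e) = Left-visits l in suc j , e ; (inj₂ e) → zero , sym e }
  ; Right-visits = λ r → let (j , e) = Right-visits r in suc j , e
  ; Left-≢ = λ { (inj₁ l) → Left-≢ l ; (inj₂ refl) e → new i (sym e) }
  ; Right-≢ = Right-≢
  ; disjoint = λ { (inj₁ l) r → disjoint l r ; (inj₂ refl) r → let (j , e) = Right-visits r in new j e } }
  where open Split (split p simple i)

-- The walk ends on `p`; its part up to the first visit to `p`, reversed, is the arm.
first-hit : ∀ {P x y Q a} (p : Walk P x y) → Walk Q a x → Σ (Fin (suc (len p))) λ i → Arm (at p i) a (λ z → Q z × ¬ Visits p z)
first-hit {a = a} p w with Finₚ.any? (λ i → ≡-dec ℕₚ._≟_ ℕₚ._≟_ (at p i) a)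
... | yes (i , e) = i , inj₁ e
first-hit p (nil _) | no none = contradiction (zero , at-start p) none
first-hit {a = a} p (cons Qa s w) | no none with first-hit p w
... | i , arm = i , Arm-map (λ { (inj₁ q) → q ; (inj₂ refl) → Qa , none }) (extend arm (Step-sym s))

record Tripod (B : Pt → Set) (x : Fin 3 → Pt) : Set₁ where
  field
    centre : Pt
    centre∈ : B centre
    A : Fin 3 → Pt → Set
    arm : ∀ k → Arm centre (x k) (A k)
    A⊆B : ∀ k {z} → A k z → B z
    A-≢ : ∀ k {z} → A k z → z ≢ centre
    A-disjoint : ∀ k l {z} → k ≢ l → A k z → ¬ A l z

abstract
  -- A simple path joins the first two points; a walk from the third, stopped where it first meets
  -- the path, gives the centre and the third arm.
  tripod : ∀ {B : Pt → Set} (x : Fin 3 → Pt) → (∀ a b → B a → B b → Walk B a b) → (∀ k → B (x k)) → Tripod B x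
  tripod {B} x conn x∈ with simplify (conn (x zero) (x (suc zero)) (x∈ zero) (x∈ (suc zero)))
  ... | p , simple with first-hit p (conn (x (suc (suc zero))) (x zero) (x∈ _) (x∈ zero))
  ... | i , third = record
    { centre = at p i ; centre∈ = at-P p i ; A = A ; arm = arm ; A⊆B = A⊆B ; A-≢ = A-≢ ; A-disjoint = A-disjoint }
    where
    open Split (split p simple i)
    A : Fin 3 → Pt → Set
    A zero = Left
    A (suc zero) = Right
    A (suc (suc zero)) z = B z × ¬ Visits p z
    arm : ∀ k → Arm (at p i) (x k) (A k)
    arm zero = to-start
    arm (suc zero) = to-end
    arm (suc (suc zero)) = third
    visited : ∀ {z} → Visits p z → B z
    visited (j , refl) = at-P p j
    A⊆B : ∀ k {z} → A k z → B z
    A⊆B zero l = visited (Left-visits l)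
    A⊆B (suc zero) r = visited (Right-visits r)
    A⊆B (suc (suc zero)) = proj₁
    A-≢ : ∀ k {z} → A k z → z ≢ at p i
    A-≢ zero = Left-≢
    A-≢ (suc zero) = Right-≢
    A-≢ (suc (suc zero)) (_ , nv) refl = nv (i , refl)
    A-disjoint : ∀ k l {z} → k ≢ l → A k z → ¬ A l z
    A-disjoint zero zero ne _ _ = ne refl
    A-disjoint zero (suc zero) _ = disjoint
    A-disjoint zero (suc (suc zero)) _ l (_ , nv) = nv (Left-visits l)
    A-disjoint (suc zero) zero _ r l = disjoint l r
    A-disjoint (suc zero) (suc zero) ne _ _ = ne refl
    A-disjoint (suc zero) (suc (suc zero)) _ r (_ , nv) = nv (Right-visits r)
    A-disjoint (suc (suc zero)) zero _ (_ , nv) l = nv (Left-visits l)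
    A-disjoint (suc (suc zero)) (suc zero) _ (_ , nv) r = nv (Right-visits r)
    A-disjoint (suc (suc zero)) (suc (suc zero)) ne _ _ = ne refl

-- Let a, b, c, d, e be the branch sets. The winding parity of the triangle abc around d equals that around e, and
-- similarly for abd, acd and bcd; around e the four parities sum to zero because every path is used twice. Comparing
-- the four squares at the centre of the tripod in a towards b, c, d shows that the four parities sum to one.
module NoK₅ (B : Fin 5 → Pt → Set) (disj : ∀ k l {z} → k ≢ l → B k z → ¬ B l z)
  (conn : ∀ k x y → B k x → B k y → Walk (B k) x y)
  (touch : ∀ k l → k ≢ l → ∃ λ x → ∃ λ y → B k x × B l y × Step x y) where

  join : ∀ k l {x y} → k ≢ l → B k x → B l y → Walk (λ z → B k z ⊎ B l z) x y
  join k l {x} {y} ne Bx By with touch k l ne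
  ... | x′ , y′ , Bx′ , By′ , s = walk-++ (walk-map inj₁ (conn k x x′ Bx Bx′)) (cons (inj₁ Bx′) s (walk-map inj₂ (conn l y′ y By′ By)))

  ℓ : Fin 3 → Fin 5
  ℓ k = suc (inject₁ k)

  e : Fin 5
  e = suc (suc (suc (suc zero)))

  ℓ≢0 : ∀ k → ℓ k ≢ zero
  ℓ≢0 k ()

  ℓ≢e : ∀ k → ℓ k ≢ e
  ℓ≢e zero ()
  ℓ≢e (suc zero) ()
  ℓ≢e (suc (suc zero)) ()

  ℓ-≢ : ∀ {k l} → k ≢ l → ℓ k ≢ ℓ l
  ℓ-≢ ne q = ne (Finₚ.inject₁-injective (Finₚ.suc-injective q))

  exit : ∀ k → ∃ λ x → ∃ λ y → B zero x × B (ℓ k) y × Step x y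
  exit k = touch zero (ℓ k) (λ q → ℓ≢0 k (sym q))

  end : Fin 3 → Pt
  end k = proj₁ (proj₂ (exit k))

  end∈ : ∀ k → B (ℓ k) (end k)
  end∈ k = proj₁ (proj₂ (proj₂ (proj₂ (exit k))))

  open Tripod (tripod {B zero} (λ k → proj₁ (exit k)) (conn zero) (λ k → proj₁ (proj₂ (proj₂ (exit k)))))

  R : Fin 3 → Pt → Set
  R k z = A k z ⊎ B (ℓ k) z

  spoke : ∀ k → Σ Pt λ v → Step centre v × Walk (R k) v (end k)
  spoke k with extend (arm k) (proj₂ (proj₂ (proj₂ (proj₂ (exit k)))))
  ... | inj₁ q = contradiction (end∈ k) (disj zero (ℓ k) (λ q → ℓ≢0 k (sym q)) (subst (B zero) q centre∈))
  ... | inj₂ (v , s , w) = v , s , walk-map (λ { (inj₁ a) → inj₁ a ; (inj₂ refl) → inj₂ (end∈ k) }) w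

  first : Fin 3 → Pt
  first k = proj₁ (spoke k)

  spoke-step : ∀ k → Step centre (first k)
  spoke-step k = proj₁ (proj₂ (spoke k))

  spoke-rest : ∀ k → Walk (R k) (first k) (end k)
  spoke-rest k = proj₂ (proj₂ (spoke k))

  P : Fin 3 → Pt → Set
  P k z = z ≡ centre ⊎ R k z

  path : ∀ k → Walk (P k) centre (end k)
  path k = cons (inj₁ refl) (spoke-step k) (walk-map inj₂ (spoke-rest k))

  Q : Fin 3 → Fin 3 → Pt → Set
  Q k l z = B (ℓ k) z ⊎ B (ℓ l) z

  cross : ∀ k l → k ≢ l → Walk (Q k l) (end k) (end l)
  cross k l ne = join (ℓ k) (ℓ l) (ℓ-≢ ne) (end∈ k) (end∈ l)

  centre∉R : ∀ k → ¬ R k centre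
  centre∉R k (inj₁ a) = A-≢ k a refl
  centre∉R k (inj₂ b) = disj zero (ℓ k) (λ q → ℓ≢0 k (sym q)) centre∈ b

  R-disjoint : ∀ k l {z} → k ≢ l → R k z → ¬ R l z
  R-disjoint k l ne (inj₁ a) (inj₁ a′) = A-disjoint k l ne a a′
  R-disjoint k l ne (inj₁ a) (inj₂ b) = disj zero (ℓ l) (λ q → ℓ≢0 l (sym q)) (A⊆B k a) b
  R-disjoint k l ne (inj₂ b) (inj₁ a) = disj (ℓ k) zero (ℓ≢0 k) b (A⊆B l a)
  R-disjoint k l ne (inj₂ b) (inj₂ b′) = disj (ℓ k) (ℓ l) (ℓ-≢ ne) b b′

  first-≢ : ∀ k l → k ≢ l → first k ≢ first l
  first-≢ k l ne q = R-disjoint k l ne (walk-start (spoke-rest k)) (subst (R l) (sym q) (walk-start (spoke-rest l)))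

  R∉P : ∀ k l {z} → k ≢ l → R k z → ¬ P l z
  R∉P k l ne r (inj₁ refl) = centre∉R k r
  R∉P k l ne r (inj₂ r′) = R-disjoint k l ne r r′

  e∉P : ∀ l {z} → B e z → ¬ P l z
  e∉P l b (inj₁ refl) = disj e zero (λ ()) b centre∈
  e∉P l b (inj₂ (inj₁ a)) = disj e zero (λ ()) b (A⊆B l a)
  e∉P l b (inj₂ (inj₂ b′)) = disj e (ℓ l) (λ q → ℓ≢e l (sym q)) b b′

  tri : ∀ k l → k ≢ l → Loop
  tri k l ne = triangle (path k) (cross k l ne) (path l)

  outer-point : ∃ (B e)
  outer-point = let (x , _ , b , _) = touch e zero (λ ()) in x , b

  -- The rest of spoke j, continued through its branch set and that of e, reaches the outer point
  -- without touching the triangle.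
  around : ∀ k l j (ne : k ≢ l) → j ≢ k → j ≢ l → W (tri k l ne) (first j) ≡ W (tri k l ne) (proj₁ outer-point)
  around k l j ne jk jl = winding-constant (tri k l ne) {λ z → R j z ⊎ B e z} avoid
    (walk-++ (walk-map inj₁ (spoke-rest j)) (walk-map (λ { (inj₁ b) → inj₁ (inj₂ b) ; (inj₂ b) → inj₂ b })
      (join (ℓ j) e (ℓ≢e j) (end∈ j) (proj₂ outer-point))))
    where
    avoid : ∀ {z} → R j z ⊎ B e z → ¬ (P k z ⊎ (Q k l z ⊎ P l z))
    avoid (inj₁ r) (inj₁ p) = R∉P j k jk r p
    avoid (inj₁ r) (inj₂ (inj₁ (inj₁ b))) = R-disjoint j k jk r (inj₂ b)
    avoid (inj₁ r) (inj₂ (inj₁ (inj₂ b))) = R-disjoint j l jl r (inj₂ b)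
    avoid (inj₁ r) (inj₂ (inj₂ p)) = R∉P j l jl r p
    avoid (inj₂ b) (inj₁ p) = e∉P k b p
    avoid (inj₂ b) (inj₂ (inj₁ (inj₁ b′))) = disj e (ℓ k) (λ q → ℓ≢e k (sym q)) b b′
    avoid (inj₂ b) (inj₂ (inj₁ (inj₂ b′))) = disj e (ℓ l) (λ q → ℓ≢e l (sym q)) b b′
    avoid (inj₂ b) (inj₂ (inj₂ p)) = e∉P l b p

  first∉tri : ∀ k l j (ne : k ≢ l) → j ≢ k → j ≢ l → ¬ On (tri k l ne) (first j)
  first∉tri k l j ne jk jl (inj₁ p) = R∉P j k jk (walk-start (spoke-rest j)) p
  first∉tri k l j ne jk jl (inj₂ (inj₁ (inj₁ b))) = R-disjoint j k jk (walk-start (spoke-rest j)) (inj₂ b)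
  first∉tri k l j ne jk jl (inj₂ (inj₁ (inj₂ b))) = R-disjoint j l jl (walk-start (spoke-rest j)) (inj₂ b)
  first∉tri k l j ne jk jl (inj₂ (inj₂ p)) = R∉P j l jl (walk-start (spoke-rest j)) p

  centre-use : ∀ k l (ne : k ≢ l) →
    S-use (tri k l ne) centre ≡ isSouth (spoke-step k) xor isSouth (spoke-step l) ×
    W-use (tri k l ne) centre ≡ isWest (spoke-step k) xor isWest (spoke-step l)
  centre-use k l ne =
    let (a₁ , a₂) = first-use {P k} {R k} inj₂ (inj₁ refl) (spoke-step k) (spoke-rest k) (centre∉R k)
        (b₁ , b₂) = first-use {P l} {R l} inj₂ (inj₁ refl) (spoke-step l) (spoke-rest l) (centre∉R l)
        (c₁ , c₂) = unusedʷ (cross k l ne) centre (λ { (inj₁ b) → centre∉R k (inj₂ b) ; (inj₂ b) → centre∉R l (inj₂ b) })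
    in cong₂ _xor_ a₁ (cong₂ _xor_ c₁ b₁) , cong₂ _xor_ a₂ (cong₂ _xor_ c₂ b₂)

  -- The change of the triangle's parity from the square at the centre to that at `first j`: it
  -- counts the spokes k and l that run along the edge crossed.
  turn : Fin 3 → Fin 3 → Fin 3 → Bool
  turn k l j = (isEast (spoke-step j) ∧ (isSouth (spoke-step k) xor isSouth (spoke-step l))) xor
    (isNorth (spoke-step j) ∧ (isWest (spoke-step k) xor isWest (spoke-step l)))

  at-centre : ∀ k l j (ne : k ≢ l) → j ≢ k → j ≢ l →
    W (tri k l ne) (proj₁ outer-point) ≡ W (tri k l ne) centre xor turn k l j
  at-centre k l j ne jk jl = trans (sym (around k l j ne jk jl))
    (trans (step-winding (tri k l ne) (spoke-step j) (first∉tri k l j ne jk jl))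
      (cong₂ (λ s w → W (tri k l ne) centre xor ((isEast (spoke-step j) ∧ s) xor (isNorth (spoke-step j) ∧ w)))
        (proj₁ (centre-use k l ne)) (proj₂ (centre-use k l ne))))

  b c d : Fin 3
  b = zero
  c = suc zero
  d = suc (suc zero)

  base : Loop
  base = triangle (cross b c (λ ())) (cross c d (λ ())) (cross b d (λ ()))

  base-constant : W base (proj₁ outer-point) ≡ W base centre
  base-constant = winding-constant base {λ z → B e z ⊎ B zero z} avoid (join e zero (λ ()) (proj₂ outer-point) centre∈)
    where
    away : ∀ k {z} → B e z ⊎ B zero z → ¬ B (ℓ k) z
    away k (inj₁ b) b′ = disj e (ℓ k) (λ q → ℓ≢e k (sym q)) b b′
    away k (inj₂ b) b′ = disj zero (ℓ k) (λ q → ℓ≢0 k (sym q)) b b′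
    avoid : ∀ {z} → B e z ⊎ B zero z → ¬ (Q b c z ⊎ (Q c d z ⊎ Q b d z))
    avoid m (inj₁ (inj₁ q)) = away b m q
    avoid m (inj₁ (inj₂ q)) = away c m q
    avoid m (inj₂ (inj₁ (inj₁ q))) = away c m q
    avoid m (inj₂ (inj₁ (inj₂ q))) = away d m q
    avoid m (inj₂ (inj₂ (inj₁ q))) = away b m q
    avoid m (inj₂ (inj₂ (inj₂ q))) = away d m q

  bc bd cd : Loop
  bc = tri b c (λ ())
  bd = tri b d (λ ())
  cd = tri c d (λ ())

  even : ∀ z → W bc z xor (W bd z xor (W cd z xor W base z)) ≡ false
  even z = ==-sound (tautology 6 (λ { (p ∷ q ∷ r ∷ x ∷ y ∷ w ∷ []) →
      ((p xor (x xor q)) xor ((p xor (y xor r)) xor ((q xor (w xor r)) xor (x xor (w xor y))))) == false }) refl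
    (windingʷ (path b) z ∷ windingʷ (path c) z ∷ windingʷ (path d) z ∷
     windingʷ (cross b c (λ ())) z ∷ windingʷ (cross b d (λ ())) z ∷ windingʷ (cross c d (λ ())) z ∷ []))

  -- The four parities sum to zero at the outer point and at the centre alike. Their difference is
  -- the sum of the three turns, as `base` has the same parity at both.
  turns-even : turn b c d xor (turn b d c xor turn c d b) ≡ false
  turns-even = ==-sound (trans (sym (cong (_== false) total)) (cong (_== false) (even (proj₁ outer-point))))
    where
    o = proj₁ outer-point
    total : W bc o xor (W bd o xor (W cd o xor W base o)) ≡ turn b c d xor (turn b d c xor turn c d b)
    total = trans
      (cong₂ _xor_ (at-centre b c d (λ ()) (λ ()) (λ ()))
        (cong₂ _xor_ (at-centre b d c (λ ()) (λ ()) (λ ()))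
          (cong₂ _xor_ (at-centre c d b (λ ()) (λ ()) (λ ())) base-constant)))
      (trans (==-sound (tautology 7 (λ { (p ∷ q ∷ r ∷ s ∷ x ∷ y ∷ z ∷ []) →
          ((p xor x) xor ((q xor y) xor ((r xor z) xor s))) == ((p xor (q xor (r xor s))) xor (x xor (y xor z))) }) refl
          (W bc centre ∷ W bd centre ∷ W cd centre ∷ W base centre ∷ turn b c d ∷ turn b d c ∷ turn c d b ∷ [])))
        (cong (_xor (turn b c d xor (turn b d c xor turn c d b))) (even centre)))

  impossible : ⊥
  impossible = true≢false (trans (sym (directions-odd (spoke-step b) (spoke-step c) (spoke-step d)
    (first-≢ b c λ ()) (first-≢ b d λ ()) (first-≢ c d λ ()))) turns-even)

-- Grids of gadgets

step-axis : ∀ {x y X Y} → Step (x , y) (X , Y) → x ≡ X ⊎ y ≡ Y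
step-axis east = inj₂ refl
step-axis west = inj₂ refl
step-axis north = inj₁ refl
step-axis south = inj₁ refl

step-irrefl : ∀ {a} → ¬ Step a a
step-irrefl ()

step? : ∀ a b → Dec (Step a b)
step? (x , y) (X , Y) = map′ from to
  ((((suc x , y) ≟ᵖ (X , Y)) ⊎-dec (((x , suc y) ≟ᵖ (X , Y)) ⊎-dec (((suc X , Y) ≟ᵖ (x , y)) ⊎-dec ((X , suc Y) ≟ᵖ (x , y))))))
  where
  _≟ᵖ_ : (a b : Pt) → Dec (a ≡ b)
  _≟ᵖ_ = ≡-dec ℕₚ._≟_ ℕₚ._≟_
  from : (suc x , y) ≡ (X , Y) ⊎ ((x , suc y) ≡ (X , Y) ⊎ ((suc X , Y) ≡ (x , y) ⊎ (X , suc Y) ≡ (x , y))) → Step (x , y) (X , Y)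
  from (inj₁ refl) = east
  from (inj₂ (inj₁ refl)) = north
  from (inj₂ (inj₂ (inj₁ refl))) = west
  from (inj₂ (inj₂ (inj₂ refl))) = south
  to : Step (x , y) (X , Y) → (suc x , y) ≡ (X , Y) ⊎ ((x , suc y) ≡ (X , Y) ⊎ ((suc X , Y) ≡ (x , y) ⊎ (X , suc Y) ≡ (x , y)))
  to east = inj₁ refl
  to north = inj₂ (inj₁ refl)
  to west = inj₂ (inj₂ (inj₁ refl))
  to south = inj₂ (inj₂ (inj₂ refl))

heading : ∀ {a b} → Step a b → Fin 4
heading east = zero
heading west = suc zero
heading north = suc (suc zero)
heading south = suc (suc (suc zero))

heading-injective : ∀ {a b c} (s : Step a b) (s′ : Step a c) → heading s ≡ heading s′ → b ≡ c
heading-injective east east _ = refl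
heading-injective west west _ = refl
heading-injective north north _ = refl
heading-injective south south _ = refl
heading-injective east west ()
heading-injective east north ()
heading-injective east south ()
heading-injective west east ()
heading-injective west north ()
heading-injective west south ()
heading-injective north east ()
heading-injective north west ()
heading-injective north south ()
heading-injective south east ()
heading-injective south west ()
heading-injective south north ()

pt : ∀ {m} → Pos m → Pt
pt p = toℕ (proj₁ p) , toℕ (proj₂ p)

pt-injective : ∀ {m} {p q : Pos m} → pt p ≡ pt q → p ≡ q
pt-injective e = cong₂ _,_ (Finₚ.toℕ-injective (cong proj₁ e)) (Finₚ.toℕ-injective (cong proj₂ e))

grid : ∀ m → Skeleton m
grid m = record
  { joined = λ p q → ⌊ step? (pt p) (pt q) ⌋
  ; joined-sym = λ p q e → ⌊⌋-complete (step? (pt q) (pt p)) (Step-sym (⌊⌋-sound (step? (pt p) (pt q)) e))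
  ; joined-irrefl = λ p e → step-irrefl (⌊⌋-sound (step? (pt p) (pt p)) e)
  ; direction = λ p q → direction (step? (pt p) (pt q))
  ; direction-injective = λ p q q′ j j′ e → pt-injective (direction-injective (step? (pt p) (pt q)) (step? (pt p) (pt q′)) j j′ e)
  ; joined-line = λ p q e → on-common-line p q (step-axis (⌊⌋-sound (step? (pt p) (pt q)) e)) }
  where
  direction : ∀ {a b} → Dec (Step a b) → Fin 4
  direction (yes s) = heading s
  direction (no _) = zero
  direction-injective : ∀ {a b c} (s : Dec (Step a b)) (s′ : Dec (Step a c)) → ⌊ s ⌋ ≡ true → ⌊ s′ ⌋ ≡ true →
    direction s ≡ direction s′ → b ≡ c
  direction-injective (yes s) (yes s′) _ _ e = heading-injective s s′ e
  on-common-line : ∀ (p q : Pos m) → toℕ (proj₁ p) ≡ toℕ (proj₁ q) ⊎ toℕ (proj₂ p) ≡ toℕ (proj₂ q) → ∃ λ i → OnLine i p × OnLine i q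
  on-common-line p q (inj₁ e) = proj₁ p , inj₁ refl , inj₁ (sym (Finₚ.toℕ-injective e))
  on-common-line p q (inj₂ e) = proj₂ p , inj₂ refl , inj₂ (sym (Finₚ.toℕ-injective e))

K₅ : Graph
K₅ = record { n = 5 ; adj = λ u v → not ⌊ u ≟ v ⌋ ; adj-sym = sy ; adj-irrefl = irr }
  where
  sy : ∀ (u v : Fin 5) → not ⌊ u ≟ v ⌋ ≡ not ⌊ v ≟ u ⌋
  sy u v with u ≟ v | v ≟ u
  ... | yes _ | yes _ = refl
  ... | no _ | no _ = refl
  ... | yes e | no ne = contradiction (sym e) ne
  ... | no ne | yes e = contradiction (sym e) ne
  irr : ∀ (v : Fin 5) → not ⌊ v ≟ v ⌋ ≡ false
  irr v = cong not (⌊⌋-complete (v ≟ v) refl)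

K₅-edge : ∀ {u v} → u ≢ v → E K₅ u v
K₅-edge {u} {v} ne = cong not (¬true⇒false λ e → ne (⌊⌋-sound (u ≟ v) e))

IsMinor-iso : ∀ {M X Y} → Iso X Y → IsMinor M Y → IsMinor M X
IsMinor-iso {M} {X} {Y} (f , g , gf , fg , ad) (β , full , conn , edge) = β ∘ f ,
  (λ k → let (y , e) = full k in g y , trans (cong β (fg y)) e) ,
  (λ k x y ex ey → subst₂ (ReachIn X (λ z → β (f z) ≡ just k)) (gf x) (gf y) (pull (conn k (f x) (f y) ex ey))) ,
  λ a b e → let (x , y , exy , ex , ey) = edge a b e in
    g x , g y , pull-edge exy , trans (cong β (fg x)) ex , trans (cong β (fg y)) ey
  where
  pull-edge : ∀ {x y} → E Y x y → E X (g x) (g y)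
  pull-edge {x} {y} e = trans (ad (g x) (g y)) (trans (cong₂ (adj Y) (fg x) (fg y)) e)
  pull : ∀ {k x y} → ReachIn Y (λ z → β z ≡ just k) x y → ReachIn X (λ z → β (f z) ≡ just k) (g x) (g y)
  pull {x = x} (here e) = here (trans (cong β (fg x)) e)
  pull {x = x} (step e exy r) = step (trans (cong β (fg x)) e) (pull-edge exy) (pull r)

K₅-minor-free : GraphClass
K₅-minor-free = record { mem = λ X → ¬ IsMinor K₅ X ; iso-closed = λ {X} {Y} i nm mn → nm (IsMinor-iso {K₅} {X} {Y} i mn) }

-- From minors of gadget graphs to the plane grid

module GridMinor {m : ℕ} (β : V (Gadgets.graph (grid m)) → Maybe (Fin 5))
  (full : ∀ k → ∃ λ x → β x ≡ just k)
  (conn : ∀ k x y → β x ≡ just k → β y ≡ just k → ReachIn (Gadgets.graph (grid m)) (λ z → β z ≡ just k) x y)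
  (edge : ∀ a b → E K₅ a b → ∃ λ x → ∃ λ y → E (Gadgets.graph (grid m)) x y × β x ≡ just a × β y ≡ just b) where
  open Gadgets (grid m)

  pos : V graph → Pos m
  pos x = proj₁ (dec x)

  hubOf : Pos m → V graph
  hubOf p = enc (p , hub)

  hub-self : ∀ x → proj₂ (dec x) ≡ hub → hubOf (pos x) ≡ x
  hub-self x e = trans (cong (λ s → enc (pos x , s)) (sym e)) (enc-dec x)

  Adj-stays : ∀ {u v} → Adj u v → proj₂ u ≡ hub ⊎ proj₁ u ≡ proj₁ v
  Adj-stays hub-star = inj₂ refl
  Adj-stays star-hub = inj₂ refl
  Adj-stays (hub-leaf _) = inj₂ refl
  Adj-stays (leaf-hub _) = inj₂ refl
  Adj-stays (star-leaf _) = inj₂ refl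
  Adj-stays (leaf-star _) = inj₂ refl
  Adj-stays (hub-hub _) = inj₁ refl

  Adj-cases : ∀ {u v} → Adj u v → proj₁ u ≡ proj₁ v ⊎ Step (pt (proj₁ u)) (pt (proj₁ v))
  Adj-cases hub-star = inj₁ refl
  Adj-cases star-hub = inj₁ refl
  Adj-cases (hub-leaf _) = inj₁ refl
  Adj-cases (leaf-hub _) = inj₁ refl
  Adj-cases (star-leaf _) = inj₁ refl
  Adj-cases (leaf-star _) = inj₁ refl
  Adj-cases (hub-hub {p} {q} j) = inj₂ (⌊⌋-sound (step? (pt p) (pt q)) j)

  -- Edges between gadgets join hubs, so the walk meets the hub of its first gadget on leaving it or
  -- at its end.
  through-hub : ∀ {P : V graph → Set} {x y} → ReachIn graph P x y → proj₂ (dec y) ≡ hub → P (hubOf (pos x))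
  through-hub {P} {x} (here Px) e = subst P (sym (hub-self x e)) Px
  through-hub {P} {x} (step Px ex r) e with Adj-stays (hasEdge-sound ex)
  ... | inj₁ h = subst P (sym (hub-self x h)) Px
  ... | inj₂ q = subst (P ∘ hubOf) (sym q) (through-hub r e)

  stays : ∀ {P : V graph → Set} {x y} → ReachIn graph P x y → ¬ P (hubOf (pos x)) → pos y ≡ pos x
  stays (here _) _ = refl
  stays {P} {x} (step Px ex r) ¬h with Adj-stays (hasEdge-sound ex)
  ... | inj₁ h = contradiction (subst P (sym (hub-self x h)) Px) ¬h
  ... | inj₂ q = trans (stays r (subst (¬_ ∘ P ∘ hubOf) q ¬h)) (sym q)

  label? : ∀ x k → Dec (β x ≡ just k)
  label? x k = Maybeₚ.≡-dec _≟_ (β x) (just k)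

  default : Maybe (Fin 5) → Fin 5
  default (just k) = k
  default nothing = zero

  HasHub : Fin 5 → Set
  HasHub k = ∃ λ x → β x ≡ just k × proj₂ (dec x) ≡ hub

  -- A branch set without hub stays inside one gadget, and every other branch set has a vertex
  -- there. Those containing neither the hub nor the star centre of this gadget consist of its
  -- leaves. At least two of the five are left so, but leaves are pairwise nonadjacent.
  module Hubless (k : Fin 5) (none : ¬ HasHub k) where
    x₀ = proj₁ (full k)
    p = pos x₀

    no-hub : ∀ q → β (hubOf q) ≢ just k
    no-hub q e = none (hubOf q , e , cong proj₂ (dec-enc (q , hub)))

    k-stays : ∀ x → β x ≡ just k → pos x ≡ p
    k-stays x e = stays (conn k x₀ x (proj₂ (full k)) e) (no-hub p)

    neighbour-at-p : ∀ l → k ≢ l → ∃ λ y → β y ≡ just l × pos y ≡ p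
    neighbour-at-p l ne with edge k l (K₅-edge ne)
    ... | x , y , exy , ex , ey with Adj-stays (hasEdge-sound exy)
    ... | inj₁ h = contradiction (x , ex , h) none
    ... | inj₂ q = y , ey , trans (sym q) (k-stays x ex)

    Avoids : Fin 5 → Set
    Avoids l = k ≢ l × β (hubOf p) ≢ just l × β (enc (p , star)) ≢ just l

    l-leaf : ∀ l → Avoids l → ∀ x → β x ≡ just l → ∃ λ i → dec x ≡ (p , leaf i)
    l-leaf l (ne , nh , ns) x ex = go (proj₂ (dec x)) refl
      where
      px : pos x ≡ p
      px = let (y , ey , py) = neighbour-at-p l ne in
        trans (stays (conn l y x ey ex) (subst (λ q → β (hubOf q) ≢ just l) (sym py) nh)) py
      here-at : ∀ s → proj₂ (dec x) ≡ s → enc (p , s) ≡ x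
      here-at s e = trans (cong enc (cong₂ _,_ (sym px) (sym e))) (enc-dec x)
      go : ∀ s → proj₂ (dec x) ≡ s → ∃ λ i → dec x ≡ (p , leaf i)
      go hub e = contradiction (trans (cong β (here-at hub e)) ex) nh
      go star e = contradiction (trans (cong β (here-at star e)) ex) ns
      go (leaf i) e = i , cong₂ _,_ px e

    used : Fin 3 → Fin 5
    used zero = k
    used (suc zero) = default (β (hubOf p))
    used (suc (suc zero)) = default (β (enc (p , star)))

    default-≢ : ∀ {b l} → default b ≢ l → b ≢ just l
    default-≢ ne refl = ne refl

    avoids : ∀ l → (∀ i → used i ≢ l) → Avoids l
    avoids l ne = ne zero , default-≢ (ne (suc zero)) , default-≢ (ne (suc (suc zero)))

    impossible : ⊥
    impossible =
      -- Two further labels are found by pigeonhole; a default in `used` for an unlabelled hub or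
      -- star centre merely excludes one more label.
      let (l₁ , f₁) = free-colour {3} {4} (λ _ → true) used (s≤s (s≤s (s≤s z≤n)))
          (l₂ , f₂) = free-colour {4} {4} (λ _ → true) (λ { zero → l₁ ; (suc i) → used i }) ℕₚ.≤-refl
          (x , y , exy , ex , ey) = edge l₁ l₂ (K₅-edge (f₂ zero refl))
          (i , ei) = l-leaf l₁ (avoids l₁ (λ i → f₁ i refl)) x ex
          (j , ej) = l-leaf l₂ (avoids l₂ (λ i → f₂ (suc i) refl)) y ey
      in no-leaf-leaf (subst₂ Adj ei ej (hasEdge-sound exy))
      where
      no-leaf-leaf : ∀ {q i j} → ¬ Adj (q , leaf i) (q , leaf j)
      no-leaf-leaf ()

  has-hub : ∀ k → HasHub k
  has-hub k = decidable-stable (Finₚ.any? (λ x → label? x k ×-dec (proj₂ (dec x) ≟ hub))) (Hubless.impossible k)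

  hub-label : ∀ k x → β x ≡ just k → β (hubOf (pos x)) ≡ just k
  hub-label k x e = let (y , ey , h) = has-hub k in through-hub (conn k x y e ey) h

  B : Fin 5 → Pt → Set
  B k z = Σ (Pos m) λ p → pt p ≡ z × β (hubOf p) ≡ just k

  just-injective : ∀ {k l : Fin 5} → just k ≡ just l → k ≡ l
  just-injective refl = refl

  B-disjoint : ∀ k l {z} → k ≢ l → B k z → ¬ B l z
  B-disjoint k l ne (p , e , ek) (q , e′ , el) with pt-injective {m} {p} {q} (trans e (sym e′))
  ... | refl = ne (just-injective (trans (sym ek) el))

  -- Steps inside a gadget are contracted and steps between gadgets are unit steps; every position
  -- passed has its hub in the branch set.
  project : ∀ k {x y} → ReachIn graph (λ z → β z ≡ just k) x y → Walk (B k) (pt (pos x)) (pt (pos y))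
  project k {x} (here e) = nil (pos x , refl , hub-label k x e)
  project k {x} {y} (step e ex r) with Adj-cases (hasEdge-sound ex)
  ... | inj₁ q = subst (λ p → Walk (B k) (pt p) (pt (pos y))) (sym q) (project k r)
  ... | inj₂ s = cons (pos x , refl , hub-label k x e) s (project k r)

  B-connected : ∀ k z z′ → B k z → B k z′ → Walk (B k) z z′
  B-connected k _ _ (p , refl , ep) (q , refl , eq) = subst₂ (λ p q → Walk (B k) (pt p) (pt q))
    (cong proj₁ (dec-enc (p , hub))) (cong proj₁ (dec-enc (q , hub))) (project k (conn k (hubOf p) (hubOf q) ep eq))

  B-touch : ∀ k l → k ≢ l → ∃ λ z → ∃ λ z′ → B k z × B l z′ × Step z z′
  B-touch k l ne with edge k l (K₅-edge ne)
  ... | x , y , exy , ex , ey with Adj-cases (hasEdge-sound exy)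
  ... | inj₁ q = contradiction (just-injective (trans (sym (hub-label k x ex)) (trans (cong (β ∘ hubOf) q) (hub-label l y ey)))) ne
  ... | inj₂ s = _ , _ , (pos x , refl , hub-label k x ex) , (pos y , refl , hub-label l y ey) , s

  contradictory : ⊥
  contradictory = NoK₅.impossible B B-disjoint B-connected B-touch

grid-minor-free : ∀ m → ¬ IsMinor K₅ (Gadgets.graph (grid m))
grid-minor-free m (β , full , conn , edge) = GridMinor.contradictory β full conn edge

-- Components of connected graphs

Connected-iso : ∀ {X Y} → Iso X Y → Connected X → Connected Y
Connected-iso {X} {Y} (f , g , gf , fg , ad) conn u v = subst₂ (ReachIn Y (λ _ → ⊤)) (fg u) (fg v) (push (conn (g u) (g v)))
  where
  push : ∀ {x y} → ReachIn X (λ _ → ⊤) x y → ReachIn Y (λ _ → ⊤) (f x) (f y)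
  push (here _) = here tt
  push (step _ e r) = step tt (trans (sym (ad _ _)) e) (push r)

-- The image is nonempty and closed under adjacency, so by connectedness it is everything.
component-of-connected : ∀ {X Y} → Connected X → IsComponent Y X → Iso X Y
component-of-connected {X} {Y} conn (e , (e-inj , e-adj) , pos , _ , closed) =
  back , e , (λ x → proj₂ (onto x)) , (λ y → e-inj (proj₂ (onto (e y)))) ,
  λ u v → trans (cong₂ (adj X) (sym (proj₂ (onto u))) (sym (proj₂ (onto v)))) (sym (e-adj (back u) (back v)))
  where
  reach : ∀ {x y} → ReachIn X (λ _ → ⊤) x y → (∃ λ a → e a ≡ x) → ∃ λ b → e b ≡ y
  reach (here _) w = w
  reach (step _ ex r) (a , refl) = reach r (closed a _ ex)
  onto : ∀ x → ∃ λ b → e b ≡ x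
  onto x = reach (conn (e (fromℕ< pos)) x) (fromℕ< pos , refl)
  back : V X → V Y
  back x = proj₁ (onto x)

K₂-connected : Connected K₂
K₂-connected zero zero = here tt
K₂-connected zero (suc zero) = step tt refl (here tt)
K₂-connected (suc zero) zero = step tt refl (here tt)
K₂-connected (suc zero) (suc zero) = here tt

module GridClass = GadgetClass grid

module _ {m : ℕ} (i : Fin m) where
  open Gadgets (grid m)
  open GridClass using (place; place-edge; place-enum; position; position-on; place-position)

  Linked : V (member i) → V (member i) → Set
  Linked = ReachIn (member i) (λ _ → ⊤)

  hubAt : ∀ p → OnLine i p → V (member i)
  hubAt p on = place p on hub

  -- The position (i , i) is on line i both as row and as column; this lets the two branches of the
  -- line meet there.
  hubAt-irrelevant : ∀ p on on′ → hubAt p on ≡ hubAt p on′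
  hubAt-irrelevant p on on′ = enum-injective (line row col i) (trans (place-enum p on hub) (sym (place-enum p on′ hub)))

  to-hub : ∀ p on s → Linked (place p on s) (hubAt p on)
  to-hub p on hub = here tt
  to-hub p on star = step tt (place-edge on on star-hub) (here tt)
  to-hub p on (leaf l) with toℕ l <? α p
  ... | yes lt = step tt (place-edge on on (leaf-star lt)) (step tt (place-edge on on star-hub) (here tt))
  ... | no ge = step tt (place-edge on on (leaf-hub (ℕₚ.≮⇒≥ ge))) (here tt)

  hub-step : ∀ p q on on′ → Step (pt p) (pt q) → Linked (hubAt p on) (hubAt q on′)
  hub-step p q on on′ s = step tt (place-edge on on′ (hub-hub (⌊⌋-complete (step? (pt p) (pt q)) s))) (here tt)

along : ∀ {m} (i : Fin (suc m)) (f : Fin (suc m) → Pos (suc m)) (on : ∀ j → OnLine i (f j)) →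
  (∀ (j : Fin m) → Step (pt (f (suc j))) (pt (f (inject₁ j)))) → ∀ j → Linked i (hubAt i (f j) (on j)) (hubAt i (f zero) (on zero))
along i f on down = <-weakInduction (λ j → Linked i (hubAt i (f j) (on j)) (hubAt i (f zero) (on zero))) (here tt)
  (λ j r → reach-trans (hub-step i (f (suc j)) (f (inject₁ j)) (on (suc j)) (on (inject₁ j)) (down j)) r)

module _ {m : ℕ} (i : Fin (suc m)) where

  row-linked : ∀ j → Linked i (hubAt i (i , j) (inj₁ refl)) (hubAt i (i , zero) (inj₁ refl))
  row-linked = along i (i ,_) (λ _ → inj₁ refl)
    (λ j → subst (λ y → Step (toℕ i , suc (toℕ j)) (toℕ i , y)) (sym (Finₚ.toℕ-inject₁ j)) south)

  col-linked : ∀ j → Linked i (hubAt i (j , i) (inj₂ refl)) (hubAt i (zero , i) (inj₂ refl))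
  col-linked = along i (_, i) (λ _ → inj₂ refl)
    (λ j → subst (λ x → Step (suc (toℕ j) , toℕ i) (x , toℕ i)) (sym (Finₚ.toℕ-inject₁ j)) west)

  corner : V (Gadgets.member (grid (suc m)) i)
  corner = hubAt i (i , i) (inj₁ refl)

  hub-to-corner : ∀ p on → Linked i (hubAt i p on) corner
  hub-to-corner (.i , j) (inj₁ refl) = reach-trans (row-linked j) (reach-sym (row-linked i))
  hub-to-corner (j , .i) (inj₂ refl) = reach-trans (col-linked j)
    (subst (Linked i _) (hubAt-irrelevant i (i , i) (inj₂ refl) (inj₁ refl)) (reach-sym (col-linked i)))

  to-corner : ∀ y → Linked i y corner
  to-corner y = subst (λ z → Linked i z corner) (GridClass.place-position y (GridClass.position y) refl (GridClass.position-on y))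
    (reach-trans (to-hub i (proj₁ (GridClass.position y)) (GridClass.position-on y) (proj₂ (GridClass.position y)))
      (hub-to-corner (proj₁ (GridClass.position y)) (GridClass.position-on y)))

member-connected : ∀ m i → Connected (Gadgets.member (grid m) i)
member-connected (suc m) i u v = reach-trans (to-corner i u) (reach-sym (to-corner i v))

grid-class-connected : ∀ X → mem GridClass.𝒢 X → Connected X
grid-class-connected X (inj₁ iso) = Connected-iso {K₂} {X} iso K₂-connected
grid-class-connected X (inj₂ (m , i , iso)) = Connected-iso {Gadgets.member (grid m) i} {X} iso (member-connected m i)

grid-class-closed : ComponentClosed GridClass.𝒢
grid-class-closed X Y X∈ c = iso-closed GridClass.𝒢 {X} {Y} (component-of-connected {X} {Y} (grid-class-connected X X∈) c) X∈

grids-unbounded : ¬ Bounded GridClass.𝒢 K₅-minor-free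
grids-unbounded = GadgetClass.gadgets-unbounded grid {K₅-minor-free} (λ m → grid-minor-free (suc m))

theorem3 :
    ((𝒢 ℋ : GraphClass) → mem 𝒢 K₂ →
       ((Hereditary 𝒢 × BoundedMad 𝒢) ⊎ (Hereditary 𝒢 × BoundedChromatic ℋ)
          ⊎ (ComponentClosed 𝒢 × BoundedTreewidth ℋ)) →
       Bounded 𝒢 ℋ)
    × (Σ GraphClass λ 𝒢 → Σ GraphClass λ ℋ →
         mem 𝒢 K₂ × Monotone 𝒢 × BoundedChromatic 𝒢 × ¬ Bounded 𝒢 ℋ)
    × (Σ GraphClass λ 𝒢 → Σ GraphClass λ ℋ → Σ Graph λ M →
         mem 𝒢 K₂ × ComponentClosed 𝒢 × MinorFree M ℋ × ¬ Bounded 𝒢 ℋ)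
    × (Σ GraphClass λ 𝒢 → Σ GraphClass λ ℋ →
         mem 𝒢 K₂ × BoundedTreewidth ℋ × ¬ Bounded 𝒢 ℋ)
theorem3 =
  (λ { 𝒢 ℋ _ (inj₁ (her , mad)) → bounded-mad 𝒢 ℋ her mad
     ; 𝒢 ℋ _ (inj₂ (inj₁ (her , chr))) → bounded-chromatic 𝒢 ℋ her chr
     ; 𝒢 ℋ _ (inj₂ (inj₂ (closed , tw))) → bounded-treewidth 𝒢 ℋ closed tw }) ,
  (2-colourable , allGraphs , 2-colourable-K₂ , 2-colourable-monotone , (2 , λ _ c → c) , shift-unbounded) ,
  (GridClass.𝒢 , K₅-minor-free , K₅ , inj₁ (Iso-refl {K₂}) , grid-class-closed , (λ _ free → free) , grids-unbounded) ,
  (GadgetClass.𝒢 disconnected , treewidth-one , inj₁ (Iso-refl {K₂}) , (1 , λ _ D → D) , forests-unbounded)
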